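{- Fix $t \in \mathbb{N}$, let $m = m(n) := \binom{n}{\lfloor n/2 \rfloor}$, and let $s = s(n)$ be a sequence of positive integers such that $m/n^t \ll s \ll m/n^{t-1}$ as $n \to \infty$. Then the number of antichains of size exactly $s$ in $\mathcal{P}(n)$ is $\binom{(t+o(1))m}{s}$. That is, for every $\delta > 0$ and all sufficiently large $n$, the number of antichains of size $s$ in $\mathcal{P}(n)$ is at least $\binom{(t-\delta)m}{s}$ and at most $\binom{(t+\delta)m}{s}$.
   Context: $\mathbb{N} = \{1,2,\dots\}$. For $n \in \mathbb{N}$, $[n] = \{1,\dots,n\}$ and $\mathcal{P}(n)$ denotes the power set of $[n]$. A family $\mathcal{A} \subseteq \mathcal{P}(n)$ is an antichain if for any $A, B \in \mathcal{A}$ with $A \subseteq B$ we have $A = B$. For positive functions $a(n), b(n)$, the notation $a \ll b$ means $a(n)/b(n) \to 0$ as $n \to \infty$. The term $o(1)$ denotes a quantity tending to $0$ as $n \to \infty$ (with $t$ fixed). For real $x$ and a nonnegative integer $s$, $\binom{x}{s} = x(x-1)\cdots(x-s+1)/s!$.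
   Formalization: The lower bound is asserted only for δ ≤ t (for δ > 2t and even s the binomial with negative upper argument exceeds the number of antichains, so the literal claim fails); δ ranges over positive rationals, which is equivalent. -}

module Defs where

open import Data.Bool.Properties using () renaming (_≟_ to _≟ᵇ_)
open import Data.Fin using (Fin)
open import Data.Fin.Properties using (all?)
open import Data.Fin.Subset using (Subset; inside; outside; _∈_; _⊆_; ∣_∣)
open import Data.Fin.Subset.Properties using (_∈?_; _⊆?_)
import Data.Integer as ℤ
open import Data.Nat as ℕ using (ℕ; zero; suc; _^_; _!; ⌊_/2⌋; z≤n; s≤s)
open import Data.Nat.Combinatorics using (_C_; nCn≡1; nCk≡nC[n∸k]; nCk+nC[k+1]≡[n+1]C[k+1])
open import Data.Nat.Properties as ℕₚ using (m^n≢0; _!≢0; ⌊n/2⌋≤n)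
open import Data.Product using (∃; ∃-syntax; _×_; _,_)
open import Data.Rational as ℚ using (ℚ; 0ℚ; 1ℚ; Positive; _/_; _÷_; _*_; _-_)
open import Data.Rational.Properties as ℚₚ using (pos⇒nonZero; normalize-pos)
open import Data.Vec using (Vec; []; _∷_; map; concat; lookup; count)
open import Data.Vec.Properties using (≡-dec)
open import Relation.Binary.PropositionalEquality using (_≡_; refl; sym; trans; subst)
open import Relation.Nullary using (Dec)
open import Relation.Nullary.Decidable using (map′; _×-dec_; _→-dec_)

-- Every subset of an n-element set, each exactly once.
powerset : ∀ n → Vec (Subset n) (2 ^ n)
powerset zero    = [] ∷ []
powerset (suc n) =
  concat (map (λ side → map (side ∷_) (powerset n)) (outside ∷ inside ∷ []))

-- A family of subsets is a subset of the index set of `powerset n`.  As the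
-- indexing has no repetitions, ∣ 𝒜 ∣ is the number of members of 𝒜, and
-- `powerset (2 ^ n)` runs through every family exactly once.
Family : ℕ → Set
Family n = Subset (2 ^ n)

infix 4 _∈ᶠ_

_∈ᶠ_ : ∀ {n} → Subset n → Family n → Set
_∈ᶠ_ {n} A 𝒜 = ∃[ i ] i ∈ 𝒜 × lookup (powerset n) i ≡ A

Antichain : ∀ {n} → Family n → Set
Antichain {n} 𝒜 = ∀ {A B : Subset n} → A ∈ᶠ 𝒜 → B ∈ᶠ 𝒜 → A ⊆ B → A ≡ B

antichain? : ∀ {n} (𝒜 : Family n) → Dec (Antichain 𝒜)
antichain? {n} 𝒜 = map′
  (λ { h (i , i∈𝒜 , refl) (j , j∈𝒜 , refl) → h i j i∈𝒜 j∈𝒜 })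
  (λ h i j i∈𝒜 j∈𝒜 → h (i , i∈𝒜 , refl) (j , j∈𝒜 , refl))
  (all? λ i → all? λ j →
    (i ∈? 𝒜) →-dec (j ∈? 𝒜) →-dec (set i ⊆? set j) →-dec ≡-dec _≟ᵇ_ (set i) (set j))
  where
  set : Fin (2 ^ n) → Subset n
  set = lookup (powerset n)

#antichains : (n s : ℕ) → ℕ
#antichains n s = count (λ 𝒜 → antichain? {n} 𝒜 ×-dec (∣ 𝒜 ∣ ℕ.≟ s)) (powerset (2 ^ n))

fromℕ : ℕ → ℚ
fromℕ k = ℤ.+ k / 1

fallingFactorial : ℚ → ℕ → ℚ
fallingFactorial x zero    = 1ℚ
fallingFactorial x (suc k) = fallingFactorial x k * (x - fromℕ k)

binom : ℚ → ℕ → ℚ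
binom x s = fallingFactorial x s * (ℤ.+ 1 / s !) {{s !≢0}}

-- Sequences are indexed by n = 1, 2, …
record PosSeq : Set where
  field
    at  : (n : ℕ) .{{_ : ℕ.NonZero n}} → ℚ
    pos : (n : ℕ) .{{_ : ℕ.NonZero n}} → Positive (at n)

open PosSeq public

infix 4 _≪_

-- a(n)/b(n) → 0; no absolute value is needed since the quotient is positive.
_≪_ : PosSeq → PosSeq → Set
a ≪ b = ∀ (ε : ℚ) → 0ℚ ℚ.< ε → ∃[ N ] ∀ n .{{_ : ℕ.NonZero n}} → N ℕ.≤ n →
  (at a n ÷ at b n) {{pos⇒nonZero (at b n) {{pos b n}}}} ℚ.< ε

natSeq : (s : (n : ℕ) .{{_ : ℕ.NonZero n}} → ℕ) →
         ((n : ℕ) .{{_ : ℕ.NonZero n}} → ℕ.NonZero (s n)) → PosSeq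
natSeq s s≢0 .at  n = fromℕ (s n)
natSeq s s≢0 .pos n = normalize-pos (s n) 1 {{_}} {{s≢0 n}}

m : ℕ → ℕ
m n = n C ⌊ n /2⌋

nCk≢0 : ∀ {n k} → k ℕ.≤ n → ℕ.NonZero (n C k)
nCk≢0 {n} {zero} z≤n =
  subst ℕ.NonZero (sym (trans (nCk≡nC[n∸k] {zero} {n} z≤n) (nCn≡1 n))) _
nCk≢0 {suc n} {suc k} (s≤s k≤n) =
  subst ℕ.NonZero (nCk+nC[k+1]≡[n+1]C[k+1] n k)
    (ℕ.>-nonZero (ℕₚ.≤-trans (ℕ.>-nonZero⁻¹ (n C k) {{nCk≢0 k≤n}}) (ℕₚ.m≤m+n _ _)))

m/n^ : ℕ → PosSeq
m/n^ t .at  n = (ℤ.+ m n / n ^ t) {{m^n≢0 n t}}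
m/n^ t .pos n = normalize-pos (m n) (n ^ t) {{m^n≢0 n t}} {{nCk≢0 (⌊n/2⌋≤n n)}}

{-# OPTIONS --safe #-}
module Submission where

{-
Both bounds count independent sets of size s in the comparability graph of the subsets of [n].

Lower bound: the t middle layers contain (t - o(1)) m sets, and each of them is comparable to
only O(n^(t-1)) others.  As s n^(t-1) is small compared to m, choosing the members one at a
time leaves (t - o(1)) m candidates for every choice.

Upper bound: on a maximal chain, a family either has at most u members or has a pair at
distance at least u for each further member.  Averaging over all maximal chains shows that a
family in which every set is comparable to O(n^u) others has at most (u + o(1)) m members.
So as long as more than (t + o(1)) m candidates are left, one of them is comparable to many
others; branching on whether it is chosen, every choice discards Ω(n^t) candidates.  The
number of ordered choices of s members is then at most ((t + o(1)) m)^s times a factor 1 + 1/r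
for each discarded candidate, with r of order m/s, and this factor is (1 + o(1))^s in total.
From 2^n down to (t + 4) m candidates the branching uses u = t + 2, and below that u = t.
-}

open import Defs
open import Data.Bool using (Bool; true; false; if_then_else_; not; _∧_)
open import Data.Bool.Properties using () renaming (_≟_ to _≟ᵇ_)
open import Data.Empty using (⊥-elim)
open import Data.Fin as Fin using (Fin; zero; suc; combine)
open import Data.Fin.Properties using (all?; any?; combine-surjective)
open import Data.Fin.Subset.Properties
  using (_⊆?_; ⊆⊤; ∣⊤∣≡n; p⊆q⇒∣p∣≤∣q∣; drop-∷-⊆; ⊆-refl; ∣p∣≤n)
import Data.Integer as ℤ
import Data.Integer.Properties as ℤ
open import Data.List as List using (List; []; _∷_; _++_; allFin)
open import Data.List.Properties using (map-tabulate)
open import Data.Nat as ℕ using (ℕ; zero; suc; z≤n; s≤s; _!; _^_; _∸_; ⌊_/2⌋)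
open import Data.Nat.Combinatorics
  using (_C_; nCn≡1; nCk≡nC[n∸k]; nCk+nC[k+1]≡[n+1]C[k+1]; nCk≡n!/k![n-k]!; k![n∸k]!∣n!; [n-k]*[n-k-1]!≡[n-k]!)
open import Data.Nat.DivMod using (m/n*n≡m; m/n*n≤m; m≡m%n+[m/n]*n; m%n<n)
open import Data.Nat.Properties as ℕₚ using (_!≢0; m^n≢0)
open import Data.Nat.Tactic.RingSolver using (solve-∀)
open import Data.Product using (∃-syntax; _×_; _,_; proj₁; proj₂)
open import Data.Sum as Sum using (_⊎_; inj₁; inj₂)
open import Data.Vec as Vec using (Vec; []; _∷_; lookup; _[_]≔_; count; here)
open import Data.Vec.Properties
  using (lookup∘update; lookup∘update′; []=⇒lookup; lookup⇒[]=; lookup-concat; lookup-map; ≡-dec)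
open import Function using (_∘_; const)
open import Relation.Binary.PropositionalEquality hiding (J)
open import Relation.Nullary using (Dec; yes; no; ¬_; does)
open import Relation.Nullary.Decidable using (_×-dec_; _→-dec_; _⊎-dec_)
open import Relation.Unary using (Decidable)

-- The starting size forces two phases. Charging X discarded sets costs (1 + 1/r)^X, which is (1 +
-- o(1))^s only if r is large compared with X/s, and the recursion closes only if a choice discards
-- somewhat more than r sets. At the start X = 2^n, estimated by (n + 1) m, and the estimates used
-- ask for about n² m/s discarded sets per choice. As m/s is only known to be at most n^t / K,
-- degrees of order n^t do not reach this, while degrees of order n^(t+2) do. Those are guaranteed
-- only above (t + 4) m sets; from there on X = O(m), and degrees of order n^t suffice once K is a
-- large constant.
--
-- The error budget: e is twice the denominator of δ, so δ ≥ 2/e. One 1/e goes to the combinatorics,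
-- which compares s! times the count with ((t ± 1/e) m)^s. In the upper bound the other 1/e pays for
-- passing from powers to falling factorials, as i ≤ s ≤ m/e for every factor (t + δ) m - i.
-- Denominators are cleared throughout, so the counting is done in ℕ and ratios such as 1 + 1/r
-- appear as pairs `r`, `suc r`.

module Counting where

  open import Data.Fin.Subset using (Subset; inside; outside; _⊆_; ∣_∣; ⊤)
  open import Data.Nat using (_+_; _*_; _/_; _%_; _≤_; _<_)
  open import Data.Nat.Properties

  -- Finite sums and indicators

  ⟦_⟧ : Bool → ℕ
  ⟦ b ⟧ = if b then 1 else 0

  𝟙 : {P : Set} → Dec P → ℕ
  𝟙 d = ⟦ does d ⟧

  𝟙-yes : {P : Set} (d : Dec P) → P → 𝟙 d ≡ 1
  𝟙-yes (yes _) _ = refl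
  𝟙-yes (no ¬p) p = ⊥-elim (¬p p)

  𝟙-no : {P : Set} (d : Dec P) → ¬ P → 𝟙 d ≡ 0
  𝟙-no (yes p) ¬p = ⊥-elim (¬p p)
  𝟙-no (no _)  _  = refl

  𝟙-≤ : {P : Set} (d : Dec P) {k : ℕ} → (P → 1 ≤ k) → 𝟙 d ≤ k
  𝟙-≤ (yes p) h = h p
  𝟙-≤ (no _)  _ = z≤n

  𝟙-mono : {P Q : Set} (d : Dec P) (e : Dec Q) → (P → Q) → 𝟙 d ≤ 𝟙 e
  𝟙-mono d e f = 𝟙-≤ d λ p → ≤-reflexive (sym (𝟙-yes e (f p)))

  𝟙-cong : {P Q : Set} (d : Dec P) (e : Dec Q) → (P → Q) → (Q → P) → 𝟙 d ≡ 𝟙 e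
  𝟙-cong d e f g = ≤-antisym (𝟙-mono d e f) (𝟙-mono e d g)

  ⟦⟧≤1 : ∀ b → ⟦ b ⟧ ≤ 1
  ⟦⟧≤1 true  = s≤s z≤n
  ⟦⟧≤1 false = z≤n

  ∑ : {A : Set} → List A → (A → ℕ) → ℕ
  ∑ []       f = 0
  ∑ (x ∷ xs) f = f x + ∑ xs f

  module _ {A : Set} where

    ∑-mono : (xs : List A) {f g : A → ℕ} → (∀ x → f x ≤ g x) → ∑ xs f ≤ ∑ xs g
    ∑-mono []       h = z≤n
    ∑-mono (x ∷ xs) h = +-mono-≤ (h x) (∑-mono xs h)

    ∑-cong : (xs : List A) {f g : A → ℕ} → (∀ x → f x ≡ g x) → ∑ xs f ≡ ∑ xs g
    ∑-cong []       h = refl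
    ∑-cong (x ∷ xs) h = cong₂ _+_ (h x) (∑-cong xs h)

    ∑-zero : (xs : List A) {f : A → ℕ} → (∀ x → f x ≡ 0) → ∑ xs f ≡ 0
    ∑-zero []       h = refl
    ∑-zero (x ∷ xs) h = cong₂ _+_ (h x) (∑-zero xs h)

    ∑-+ : (xs : List A) (f g : A → ℕ) → ∑ xs (λ x → f x + g x) ≡ ∑ xs f + ∑ xs g
    ∑-+ []       f g = refl
    ∑-+ (x ∷ xs) f g = trans (cong (f x + g x +_) (∑-+ xs f g)) (lemma (f x) (g x) (∑ xs f) (∑ xs g))
      where
      lemma : ∀ a b c d → a + b + (c + d) ≡ a + c + (b + d)
      lemma = solve-∀

    ∑-*ˡ : (xs : List A) (c : ℕ) (f : A → ℕ) → ∑ xs (λ x → c * f x) ≡ c * ∑ xs f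
    ∑-*ˡ []       c f = sym (*-zeroʳ c)
    ∑-*ˡ (x ∷ xs) c f = trans (cong (c * f x +_) (∑-*ˡ xs c f)) (sym (*-distribˡ-+ c (f x) (∑ xs f)))

    ∑-*ʳ : (xs : List A) (c : ℕ) (f : A → ℕ) → ∑ xs (λ x → f x * c) ≡ ∑ xs f * c
    ∑-*ʳ xs c f = trans (∑-cong xs λ x → *-comm (f x) c) (trans (∑-*ˡ xs c f) (*-comm c _))

    ∑-++ : (xs ys : List A) (f : A → ℕ) → ∑ (xs ++ ys) f ≡ ∑ xs f + ∑ ys f
    ∑-++ []       ys f = refl
    ∑-++ (x ∷ xs) ys f = trans (cong (f x +_) (∑-++ xs ys f)) (sym (+-assoc (f x) _ _))

    ∑-map : {B : Set} (h : B → A) (ys : List B) (f : A → ℕ) → ∑ (List.map h ys) f ≡ ∑ ys (f ∘ h)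
    ∑-map h []       f = refl
    ∑-map h (y ∷ ys) f = cong (f (h y) +_) (∑-map h ys f)

  ∑-swap : {A B : Set} (xs : List A) (ys : List B) (f : A → B → ℕ) →
           ∑ xs (λ x → ∑ ys (f x)) ≡ ∑ ys (λ y → ∑ xs (λ x → f x y))
  ∑-swap []       ys f = sym (∑-zero ys λ _ → refl)
  ∑-swap (x ∷ xs) ys f =
    trans (cong (∑ ys (f x) +_) (∑-swap xs ys f)) (sym (∑-+ ys (f x) (λ y → ∑ xs (λ x → f x y))))

  ∑-Fin-suc : ∀ n (f : Fin (suc n) → ℕ) → ∑ (allFin (suc n)) f ≡ f zero + ∑ (allFin n) (f ∘ suc)
  ∑-Fin-suc n f = cong (f zero +_)
    (trans (cong (λ xs → ∑ xs f) (sym (map-tabulate (λ i → i) suc))) (∑-map suc (allFin n) f))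

  ∑-Fin-1 : ∀ n → ∑ (allFin n) (const 1) ≡ n
  ∑-Fin-1 zero    = refl
  ∑-Fin-1 (suc n) = trans (∑-Fin-suc n (const 1)) (cong suc (∑-Fin-1 n))

  term≤∑-Fin : ∀ n (f : Fin n → ℕ) i → f i ≤ ∑ (allFin n) f
  term≤∑-Fin (suc n) f zero    = ≤-trans (m≤m+n _ _) (≤-reflexive (sym (∑-Fin-suc n f)))
  term≤∑-Fin (suc n) f (suc i) = ≤-trans (term≤∑-Fin n (f ∘ suc) i)
    (≤-trans (m≤n+m _ (f zero)) (≤-reflexive (sym (∑-Fin-suc n f))))

  subsets : ∀ n → List (Subset n)
  subsets zero    = [] ∷ []
  subsets (suc n) = List.map (outside ∷_) (subsets n) ++ List.map (inside ∷_) (subsets n)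

  ∑-subsets-suc : ∀ n (f : Subset (suc n) → ℕ) →
    ∑ (subsets (suc n)) f ≡ ∑ (subsets n) (f ∘ (outside ∷_)) + ∑ (subsets n) (f ∘ (inside ∷_))
  ∑-subsets-suc n f = trans (∑-++ (List.map (outside ∷_) (subsets n)) _ f)
    (cong₂ _+_ (∑-map (outside ∷_) (subsets n) f) (∑-map (inside ∷_) (subsets n) f))

  -- Reindexing S ↦ S ∪ {v} between the sets avoiding v and those containing v.
  ∑-subsets-insert : ∀ n (v : Fin n) (f : Subset n → ℕ) →
    ∑ (subsets n) (λ S → ⟦ lookup S v ⟧ * f S) ≡
    ∑ (subsets n) (λ S → ⟦ not (lookup S v) ⟧ * f (S [ v ]≔ inside))
  ∑-subsets-insert (suc n) zero f = begin
    ∑ (subsets (suc n)) (λ S → ⟦ lookup S zero ⟧ * f S)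
      ≡⟨ ∑-subsets-suc n _ ⟩
    ∑ (subsets n) (λ _ → 0) + ∑ (subsets n) (λ S → 1 * f (inside ∷ S))
      ≡⟨ +-comm (∑ (subsets n) (λ _ → 0)) _ ⟩
    ∑ (subsets n) (λ S → 1 * f (inside ∷ S)) + ∑ (subsets n) (λ _ → 0)
      ≡⟨ ∑-subsets-suc n _ ⟨
    ∑ (subsets (suc n)) (λ S → ⟦ not (lookup S zero) ⟧ * f (S [ zero ]≔ inside)) ∎
    where open ≡-Reasoning
  ∑-subsets-insert (suc n) (suc v) f = begin
    ∑ (subsets (suc n)) (λ S → ⟦ lookup S (suc v) ⟧ * f S)
      ≡⟨ ∑-subsets-suc n _ ⟩
    _ ≡⟨ cong₂ _+_ (∑-subsets-insert n v (f ∘ (outside ∷_))) (∑-subsets-insert n v (f ∘ (inside ∷_))) ⟩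
    _ ≡⟨ ∑-subsets-suc n _ ⟨
    ∑ (subsets (suc n)) (λ S → ⟦ not (lookup S (suc v)) ⟧ * f (S [ suc v ]≔ inside)) ∎
    where open ≡-Reasoning

  ∣∣-∑ : ∀ {n} (S : Subset n) → ∣ S ∣ ≡ ∑ (allFin n) (λ v → ⟦ lookup S v ⟧)
  ∣∣-∑ {zero}  []          = refl
  ∣∣-∑ {suc n} (true  ∷ S) = trans (cong suc (∣∣-∑ S)) (sym (∑-Fin-suc n (λ v → ⟦ lookup (true ∷ S) v ⟧)))
  ∣∣-∑ {suc n} (false ∷ S) = trans (∣∣-∑ S) (sym (∑-Fin-suc n (λ v → ⟦ lookup (false ∷ S) v ⟧)))

  ∣insert∣ : ∀ {n} (S : Subset n) v → lookup S v ≡ false → ∣ S [ v ]≔ inside ∣ ≡ suc ∣ S ∣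
  ∣insert∣ (false ∷ S) zero    refl = refl
  ∣insert∣ (true  ∷ S) (suc v) e    = cong suc (∣insert∣ S v e)
  ∣insert∣ (false ∷ S) (suc v) e    = ∣insert∣ S v e

  -- The enumeration `powerset`

  ∑ᵛ : ∀ {A : Set} {k} → Vec A k → (A → ℕ) → ℕ
  ∑ᵛ xs f = ∑ (Vec.toList xs) f

  ∑ᵛ-++ : ∀ {A : Set} {k l} (xs : Vec A k) (ys : Vec A l) f → ∑ᵛ (xs Vec.++ ys) f ≡ ∑ᵛ xs f + ∑ᵛ ys f
  ∑ᵛ-++ []       ys f = refl
  ∑ᵛ-++ (x ∷ xs) ys f = trans (cong (f x +_) (∑ᵛ-++ xs ys f)) (sym (+-assoc (f x) _ _))

  ∑ᵛ-map : ∀ {A B : Set} {k} (h : B → A) (ys : Vec B k) f → ∑ᵛ (Vec.map h ys) f ≡ ∑ᵛ ys (f ∘ h)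
  ∑ᵛ-map h []       f = refl
  ∑ᵛ-map h (y ∷ ys) f = cong (f (h y) +_) (∑ᵛ-map h ys f)

  ∑ᵛ-powerset : ∀ n f → ∑ᵛ (powerset n) f ≡ ∑ (subsets n) f
  ∑ᵛ-powerset zero    f = refl
  ∑ᵛ-powerset (suc n) f = begin
    ∑ᵛ (Vec.map (outside ∷_) (powerset n) Vec.++ (Vec.map (inside ∷_) (powerset n) Vec.++ [])) f
      ≡⟨ ∑ᵛ-++ (Vec.map (outside ∷_) (powerset n)) _ f ⟩
    ∑ᵛ (Vec.map (outside ∷_) (powerset n)) f + ∑ᵛ (Vec.map (inside ∷_) (powerset n) Vec.++ []) f
      ≡⟨ cong₂ _+_ (trans (∑ᵛ-map (outside ∷_) (powerset n) f) (∑ᵛ-powerset n _))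
         (trans (∑ᵛ-++ (Vec.map (inside ∷_) (powerset n)) [] f)
           (trans (+-identityʳ _) (trans (∑ᵛ-map (inside ∷_) (powerset n) f) (∑ᵛ-powerset n _)))) ⟩
    ∑ (subsets n) (f ∘ (outside ∷_)) + ∑ (subsets n) (f ∘ (inside ∷_))
      ≡⟨ ∑-subsets-suc n f ⟨
    ∑ (subsets (suc n)) f ∎
    where open ≡-Reasoning

  ∑ᵛ-lookup : ∀ {A : Set} {k} (xs : Vec A k) f → ∑ (allFin k) (f ∘ lookup xs) ≡ ∑ᵛ xs f
  ∑ᵛ-lookup []       f = refl
  ∑ᵛ-lookup {k = suc k} (x ∷ xs) f = trans (∑-Fin-suc k _) (cong (f x +_) (∑ᵛ-lookup xs f))

  count-∑ᵛ : ∀ {A : Set} {P : A → Set} (P? : Decidable P) {k} (xs : Vec A k) →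
             count P? xs ≡ ∑ᵛ xs (𝟙 ∘ P?)
  count-∑ᵛ P? []       = refl
  count-∑ᵛ P? (x ∷ xs) with does (P? x)
  ... | true  = cong suc (count-∑ᵛ P? xs)
  ... | false = count-∑ᵛ P? xs

  members : ∀ n → Fin (2 ^ n) → Subset n
  members n = lookup (powerset n)

  side-index : Bool → Fin 2
  side-index false = zero
  side-index true  = suc zero

  index : ∀ {n} → Subset n → Fin (2 ^ n)
  index []      = zero
  index (b ∷ A) = combine (side-index b) (index A)

  members-combine : ∀ {n} b (i : Fin (2 ^ n)) → members (suc n) (combine (side-index b) i) ≡ b ∷ members n i
  members-combine {n} false i = trans (lookup-concat
    (Vec.map (λ side → Vec.map (side ∷_) (powerset n)) (outside ∷ inside ∷ [])) zero i) (lookup-map i _ (powerset n))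
  members-combine {n} true  i = trans (lookup-concat
    (Vec.map (λ side → Vec.map (side ∷_) (powerset n)) (outside ∷ inside ∷ [])) (suc zero) i) (lookup-map i _ (powerset n))

  index-members : ∀ n (i : Fin (2 ^ n)) → index (members n i) ≡ i
  index-members zero  zero = refl
  index-members (suc n) i with combine-surjective {2} {2 ^ n} i
  ... | zero     , k , refl = trans (cong index (members-combine {n} false k)) (cong (combine {2} zero) (index-members n k))
  ... | suc zero , k , refl = trans (cong index (members-combine {n} true k)) (cong (combine {2} (suc zero)) (index-members n k))

  members-injective : ∀ n {i j : Fin (2 ^ n)} → members n i ≡ members n j → i ≡ j
  members-injective n {i} {j} e = trans (sym (index-members n i)) (trans (cong index e) (index-members n j))

  ∑-members : ∀ n (f : Subset n → ℕ) → ∑ (allFin (2 ^ n)) (f ∘ members n) ≡ ∑ (subsets n) f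
  ∑-members n f = trans (∑ᵛ-lookup (powerset n) f) (∑ᵛ-powerset n f)

  members-index : ∀ {n} (A : Subset n) → members n (index A) ≡ A
  members-index []      = refl
  members-index (b ∷ A) = trans (members-combine b (index A)) (cong (b ∷_) (members-index A))

  -- Independent sets

  true≢false : true ≢ false
  true≢false ()

  ∈-insert : ∀ {n} (S : Subset n) v {i} → lookup S i ≡ true → lookup (S [ v ]≔ inside) i ≡ true
  ∈-insert S v {i} i∈S with i Fin.≟ v
  ... | yes refl = lookup∘update v S true
  ... | no  i≢v  = trans (lookup∘update′ i≢v S true) i∈S

  ∈-insert⁻ : ∀ {n} (S : Subset n) v {i} → i ≢ v → lookup (S [ v ]≔ inside) i ≡ true → lookup S i ≡ true
  ∈-insert⁻ S v i≢v i∈S = trans (sym (lookup∘update′ i≢v S true)) i∈S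

  size : ∀ {N} → (Fin N → Bool) → ℕ
  size {N} F = ∑ (allFin N) (λ v → ⟦ F v ⟧)

  size≤ : ∀ {N} (F : Fin N → Bool) → size F ≤ N
  size≤ {N} F = ≤-trans (∑-mono (allFin N) (⟦⟧≤1 ∘ F)) (≤-reflexive (∑-Fin-1 N))

  ∧-split : ∀ a b → ⟦ a ⟧ ≡ ⟦ a ∧ b ⟧ + ⟦ a ∧ not b ⟧
  ∧-split false _     = refl
  ∧-split true  true  = refl
  ∧-split true  false = refl

  size-split : ∀ {N} (F P : Fin N → Bool) →
    size F ≡ size (λ v → F v ∧ P v) + size (λ v → F v ∧ not (P v))
  size-split {N} F P = trans (∑-cong (allFin N) λ v → ∧-split (F v) (P v)) (∑-+ (allFin N) _ _)

  ∧-true : ∀ {a b} → a ≡ true → b ≡ true → a ∧ b ≡ true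
  ∧-true refl refl = refl

  ∧-trueˡ : ∀ a {b} → a ∧ b ≡ true → a ≡ true
  ∧-trueˡ true _ = refl

  not-does : {P : Set} (d : Dec P) → ¬ P → not (does d) ≡ true
  not-does (yes p) ¬p = ⊥-elim (¬p p)
  not-does (no _)  _  = refl

  does-yes : {P : Set} (d : Dec P) → P → does d ≡ true
  does-yes (yes _) _ = refl
  does-yes (no ¬p) p = ⊥-elim (¬p p)

  ∑-subsets-split : ∀ n v (f : Subset n → ℕ) → ∑ (subsets n) f ≡
    ∑ (subsets n) (λ S → ⟦ not (lookup S v) ⟧ * f S) +
    ∑ (subsets n) (λ S → ⟦ not (lookup S v) ⟧ * f (S [ v ]≔ inside))
  ∑-subsets-split n v f = begin
    ∑ (subsets n) f
      ≡⟨ ∑-cong (subsets n) (λ S → split (lookup S v) (f S)) ⟩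
    ∑ (subsets n) (λ S → ⟦ not (lookup S v) ⟧ * f S + ⟦ lookup S v ⟧ * f S)
      ≡⟨ ∑-+ (subsets n) _ _ ⟩
    _ ≡⟨ cong (∑ (subsets n) (λ S → ⟦ not (lookup S v) ⟧ * f S) +_) (∑-subsets-insert n v f) ⟩
    _ ∎
    where
    open ≡-Reasoning
    split : ∀ b k → k ≡ ⟦ not b ⟧ * k + ⟦ b ⟧ * k
    split true  k = sym (*-identityˡ k)
    split false k = sym (trans (+-identityʳ _) (*-identityˡ k))

  ∑-∣∣-0 : ∀ n → ∑ (subsets n) (λ S → 𝟙 (∣ S ∣ ℕ.≟ 0)) ≡ 1
  ∑-∣∣-0 zero    = refl
  ∑-∣∣-0 (suc n) = trans (∑-subsets-suc n _) (cong₂ _+_ (∑-∣∣-0 n) (∑-zero (subsets n) λ _ → refl))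

  module Graph {N : ℕ} (R : Fin N → Fin N → Set) (R? : ∀ i j → Dec (R i j))
               (R-refl : ∀ i → R i i) (R-sym : ∀ {i j} → R i j → R j i) where

    IsIndependent : (Fin N → Bool) → ℕ → Subset N → Set
    IsIndependent F s S =
      (∀ i → lookup S i ≡ true → F i ≡ true) ×
      (∀ i j → lookup S i ≡ true → lookup S j ≡ true → R i j → i ≡ j) ×
      ∣ S ∣ ≡ s

    isIndependent? : ∀ F s S → Dec (IsIndependent F s S)
    isIndependent? F s S =
      (all? λ i → (lookup S i ≟ᵇ true) →-dec (F i ≟ᵇ true)) ×-dec
      (all? λ i → all? λ j → (lookup S i ≟ᵇ true) →-dec ((lookup S j ≟ᵇ true) →-dec (R? i j →-dec (i Fin.≟ j)))) ×-dec
      (∣ S ∣ ℕ.≟ s)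

    #independent : (Fin N → Bool) → ℕ → ℕ
    #independent F s = ∑ (subsets N) (λ S → 𝟙 (isIndependent? F s S))

    -- The factor s! turns binom(x, s) into a product of s factors close to x, so that bounds become
    -- s-th powers and can be proved one chosen vertex at a time.
    #orderedIndependent : (Fin N → Bool) → ℕ → ℕ
    #orderedIndependent F s = s ! * #independent F s

    -- The closed neighbourhood is counted, v included.
    degree : (Fin N → Bool) → Fin N → ℕ
    degree F v = size (λ u → F u ∧ does (R? v u))

    infixl 6 _∖_ _∖N_
    _∖_ _∖N_ : (Fin N → Bool) → Fin N → (Fin N → Bool)
    (F ∖ v)  u = F u ∧ not (does (v Fin.≟ u))
    (F ∖N v) u = F u ∧ not (does (R? v u))

    size-∖ : ∀ F v → F v ≡ true → suc (size (F ∖ v)) ≤ size F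
    size-∖ F v v∈F = ≤-trans
      (+-monoˡ-≤ (size (F ∖ v)) (≤-trans
        (≤-reflexive (cong ⟦_⟧ (sym (∧-true v∈F (does-yes (v Fin.≟ v) refl)))))
        (term≤∑-Fin N (λ u → ⟦ F u ∧ does (v Fin.≟ u) ⟧) v)))
      (≤-reflexive (sym (size-split F (λ u → does (v Fin.≟ u)))))

    size-∖N : ∀ F v → degree F v + size (F ∖N v) ≡ size F
    size-∖N F v = sym (size-split F (λ u → does (R? v u)))

    #independent-mono : ∀ {F G} s → (∀ i → F i ≡ true → G i ≡ true) → #independent F s ≤ #independent G s
    #independent-mono {F} {G} s F⊆G = ∑-mono (subsets N) λ S →
      𝟙-mono (isIndependent? F s S) (isIndependent? G s S) λ (S⊆F , rest) → (λ i i∈S → F⊆G i (S⊆F i i∈S)) , rest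

    #independent-0 : ∀ F → #independent F 0 ≤ 1
    #independent-0 F = ≤-trans
      (∑-mono (subsets N) λ S → 𝟙-mono (isIndependent? F 0 S) (∣ S ∣ ℕ.≟ 0) (proj₂ ∘ proj₂))
      (≤-reflexive (∑-∣∣-0 N))

    #independent-deletion : ∀ F v s →
      #independent F (suc s) ≤ #independent (F ∖ v) (suc s) + #independent (F ∖N v) s
    #independent-deletion F v s = ≤-trans (≤-reflexive (∑-subsets-split N v _))
      (+-mono-≤ (∑-mono (subsets N) avoiding) (∑-mono (subsets N) containing))
      where
      avoiding : ∀ S → ⟦ not (lookup S v) ⟧ * 𝟙 (isIndependent? F (suc s) S) ≤ 𝟙 (isIndependent? (F ∖ v) (suc s) S)
      avoiding S with lookup S v in eq
      ... | true  = z≤n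
      ... | false = ≤-trans (≤-reflexive (*-identityˡ _))
        (𝟙-mono (isIndependent? F (suc s) S) (isIndependent? (F ∖ v) (suc s) S) λ (S⊆F , rest) →
          (λ i i∈S → ∧-true (S⊆F i i∈S) (not-does (v Fin.≟ i) λ { refl → true≢false (trans (sym i∈S) eq) })) , rest)
      containing : ∀ S → ⟦ not (lookup S v) ⟧ * 𝟙 (isIndependent? F (suc s) (S [ v ]≔ inside)) ≤ 𝟙 (isIndependent? (F ∖N v) s S)
      containing S with lookup S v in eq
      ... | true  = z≤n
      ... | false = ≤-trans (≤-reflexive (*-identityˡ _))
        (𝟙-mono (isIndependent? F (suc s) (S [ v ]≔ inside)) (isIndependent? (F ∖N v) s S) λ (S⊆F , indep , card) →
          (λ i i∈S → ∧-true (S⊆F i (∈-insert S v i∈S)) (not-does (R? v i) λ Rvi →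
            true≢false (trans (sym i∈S) (trans (cong (lookup S) (sym
              (indep v i (lookup∘update v S true) (∈-insert S v i∈S) Rvi))) eq)))) ,
          (λ i j i∈S j∈S → indep i j (∈-insert S v i∈S) (∈-insert S v j∈S)) ,
          suc-injective (trans (sym (∣insert∣ S v eq)) card))

    -- Double counting of the pairs v ∈ S′ with S′ independent, through S = S′ ∖ {v}.
    #independent-suc : ∀ F s → suc s * #independent F (suc s) ≡
      ∑ (subsets N) (λ S → ∑ (allFin N) λ v →
        ⟦ not (lookup S v) ⟧ * 𝟙 (isIndependent? F (suc s) (S [ v ]≔ inside)))
    #independent-suc F s = begin
      suc s * ∑ (subsets N) ind
        ≡⟨ ∑-*ˡ (subsets N) (suc s) ind ⟨
      ∑ (subsets N) (λ S → suc s * ind S)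
        ≡⟨ ∑-cong (subsets N) weigh ⟩
      ∑ (subsets N) (λ S → ∑ (allFin N) λ v → ⟦ lookup S v ⟧ * ind S)
        ≡⟨ ∑-swap (subsets N) (allFin N) _ ⟩
      ∑ (allFin N) (λ v → ∑ (subsets N) λ S → ⟦ lookup S v ⟧ * ind S)
        ≡⟨ ∑-cong (allFin N) (λ v → ∑-subsets-insert N v ind) ⟩
      ∑ (allFin N) (λ v → ∑ (subsets N) λ S → ⟦ not (lookup S v) ⟧ * ind (S [ v ]≔ inside))
        ≡⟨ ∑-swap (allFin N) (subsets N) _ ⟩
      _ ∎
      where
      open ≡-Reasoning
      ind : Subset N → ℕ
      ind S = 𝟙 (isIndependent? F (suc s) S)
      weigh : ∀ S → suc s * ind S ≡ ∑ (allFin N) λ v → ⟦ lookup S v ⟧ * ind S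
      weigh S = trans (lemma (isIndependent? F (suc s) S) (proj₂ ∘ proj₂))
        (trans (cong (_* ind S) (∣∣-∑ S)) (sym (∑-*ʳ (allFin N) (ind S) _)))
        where
        lemma : {P : Set} (d : Dec P) → (P → ∣ S ∣ ≡ suc s) → suc s * 𝟙 d ≡ ∣ S ∣ * 𝟙 d
        lemma (yes p) h = cong (_* 1) (sym (h p))
        lemma (no _)  _ = trans (*-zeroʳ (suc s)) (sym (*-zeroʳ ∣ S ∣))

    #orderedIndependent≤ : ∀ F s → #orderedIndependent F s ≤ size F ^ s
    #orderedIndependent≤ F zero    = ≤-trans (≤-reflexive (*-identityˡ _)) (#independent-0 F)
    #orderedIndependent≤ F (suc s) = begin
      suc s ! * #independent F (suc s)
        ≡⟨ rearrange (suc s) (s !) (#independent F (suc s)) ⟩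
      s ! * (suc s * #independent F (suc s))
        ≤⟨ *-monoʳ-≤ (s !) extend ⟩
      s ! * (size F * #independent F s)
        ≡⟨ rearrange₂ (s !) (size F) (#independent F s) ⟩
      size F * (s ! * #independent F s)
        ≤⟨ *-monoʳ-≤ (size F) (#orderedIndependent≤ F s) ⟩
      size F ^ suc s ∎
      where
      open ≤-Reasoning
      rearrange : ∀ a b c → a * b * c ≡ b * (a * c)
      rearrange = solve-∀
      rearrange₂ : ∀ a b c → a * (b * c) ≡ b * (a * c)
      rearrange₂ = solve-∀
      pointwise : ∀ S v → ⟦ not (lookup S v) ⟧ * 𝟙 (isIndependent? F (suc s) (S [ v ]≔ inside)) ≤
                          ⟦ F v ⟧ * 𝟙 (isIndependent? F s S)
      pointwise S v with lookup S v in eq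
      ... | true  = z≤n
      ... | false = ≤-trans (≤-reflexive (*-identityˡ _)) (𝟙-≤ (isIndependent? F (suc s) (S [ v ]≔ inside)) λ (S⊆F , indep , card) →
        ≤-reflexive (sym (cong₂ _*_ (cong ⟦_⟧ (S⊆F v (lookup∘update v S true))) (𝟙-yes (isIndependent? F s S)
          ((λ i i∈S → S⊆F i (∈-insert S v i∈S)) , (λ i j i∈S j∈S → indep i j (∈-insert S v i∈S) (∈-insert S v j∈S)) ,
           suc-injective (trans (sym (∣insert∣ S v eq)) card))))))
      extend : suc s * #independent F (suc s) ≤ size F * #independent F s
      extend = begin
        suc s * #independent F (suc s)
          ≡⟨ #independent-suc F s ⟩
        _ ≤⟨ ∑-mono (subsets N) (λ S → ∑-mono (allFin N) (pointwise S)) ⟩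
        ∑ (subsets N) (λ S → ∑ (allFin N) λ v → ⟦ F v ⟧ * 𝟙 (isIndependent? F s S))
          ≡⟨ ∑-cong (subsets N) (λ S → ∑-*ʳ (allFin N) (𝟙 (isIndependent? F s S)) _) ⟩
        ∑ (subsets N) (λ S → size F * 𝟙 (isIndependent? F s S))
          ≡⟨ ∑-*ˡ (subsets N) (size F) _ ⟩
        size F * #independent F s ∎

    -- Each vertex of F either extends S or lies in the closed neighbourhood of a member of S, and
    -- these neighbourhoods cover at most s d vertices. By `R-refl` they contain the members of S,
    -- which therefore need no term of their own.
    extensions : ∀ F s d → (∀ u → F u ≡ true → degree F u ≤ d) →
      size F * #independent F s ≤ suc s * #independent F (suc s) + s * d * #independent F s
    extensions F s d deg≤d = begin
      size F * #independent F s
        ≡⟨ ∑-*ˡ (subsets N) (size F) _ ⟨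
      ∑ (subsets N) (λ S → size F * 𝟙 (isIndependent? F s S))
        ≤⟨ ∑-mono (subsets N) (λ S → count-ext S (isIndependent? F s S)) ⟩
      ∑ (subsets N) (λ S → ext S + s * d * 𝟙 (isIndependent? F s S))
        ≡⟨ ∑-+ (subsets N) ext _ ⟩
      ∑ (subsets N) ext + ∑ (subsets N) (λ S → s * d * 𝟙 (isIndependent? F s S))
        ≡⟨ cong₂ _+_ (sym (#independent-suc F s)) (∑-*ˡ (subsets N) (s * d) _) ⟩
      suc s * #independent F (suc s) + s * d * #independent F s ∎
      where
      open ≤-Reasoning
      ext : Subset N → ℕ
      ext S = ∑ (allFin N) λ v → ⟦ not (lookup S v) ⟧ * 𝟙 (isIndependent? F (suc s) (S [ v ]≔ inside))
      module _ (S : Subset N) (good : IsIndependent F s S) where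
        S⊆F : ∀ i → lookup S i ≡ true → F i ≡ true
        S⊆F = proj₁ good
        indep : ∀ i j → lookup S i ≡ true → lookup S j ≡ true → R i j → i ≡ j
        indep = proj₁ (proj₂ good)
        near : Fin N → Fin N → ℕ
        near v u = ⟦ lookup S u ⟧ * ⟦ F v ∧ does (R? u v) ⟧
        insert-good : ∀ v → F v ≡ true → ¬ (∃[ u ] (lookup S u ≡ true × R u v)) →
                      lookup S v ≡ false → IsIndependent F (suc s) (S [ v ]≔ inside)
        insert-good v v∈F ¬near v∉S = sub , ind , trans (∣insert∣ S v v∉S) (cong suc (proj₂ (proj₂ good)))
          where
          sub : ∀ i → lookup (S [ v ]≔ inside) i ≡ true → F i ≡ true
          sub i i∈ with i Fin.≟ v
          ... | yes refl = v∈F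
          ... | no i≢v   = S⊆F i (∈-insert⁻ S v i≢v i∈)
          ind : ∀ i j → lookup (S [ v ]≔ inside) i ≡ true → lookup (S [ v ]≔ inside) j ≡ true → R i j → i ≡ j
          ind i j i∈ j∈ Rij with i Fin.≟ v | j Fin.≟ v
          ... | yes refl | yes refl = refl
          ... | yes refl | no j≢v   = ⊥-elim (¬near (j , ∈-insert⁻ S v j≢v j∈ , R-sym Rij))
          ... | no i≢v   | yes refl = ⊥-elim (¬near (i , ∈-insert⁻ S v i≢v i∈ , Rij))
          ... | no i≢v   | no j≢v   = indep i j (∈-insert⁻ S v i≢v i∈) (∈-insert⁻ S v j≢v j∈) Rij
        pointwise : ∀ v → ⟦ F v ⟧ ≤
          ⟦ not (lookup S v) ⟧ * 𝟙 (isIndependent? F (suc s) (S [ v ]≔ inside)) + ∑ (allFin N) (near v)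
        pointwise v with F v in v∈F
        ... | false = z≤n
        ... | true with any? (λ u → (lookup S u ≟ᵇ true) ×-dec R? u v)
        ...   | yes (u , u∈S , Ruv) = ≤-trans (≤-trans
                  (≤-reflexive (sym (cong₂ _*_ (cong ⟦_⟧ u∈S) (cong ⟦_⟧ (∧-true v∈F (does-yes (R? u v) Ruv))))))
                  (term≤∑-Fin N (near v) u))
                  (≤-trans (m≤n+m _ (⟦ not (lookup S v) ⟧ * 𝟙 (isIndependent? F (suc s) (S [ v ]≔ inside))))
                    (≤-reflexive (cong (λ b → ⟦ not (lookup S v) ⟧ * 𝟙 (isIndependent? F (suc s) (S [ v ]≔ inside)) +
                       ∑ (allFin N) (λ u → ⟦ lookup S u ⟧ * ⟦ b ∧ does (R? u v) ⟧)) v∈F)))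
        ...   | no ¬near with lookup S v in v∈S
        ...     | true  = ⊥-elim (¬near (v , v∈S , R-refl v))
        ...     | false = ≤-trans (≤-reflexive (sym (trans (*-identityˡ _)
                    (𝟙-yes (isIndependent? F (suc s) (S [ v ]≔ inside)) (insert-good v v∈F ¬near v∈S))))) (m≤m+n _ _)
        near-total : ∑ (allFin N) (λ v → ∑ (allFin N) (near v)) ≤ s * d
        near-total = begin
          ∑ (allFin N) (λ v → ∑ (allFin N) (near v))
            ≡⟨ ∑-swap (allFin N) (allFin N) near ⟩
          ∑ (allFin N) (λ u → ∑ (allFin N) λ v → near v u)
            ≡⟨ ∑-cong (allFin N) (λ u → ∑-*ˡ (allFin N) ⟦ lookup S u ⟧ _) ⟩
          ∑ (allFin N) (λ u → ⟦ lookup S u ⟧ * degree F u)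
            ≤⟨ ∑-mono (allFin N) bound ⟩
          ∑ (allFin N) (λ u → ⟦ lookup S u ⟧ * d)
            ≡⟨ ∑-*ʳ (allFin N) d _ ⟩
          ∑ (allFin N) (λ u → ⟦ lookup S u ⟧) * d
            ≡⟨ cong (_* d) (trans (sym (∣∣-∑ S)) (proj₂ (proj₂ good))) ⟩
          s * d ∎
          where
          bound : ∀ u → ⟦ lookup S u ⟧ * degree F u ≤ ⟦ lookup S u ⟧ * d
          bound u with lookup S u in u∈S
          ... | false = z≤n
          ... | true  = *-monoʳ-≤ 1 (deg≤d u (S⊆F u u∈S))
        count-ext′ : size F ≤ ext S + s * d
        count-ext′ = begin
          size F ≤⟨ ∑-mono (allFin N) pointwise ⟩
          _      ≡⟨ ∑-+ (allFin N) _ _ ⟩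
          ext S + ∑ (allFin N) (λ v → ∑ (allFin N) (near v)) ≤⟨ +-monoʳ-≤ (ext S) near-total ⟩
          ext S + s * d ∎
      count-ext : ∀ S (good? : Dec (IsIndependent F s S)) → size F * 𝟙 good? ≤ ext S + s * d * 𝟙 good?
      count-ext S (no _)     = ≤-trans (≤-reflexive (*-zeroʳ (size F))) z≤n
      count-ext S (yes good) = ≤-trans (≤-reflexive (*-identityʳ _)) (≤-trans (count-ext′ S good)
        (≤-reflexive (cong (ext S +_) (sym (*-identityʳ (s * d))))))

    -- The quotient a / e bounds from below the number of vertices still available after up to s₀
    -- choices, so each step of an ordered choice has at least a / e options.
    greedy : ∀ F a e d s₀ → (∀ u → F u ≡ true → degree F u ≤ d) → a + e * (s₀ * d) ≤ e * size F →
             ∀ s → s ≤ s₀ → a ^ s ≤ e ^ s * #orderedIndependent F s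
    greedy F a e d s₀ deg≤d room zero _ = ≤-trans one≤ (≤-reflexive (sym (trans (*-identityˡ _) (*-identityˡ _))))
      where
      one≤ : 1 ≤ #independent F 0
      one≤ = ≤-trans (≤-reflexive (sym (∑-∣∣-0 N))) (∑-mono (subsets N) λ S →
        𝟙-mono (∣ S ∣ ℕ.≟ 0) (isIndependent? F 0 S) λ ∣S∣≡0 →
          (λ i i∈S → ⊥-elim (empty S ∣S∣≡0 i i∈S)) , (λ i j i∈S _ _ → ⊥-elim (empty S ∣S∣≡0 i i∈S)) , ∣S∣≡0)
        where
        empty : ∀ {n} (S : Subset n) → ∣ S ∣ ≡ 0 → ∀ i → ¬ (lookup S i ≡ true)
        empty (false ∷ S) e (suc i) i∈S = empty S e i i∈S
    greedy F a e d s₀ deg≤d room (suc s) s<s₀ = begin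
      a * a ^ s
        ≤⟨ *-monoʳ-≤ a (greedy F a e d s₀ deg≤d room s (<⇒≤ s<s₀)) ⟩
      a * (e ^ s * (s ! * #independent F s))
        ≡⟨ rearrange a (e ^ s) (s !) (#independent F s) ⟩
      e ^ s * s ! * (a * #independent F s)
        ≤⟨ *-monoʳ-≤ (e ^ s * s !) (+-cancelʳ-≤ (e * (s * d) * #independent F s) _ _ step) ⟩
      e ^ s * s ! * (e * (suc s * #independent F (suc s)))
        ≡⟨ rearrange₂ (e ^ s) (s !) e (suc s) (#independent F (suc s)) ⟩
      e ^ suc s * #orderedIndependent F (suc s) ∎
      where
      open ≤-Reasoning
      rearrange : ∀ a b c d → a * (b * (c * d)) ≡ b * c * (a * d)
      rearrange = solve-∀
      rearrange₂ : ∀ p q e s i → p * q * (e * (s * i)) ≡ e * p * (s * q * i)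
      rearrange₂ = solve-∀
      rearrange₃ : ∀ e x y i → e * (x + y * i) ≡ e * x + e * y * i
      rearrange₃ = solve-∀
      step : a * #independent F s + e * (s * d) * #independent F s ≤
             e * (suc s * #independent F (suc s)) + e * (s * d) * #independent F s
      step = begin
        a * #independent F s + e * (s * d) * #independent F s
          ≡⟨ *-distribʳ-+ (#independent F s) a (e * (s * d)) ⟨
        (a + e * (s * d)) * #independent F s
          ≤⟨ *-monoˡ-≤ (#independent F s) (≤-trans (+-monoʳ-≤ a (*-monoʳ-≤ e (*-monoˡ-≤ d (<⇒≤ s<s₀)))) room) ⟩
        e * size F * #independent F s
          ≡⟨ *-assoc e (size F) _ ⟩
        e * (size F * #independent F s)
          ≤⟨ *-monoʳ-≤ e (extensions F s d deg≤d) ⟩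
        e * (suc s * #independent F (suc s) + s * d * #independent F s)
          ≡⟨ rearrange₃ e (suc s * #independent F (suc s)) (s * d) (#independent F s) ⟩
        e * (suc s * #independent F (suc s)) + e * (s * d) * #independent F s ∎

    -- Branching on a vertex v of large degree, according to whether v is in the
    -- independent set, costs a factor 1 + 1/r per vertex of F.
    branching : ∀ M₀ D M r s₀ a b → a ≤ b →
      s₀ * r * r ^ D ≤ suc r ^ D * M →
      (∀ F → M₀ < size F → ∃[ v ] (F v ≡ true × D < degree F v)) →
      (∀ F → size F ≤ M₀ → ∀ s → s ≤ s₀ → a * #orderedIndependent F s ≤ b * M ^ s) →
      ∀ k f → f ≤ k → ∀ F → size F ≤ f → ∀ s → s ≤ s₀ →
      a * r ^ f * #orderedIndependent F s ≤ b * suc r ^ f * M ^ s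
    branching M₀ D M r s₀ a b a≤b cost dense base k f f≤k F F≤f s s≤s₀ with size F ≤? M₀
    branching M₀ D M r s₀ a b a≤b cost dense base k f f≤k F F≤f s s≤s₀ | yes F≤M₀ = begin
      a * r ^ f * #orderedIndependent F s       ≡⟨ swap a (r ^ f) _ ⟩
      r ^ f * (a * #orderedIndependent F s)     ≤⟨ *-mono-≤ (^-monoˡ-≤ f (n≤1+n r)) (base F F≤M₀ s s≤s₀) ⟩
      suc r ^ f * (b * M ^ s)                   ≡⟨ swap b (suc r ^ f) _ ⟨
      b * suc r ^ f * M ^ s ∎
      where
      open ≤-Reasoning
      swap : ∀ a b c → a * b * c ≡ b * (a * c)
      swap = solve-∀
    branching M₀ D M r s₀ a b a≤b cost dense base k f f≤k F F≤f zero s≤s₀ | no _ =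
      *-mono-≤ (*-mono-≤ a≤b (^-monoˡ-≤ f (n≤1+n r))) (#orderedIndependent≤ F 0)
    branching M₀ D M r s₀ a b a≤b cost dense base k f f≤k F F≤f (suc s) s<s₀ | no F≰M₀
      with dense F (≰⇒> F≰M₀)
    -- Write f = suc D + l. Then D + l bounds the size of `F ∖ v`, and l bounds the size of
    -- `F ∖N v`, because more than D vertices go.
    ... | v , v∈F , D<deg with m≤n⇒∃[o]m+o≡n (≤-trans D<deg (≤-trans (m≤m+n _ _) (≤-trans (≤-reflexive (size-∖N F v)) F≤f)))
    -- The call at `l` is not structurally below `f`; the recursion descends on the bound `k`
    -- instead.
    ... | l , refl with k | f≤k
    ... | suc k′ | s≤s D+l≤k′ = begin
      a * (r * r ^ (D + l)) * (suc s ! * #independent F (suc s))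
        ≤⟨ *-monoʳ-≤ (a * (r * r ^ (D + l))) (*-monoʳ-≤ (suc s !) (#independent-deletion F v s)) ⟩
      a * (r * r ^ (D + l)) * (suc s ! * (i₁ + i₂))
        ≡⟨ cong (λ x → a * (r * x) * (suc s ! * (i₁ + i₂))) (^-distribˡ-+-* r D l) ⟩
      a * (r * (r ^ D * r ^ l)) * (suc s * s ! * (i₁ + i₂))
        ≡⟨ rearrange a r (r ^ D) (r ^ l) (suc s) (s !) i₁ i₂ ⟩
      r * (a * (r ^ D * r ^ l) * (suc s ! * i₁)) + suc s * r * r ^ D * (a * r ^ l * (s ! * i₂))
        -- With x = 1 + 1/r and s standing for `suc s`, the claim is x^(f-1) M^s + s x^(f-1-D)
        -- M^(s-1) ≤ x^f M^s. Since x - 1 = 1/r, this reduces to s r ≤ x^D M, which is `cost`.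
        ≤⟨ +-mono-≤ (*-monoʳ-≤ r ih₁) (*-mono-≤ (≤-trans (*-monoˡ-≤ (r ^ D) (*-monoˡ-≤ r s<s₀)) cost) ih₂) ⟩
      r * (b * (suc r ^ D * suc r ^ l) * M ^ suc s) + suc r ^ D * M * (b * suc r ^ l * M ^ s)
        ≡⟨ rearrange₂ r b (suc r ^ D) (suc r ^ l) M (M ^ s) ⟩
      b * (suc r * (suc r ^ D * suc r ^ l)) * M ^ suc s
        ≡⟨ cong (λ x → b * (suc r * x) * M ^ suc s) (^-distribˡ-+-* (suc r) D l) ⟨
      b * suc r ^ (suc D + l) * M ^ suc s ∎
      where
      open ≤-Reasoning
      i₁ i₂ : ℕ
      i₁ = #independent (F ∖ v) (suc s)
      i₂ = #independent (F ∖N v) s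
      rearrange : ∀ a r p q t u x y → a * (r * (p * q)) * (t * u * (x + y)) ≡
        r * (a * (p * q) * (t * u * x)) + t * r * p * (a * q * (u * y))
      rearrange = solve-∀
      rearrange₂ : ∀ r b p q m z → r * (b * (p * q) * (m * z)) + p * m * (b * q * z) ≡
        b * ((1 + r) * (p * q)) * (m * z)
      rearrange₂ = solve-∀
      ih₁ : a * (r ^ D * r ^ l) * (suc s ! * i₁) ≤ b * (suc r ^ D * suc r ^ l) * M ^ suc s
      ih₁ = subst₂ (λ x y → a * x * (suc s ! * i₁) ≤ b * y * M ^ suc s)
        (^-distribˡ-+-* r D l) (^-distribˡ-+-* (suc r) D l)
        (branching M₀ D M r s₀ a b a≤b cost dense base k′ (D + l) D+l≤k′ (F ∖ v)
          (ℕ.s≤s⁻¹ (≤-trans (size-∖ F v v∈F) F≤f)) (suc s) s<s₀)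
      ih₂ : a * r ^ l * (s ! * i₂) ≤ b * suc r ^ l * M ^ s
      ih₂ = branching M₀ D M r s₀ a b a≤b cost dense base k′ l (≤-trans (m≤n+m l D) D+l≤k′) (F ∖N v)
        (+-cancelˡ-≤ (suc D) _ _ (≤-trans (+-monoˡ-≤ (size (F ∖N v)) D<deg) (≤-trans (≤-reflexive (size-∖N F v)) F≤f)))
        s (<⇒≤ s<s₀)

  -- Inclusion and cardinality of subsets

  ⊆-lookup : ∀ {n} {A B : Subset n} → A ⊆ B → ∀ v → lookup A v ≡ true → lookup B v ≡ true
  ⊆-lookup {A = A} A⊆B v v∈A = []=⇒lookup (A⊆B (lookup⇒[]= v A v∈A))

  lookup-⊆ : ∀ {n} {A B : Subset n} → (∀ v → lookup A v ≡ true → lookup B v ≡ true) → A ⊆ B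
  lookup-⊆ {B = B} h {v} v∈A = lookup⇒[]= v B (h v ([]=⇒lookup v∈A))

  ⊆∧∣∣≡⇒≡ : ∀ {n} {A B : Subset n} → A ⊆ B → ∣ A ∣ ≡ ∣ B ∣ → A ≡ B
  ⊆∧∣∣≡⇒≡ {A = []}        {[]}        _   _ = refl
  ⊆∧∣∣≡⇒≡ {A = true  ∷ A} {true  ∷ B} A⊆B e = cong (true ∷_) (⊆∧∣∣≡⇒≡ (drop-∷-⊆ A⊆B) (suc-injective e))
  ⊆∧∣∣≡⇒≡ {A = false ∷ A} {false ∷ B} A⊆B e = cong (false ∷_) (⊆∧∣∣≡⇒≡ (drop-∷-⊆ A⊆B) e)
  ⊆∧∣∣≡⇒≡ {A = true  ∷ A} {false ∷ B} A⊆B e with () ← []=⇒lookup (A⊆B here)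
  ⊆∧∣∣≡⇒≡ {A = false ∷ A} {true  ∷ B} A⊆B e =
    ⊥-elim (<-irrefl e (s≤s (p⊆q⇒∣p∣≤∣q∣ (drop-∷-⊆ A⊆B))))

  ∑-∣∖∣ : ∀ {n} {A B : Subset n} → A ⊆ B →
          ∑ (allFin n) (λ v → ⟦ lookup B v ∧ not (lookup A v) ⟧) ≡ ∣ B ∣ ∸ ∣ A ∣
  ∑-∣∖∣ {n} {A} {B} A⊆B = sym (begin
    ∣ B ∣ ∸ ∣ A ∣
      ≡⟨ cong₂ _∸_ (trans (∣∣-∑ B) (size-split (lookup B) (lookup A))) (trans (∣∣-∑ A) (∑-cong (allFin n) meet)) ⟩
    size (λ v → lookup B v ∧ lookup A v) + _ ∸ size (λ v → lookup B v ∧ lookup A v)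
      ≡⟨ m+n∸m≡n (size (λ v → lookup B v ∧ lookup A v)) _ ⟩
    _ ∎)
    where
    open ≡-Reasoning
    meet : ∀ v → ⟦ lookup A v ⟧ ≡ ⟦ lookup B v ∧ lookup A v ⟧
    meet v with lookup A v in v∈A
    ... | true  rewrite ⊆-lookup A⊆B v v∈A = refl
    ... | false with lookup B v
    ...   | true  = refl
    ...   | false = refl

  _≟ˢ_ : ∀ {n} (A B : Subset n) → Dec (A ≡ B)
  _≟ˢ_ = ≡-dec _≟ᵇ_

  ∑-subsets-≡ : ∀ {n} (B : Subset n) (f : Subset n → ℕ) → ∑ (subsets n) (λ A → 𝟙 (A ≟ˢ B) * f A) ≡ f B
  ∑-subsets-≡ []          f = trans (+-identityʳ _) (*-identityˡ _)
  ∑-subsets-≡ {suc n} (true  ∷ B) f = trans (∑-subsets-suc n _) (cong₂ _+_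
    (∑-zero (subsets n) λ A → cong (_* f (false ∷ A)) (𝟙-no ((false ∷ A) ≟ˢ (true ∷ B)) λ ()))
    (trans (∑-cong (subsets n) λ A → cong (_* f (true ∷ A))
      (𝟙-cong ((true ∷ A) ≟ˢ (true ∷ B)) (A ≟ˢ B) (λ { refl → refl }) (cong (true ∷_))))
      (∑-subsets-≡ B (f ∘ (true ∷_)))))
  ∑-subsets-≡ {suc n} (false ∷ B) f = trans (∑-subsets-suc n _) (trans (cong₂ _+_
    (trans (∑-cong (subsets n) λ A → cong (_* f (false ∷ A))
      (𝟙-cong ((false ∷ A) ≟ˢ (false ∷ B)) (A ≟ˢ B) (λ { refl → refl }) (cong (false ∷_))))
      (∑-subsets-≡ B (f ∘ (false ∷_))))
    (∑-zero (subsets n) λ A → cong (_* f (true ∷ A)) (𝟙-no ((true ∷ A) ≟ˢ (false ∷ B)) λ ())))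
    (+-identityʳ _))

  ∣remove∣ : ∀ {n} (B : Subset n) v → lookup B v ≡ true → suc ∣ B [ v ]≔ outside ∣ ≡ ∣ B ∣
  ∣remove∣ (true  ∷ B) zero    refl = refl
  ∣remove∣ (true  ∷ B) (suc v) e    = cong suc (∣remove∣ B v e)
  ∣remove∣ (false ∷ B) (suc v) e    = ∣remove∣ B v e

  -- Maximal chains of subsets

  -- Sum of G over the maximal chains B ⊃ … ⊃ ∅, written as lists, where k = ∣ B ∣.
  chainSum : ∀ {n} → ℕ → Subset n → (List (Subset n) → ℕ) → ℕ
  chainSum     zero    B G = G (B ∷ [])
  chainSum {n} (suc k) B G =
    ∑ (allFin n) λ v → ⟦ lookup B v ⟧ * chainSum k (B [ v ]≔ outside) (λ c → G (B ∷ c))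

  data Levels {n} : ℕ → List (Subset n) → Set where
    [_]  : ∀ {B} → ∣ B ∣ ≡ 0 → Levels 0 (B ∷ [])
    _∷_  : ∀ {B k c} → ∣ B ∣ ≡ suc k → Levels k c → Levels (suc k) (B ∷ c)

  -- The summand also sees the rest of the chain below its set, so that sums over pairs on a chain
  -- are again of the form `tot`.
  tot : ∀ {n} → (Subset n → List (Subset n) → ℕ) → List (Subset n) → ℕ
  tot g []      = 0
  tot g (B ∷ c) = g B c + tot g c

  tot-mono : ∀ {n} {g h : Subset n → List (Subset n) → ℕ} → (∀ A c → g A c ≤ h A c) → ∀ c → tot g c ≤ tot h c
  tot-mono g≤h []      = z≤n
  tot-mono g≤h (A ∷ c) = +-mono-≤ (g≤h A c) (tot-mono g≤h c)

  +-interchange : ∀ a b c d → a + b + (c + d) ≡ a + c + (b + d)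
  +-interchange = solve-∀

  tot-+ : ∀ {n} (g h : Subset n → List (Subset n) → ℕ) c → tot (λ A c → g A c + h A c) c ≡ tot g c + tot h c
  tot-+ g h []      = refl
  tot-+ g h (A ∷ c) = trans (cong (g A c + h A c +_) (tot-+ g h c)) (+-interchange (g A c) (h A c) (tot g c) (tot h c))

  ⟦⟧*-mono : ∀ b {x y} → (b ≡ true → x ≤ y) → ⟦ b ⟧ * x ≤ ⟦ b ⟧ * y
  ⟦⟧*-mono true  h = *-monoʳ-≤ 1 (h refl)
  ⟦⟧*-mono false h = z≤n

  ⟦⟧*-cong : ∀ b {x y} → (b ≡ true → x ≡ y) → ⟦ b ⟧ * x ≡ ⟦ b ⟧ * y
  ⟦⟧*-cong true  h = cong (1 *_) (h refl)
  ⟦⟧*-cong false h = refl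

  module _ {n : ℕ} where

    chainSum-mono : ∀ k (B : Subset n) {G H} → ∣ B ∣ ≡ k → (∀ c → Levels k c → G c ≤ H c) →
                    chainSum k B G ≤ chainSum k B H
    chainSum-mono zero    B e G≤H = G≤H _ [ e ]
    chainSum-mono (suc k) B e G≤H = ∑-mono (allFin n) λ v → ⟦⟧*-mono (lookup B v) λ v∈B →
      chainSum-mono k (B [ v ]≔ outside) (suc-injective (trans (∣remove∣ B v v∈B) e)) λ c lv → G≤H (B ∷ c) (e ∷ lv)

    chainSum-+ : ∀ k (B : Subset n) G H → chainSum k B (λ c → G c + H c) ≡ chainSum k B G + chainSum k B H
    chainSum-+ zero    B G H = refl
    chainSum-+ (suc k) B G H = trans
      (∑-cong (allFin n) λ v → trans (cong (⟦ lookup B v ⟧ *_) (chainSum-+ k (B [ v ]≔ outside) _ _))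
        (*-distribˡ-+ ⟦ lookup B v ⟧ _ _))
      (∑-+ (allFin n) _ _)

    chainSum-*ˡ : ∀ k (B : Subset n) x G → chainSum k B (λ c → x * G c) ≡ x * chainSum k B G
    chainSum-*ˡ zero    B x G = refl
    chainSum-*ˡ (suc k) B x G = trans
      (∑-cong (allFin n) λ v → trans (cong (⟦ lookup B v ⟧ *_) (chainSum-*ˡ k (B [ v ]≔ outside) x _))
        (swap ⟦ lookup B v ⟧ x _))
      (∑-*ˡ (allFin n) x _)
      where
      swap : ∀ a b c → a * (b * c) ≡ b * (a * c)
      swap = solve-∀

    chainSum-const : ∀ k (B : Subset n) x → ∣ B ∣ ≡ k → chainSum k B (const x) ≡ k ! * x
    chainSum-const zero    B x e = sym (*-identityˡ x)
    chainSum-const (suc k) B x e = begin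
      ∑ (allFin n) (λ v → ⟦ lookup B v ⟧ * chainSum k (B [ v ]≔ outside) (const x))
        ≡⟨ ∑-cong (allFin n) (λ v → ⟦⟧*-cong (lookup B v) λ v∈B →
             chainSum-const k (B [ v ]≔ outside) x (suc-injective (trans (∣remove∣ B v v∈B) e))) ⟩
      ∑ (allFin n) (λ v → ⟦ lookup B v ⟧ * (k ! * x))
        ≡⟨ ∑-*ʳ (allFin n) (k ! * x) _ ⟩
      ∑ (allFin n) (λ v → ⟦ lookup B v ⟧) * (k ! * x)
        ≡⟨ cong (_* (k ! * x)) (trans (sym (∣∣-∑ B)) e) ⟩
      suc k * (k ! * x)
        ≡⟨ *-assoc (suc k) (k !) x ⟨
      suc k ! * x ∎
      where open ≡-Reasoning

    -- There are (∣ B ∣ ∸ ∣ A ∣)! ways for a chain to descend from B to A.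
    chainSum-tot : ∀ k (B : Subset n) (g : Subset n → List (Subset n) → ℕ) → ∣ B ∣ ≡ k →
      chainSum k B (tot g) ≡
      ∑ (subsets n) λ A → 𝟙 (A ⊆? B) * ((k ∸ ∣ A ∣) ! * chainSum (∣ A ∣) A (g A ∘ List.drop 1))
    chainSum-tot zero B g e = begin
      g B [] + 0                                ≡⟨ +-identityʳ _ ⟩
      g B []                                    ≡⟨ cong (λ k → chainSum k B (g B ∘ List.drop 1)) e ⟨
      Q B                                       ≡⟨ ∑-subsets-≡ B Q ⟨
      ∑ (subsets n) (λ A → 𝟙 (A ≟ˢ B) * Q A)    ≡⟨ ∑-cong (subsets n) only-B ⟩
      ∑ (subsets n) (λ A → 𝟙 (A ⊆? B) * ((0 ∸ ∣ A ∣) ! * Q A)) ∎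
      where
      open ≡-Reasoning
      -- `chainSum` hands over a chain with A in front, while `g A` expects only the sets below A;
      -- hence `List.drop 1`.
      Q : Subset n → ℕ
      Q A = chainSum (∣ A ∣) A (g A ∘ List.drop 1)
      only-B : ∀ A → 𝟙 (A ≟ˢ B) * Q A ≡ 𝟙 (A ⊆? B) * ((0 ∸ ∣ A ∣) ! * Q A)
      only-B A = cong₂ _*_
        (𝟙-cong (A ≟ˢ B) (A ⊆? B) (λ { refl → ⊆-refl })
          λ A⊆B → ⊆∧∣∣≡⇒≡ A⊆B (trans (n≤0⇒n≡0 (≤-trans (p⊆q⇒∣p∣≤∣q∣ A⊆B) (≤-reflexive e))) (sym e)))
        (sym (trans (cong (λ x → x ! * Q A) (0∸n≡0 ∣ A ∣)) (*-identityˡ _)))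
    chainSum-tot (suc k) B g e = begin
      ∑ (allFin n) (λ v → ⟦ lookup B v ⟧ * chainSum k (B [ v ]≔ outside) (λ c → g B c + tot g c))
        ≡⟨ chainSum-+ (suc k) B (g B ∘ List.drop 1) (tot g ∘ List.drop 1) ⟩
      chainSum (suc k) B (g B ∘ List.drop 1) + ∑ (allFin n) (λ v → ⟦ lookup B v ⟧ * chainSum k (B [ v ]≔ outside) (tot g))
        ≡⟨ cong₂ _+_ (trans (cong (λ k → chainSum k B (g B ∘ List.drop 1)) (sym e)) (sym (∑-subsets-≡ B Q)))
             (∑-cong (allFin n) (λ v → trans (⟦⟧*-cong (lookup B v) (λ v∈B →
               chainSum-tot k (B [ v ]≔ outside) g (suc-injective (trans (∣remove∣ B v v∈B) e))))
               (sym (∑-*ˡ (subsets n) ⟦ lookup B v ⟧ _)))) ⟩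
      ∑ (subsets n) (λ A → 𝟙 (A ≟ˢ B) * Q A) +
      ∑ (allFin n) (λ v → ∑ (subsets n) λ A → ⟦ lookup B v ⟧ * (𝟙 (A ⊆? (B [ v ]≔ outside)) * ((k ∸ ∣ A ∣) ! * Q A)))
        ≡⟨ cong (∑ (subsets n) (λ A → 𝟙 (A ≟ˢ B) * Q A) +_) (∑-swap (allFin n) (subsets n) _) ⟩
      ∑ (subsets n) (λ A → 𝟙 (A ≟ˢ B) * Q A) +
      ∑ (subsets n) (λ A → ∑ (allFin n) λ v → ⟦ lookup B v ⟧ * (𝟙 (A ⊆? (B [ v ]≔ outside)) * ((k ∸ ∣ A ∣) ! * Q A)))
        ≡⟨ ∑-+ (subsets n) _ _ ⟨
      ∑ (subsets n) (λ A → 𝟙 (A ≟ˢ B) * Q A + ∑ (allFin n) λ v → ⟦ lookup B v ⟧ * (𝟙 (A ⊆? (B [ v ]≔ outside)) * ((k ∸ ∣ A ∣) ! * Q A)))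
        ≡⟨ ∑-cong (subsets n) combine-terms ⟩
      ∑ (subsets n) (λ A → 𝟙 (A ⊆? B) * ((suc k ∸ ∣ A ∣) ! * Q A)) ∎
      where
      open ≡-Reasoning
      Q : Subset n → ℕ
      Q A = chainSum (∣ A ∣) A (g A ∘ List.drop 1)
      remove-term : ∀ A (A⊆?B : Dec (A ⊆ B)) v →
        ⟦ lookup B v ⟧ * 𝟙 (A ⊆? (B [ v ]≔ outside)) ≡ 𝟙 A⊆?B * ⟦ lookup B v ∧ not (lookup A v) ⟧
      remove-term A A⊆?B v with lookup B v in v∈B
      ... | false = sym (*-zeroʳ (𝟙 A⊆?B))
      ... | true with lookup A v in v∈A
      ...   | true  = trans (*-identityˡ _) (trans (𝟙-no (A ⊆? (B [ v ]≔ outside))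
          λ A⊆B-v → true≢false (trans (sym (⊆-lookup A⊆B-v v v∈A)) (lookup∘update v B false))) (sym (*-zeroʳ (𝟙 A⊆?B))))
      ...   | false = trans (*-identityˡ _) (trans (𝟙-cong (A ⊆? (B [ v ]≔ outside)) A⊆?B
          (λ A⊆B-v → lookup-⊆ (λ u u∈A → widen u (⊆-lookup A⊆B-v u u∈A)))
          (λ A⊆B → lookup-⊆ (λ u u∈A → trans (lookup∘update′ (λ { refl → true≢false (trans (sym u∈A) v∈A) }) B false) (⊆-lookup A⊆B u u∈A))))
          (sym (*-identityʳ _)))
          where
          widen : ∀ u → lookup (B [ v ]≔ outside) u ≡ true → lookup B u ≡ true
          widen u u∈ with u Fin.≟ v
          ... | yes refl = v∈B
          ... | no u≢v   = trans (sym (lookup∘update′ u≢v B false)) u∈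
      -- A descent from B to A begins by removing some v in B but not in A. For A ≠ B there are
      -- `suc k ∸ ∣ A ∣` of these, the factor that completes the factorial; for A = B there are
      -- none, and the term of B itself remains.
      below : ∀ A → ∑ (allFin n) (λ v → ⟦ lookup B v ⟧ * (𝟙 (A ⊆? (B [ v ]≔ outside)) * ((k ∸ ∣ A ∣) ! * Q A))) ≡
                    𝟙 (A ⊆? B) * ∑ (allFin n) (λ v → ⟦ lookup B v ∧ not (lookup A v) ⟧) * ((k ∸ ∣ A ∣) ! * Q A)
      below A = begin
        ∑ (allFin n) (λ v → ⟦ lookup B v ⟧ * (𝟙 (A ⊆? (B [ v ]≔ outside)) * X))
          ≡⟨ ∑-cong (allFin n) (λ v → trans (sym (*-assoc ⟦ lookup B v ⟧ _ X)) (cong (_* X) (remove-term A (A ⊆? B) v))) ⟩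
        ∑ (allFin n) (λ v → 𝟙 (A ⊆? B) * ⟦ lookup B v ∧ not (lookup A v) ⟧ * X)
          ≡⟨ ∑-*ʳ (allFin n) X _ ⟩
        ∑ (allFin n) (λ v → 𝟙 (A ⊆? B) * ⟦ lookup B v ∧ not (lookup A v) ⟧) * X
          ≡⟨ cong (_* X) (∑-*ˡ (allFin n) (𝟙 (A ⊆? B)) _) ⟩
        𝟙 (A ⊆? B) * ∑ (allFin n) (λ v → ⟦ lookup B v ∧ not (lookup A v) ⟧) * X ∎
        where
        X : ℕ
        X = (k ∸ ∣ A ∣) ! * Q A
      factorial : ∀ a x → a ≤ k → (suc k ∸ a) * ((k ∸ a) ! * x) ≡ (suc k ∸ a) ! * x
      factorial a x a≤k rewrite +-∸-assoc 1 a≤k = sym (*-assoc (suc (k ∸ a)) ((k ∸ a) !) x)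
      combine-terms : ∀ A → 𝟙 (A ≟ˢ B) * Q A + ∑ (allFin n) (λ v → ⟦ lookup B v ⟧ * (𝟙 (A ⊆? (B [ v ]≔ outside)) * ((k ∸ ∣ A ∣) ! * Q A))) ≡
                          𝟙 (A ⊆? B) * ((suc k ∸ ∣ A ∣) ! * Q A)
      combine-terms A = trans (cong (𝟙 (A ≟ˢ B) * Q A +_) (below A)) (cases (A ⊆? B) (A ≟ˢ B))
        where
        cases : (d : Dec (A ⊆ B)) (d′ : Dec (A ≡ B)) →
          𝟙 d′ * Q A + 𝟙 d * ∑ (allFin n) (λ v → ⟦ lookup B v ∧ not (lookup A v) ⟧) * ((k ∸ ∣ A ∣) ! * Q A) ≡
          𝟙 d * ((suc k ∸ ∣ A ∣) ! * Q A)
        cases (no A⊈B) (yes refl) = ⊥-elim (A⊈B ⊆-refl)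
        cases (no _)   (no _)     = refl
        cases (yes A⊆B) (yes refl) = trans
          (cong₂ _+_ (*-identityˡ (Q A)) (cong (λ x → 1 * x * ((k ∸ ∣ A ∣) ! * Q A)) (trans (∑-∣∖∣ A⊆B) (n∸n≡0 ∣ A ∣))))
          (trans (+-identityʳ (Q A)) (sym (trans (*-identityˡ _)
            (trans (cong (λ x → x ! * Q A) (trans (cong (suc k ∸_) e) (n∸n≡0 (suc k)))) (*-identityˡ (Q A))))))
        cases (yes A⊆B) (no A≢B) = trans
          (cong (λ x → 1 * x * ((k ∸ ∣ A ∣) ! * Q A)) (trans (∑-∣∖∣ A⊆B) (cong (_∸ ∣ A ∣) e)))
          (trans (cong (_* ((k ∸ ∣ A ∣) ! * Q A)) (*-identityˡ (suc k ∸ ∣ A ∣)))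
            (trans (factorial ∣ A ∣ (Q A) (ℕ.s≤s⁻¹ (≤∧≢⇒< (≤-trans (p⊆q⇒∣p∣≤∣q∣ A⊆B) (≤-reflexive e))
              λ ∣A∣≡ → A≢B (⊆∧∣∣≡⇒≡ A⊆B (trans ∣A∣≡ (sym e)))))) (sym (*-identityˡ _))))

    -- The chain has one set of each size from j down to 0. At j = k, the case used, the bound is τ:
    -- the levels k, k - 1, ..., k - τ + 1.
    level-count : ∀ k τ j c → Levels {n} j c → tot (λ A _ → 𝟙 (k <? ∣ A ∣ + τ)) c ≤ j + τ ∸ k
    level-count k τ .0 (B ∷ []) [ e ] = ≤-trans (≤-reflexive (+-identityʳ _))
      (𝟙-≤ (k <? ∣ B ∣ + τ) λ k<τ → m<n⇒0<n∸m (≤-trans k<τ (≤-reflexive (cong (_+ τ) e))))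
    level-count k τ (suc j) (B ∷ c) (e ∷ lv) = ≤-trans
      (+-monoʳ-≤ (𝟙 (k <? ∣ B ∣ + τ)) (level-count k τ j c lv)) (top (k <? ∣ B ∣ + τ))
      where
      top : (d : Dec (k < ∣ B ∣ + τ)) → 𝟙 d + (j + τ ∸ k) ≤ suc j + τ ∸ k
      top (yes k<) = ≤-reflexive (sym (+-∸-assoc 1 (ℕ.s≤s⁻¹ (≤-trans k< (≤-reflexive (cong (_+ τ) e))))))
      top (no _)   = ∸-monoˡ-≤ k (n≤1+n (j + τ))

    -- A LYM inequality for families with few distant comparable pairs

    module _ (F : Subset n → Bool) (τ : ℕ) where

      distant : Subset n → Subset n → ℕ
      distant B A = ⟦ F A ⟧ * 𝟙 (∣ A ∣ + suc τ ≤? ∣ B ∣)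

      hits pairs : List (Subset n) → ℕ
      hits  = tot λ A _ → ⟦ F A ⟧
      pairs = tot λ B c → ⟦ F B ⟧ * tot (λ A _ → distant B A) c

      -- At most t = τ + 1 members of F on a chain lie within t levels of the largest one.
      hits≤pairs : ∀ k c → Levels k c → hits c ≤ suc τ + pairs c
      hits≤pairs .0 (B ∷ []) [ _ ] = ≤-trans (+-mono-≤ (⟦⟧≤1 (F B)) (z≤n {τ})) (m≤m+n (suc τ) _)
      hits≤pairs (suc k) (B ∷ c) (e ∷ lv) with F B
      ... | false = hits≤pairs k c lv
      ... | true  = s≤s (begin
        hits c
          ≤⟨ tot-mono (λ A _ → near-or-distant A (∣ A ∣ + suc τ ≤? ∣ B ∣)) c ⟩
        tot (λ A _ → distant B A + 𝟙 (k <? ∣ A ∣ + τ)) c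
          ≡⟨ tot-+ (λ A _ → distant B A) (λ A _ → 𝟙 (k <? ∣ A ∣ + τ)) c ⟩
        tot (λ A _ → distant B A) c + tot (λ A _ → 𝟙 (k <? ∣ A ∣ + τ)) c
          ≤⟨ +-monoʳ-≤ (tot (λ A _ → distant B A) c) (≤-trans (level-count k τ k c lv) (≤-reflexive (m+n∸m≡n k τ))) ⟩
        tot (λ A _ → distant B A) c + τ
          ≡⟨ +-comm _ τ ⟩
        τ + tot (λ A _ → distant B A) c
          ≤⟨ +-monoʳ-≤ τ (≤-trans (≤-reflexive (sym (*-identityˡ _))) (m≤m+n _ (pairs c))) ⟩
        τ + (1 * tot (λ A _ → distant B A) c + pairs c) ∎)
        where
        open ≤-Reasoning
        near-or-distant : ∀ A (d : Dec (∣ A ∣ + suc τ ≤ ∣ B ∣)) → ⟦ F A ⟧ ≤ ⟦ F A ⟧ * 𝟙 d + 𝟙 (k <? ∣ A ∣ + τ)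
        near-or-distant A (yes _) = ≤-trans (≤-reflexive (sym (*-identityʳ ⟦ F A ⟧))) (m≤m+n _ _)
        near-or-distant A (no b≰) = ≤-trans (⟦⟧≤1 (F A)) (≤-trans (≤-reflexive (sym (𝟙-yes (k <? ∣ A ∣ + τ)
          (ℕ.s≤s⁻¹ (≤-trans (s≤s (≤-reflexive (sym e))) (≤-trans (≰⇒> b≰) (≤-reflexive (+-suc ∣ A ∣ τ)))))))) (m≤n+m _ _))

      -- Sum `hits≤pairs` over all n! maximal chains. A set A lies on (n - ∣A∣)! ∣A∣! of them. Of
      -- the chains through B only one in (∣B∣ choose ∣A∣), at most one in κ, also passes through a
      -- given distant A below B, and B has at most D such partners. So the pairs weigh at most D/κ
      -- ≤ 1/q of the hits.
      lym : ∀ q κ D → q * D ≤ κ → 0 < κ →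
        (∀ A B → F A ≡ true → F B ≡ true → A ⊆ B → ∣ A ∣ + suc τ ≤ ∣ B ∣ →
           κ * ((∣ B ∣ ∸ ∣ A ∣) ! * ∣ A ∣ !) ≤ ∣ B ∣ !) →
        (∀ B → F B ≡ true → ∑ (subsets n) (λ A → ⟦ F A ⟧ * 𝟙 (A ⊆? B)) ≤ D) →
        q * ∑ (subsets n) (λ A → ⟦ F A ⟧ * ((n ∸ ∣ A ∣) ! * ∣ A ∣ !)) ≤
        q * (suc τ * n !) + ∑ (subsets n) (λ A → ⟦ F A ⟧ * ((n ∸ ∣ A ∣) ! * ∣ A ∣ !))
      lym q κ D qD≤C 0<C sparse deg≤D = begin
        q * ∑ (subsets n) (λ A → ⟦ F A ⟧ * ((n ∸ ∣ A ∣) ! * ∣ A ∣ !))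
          ≡⟨ cong (q *_) (∑-cong (subsets n) λ A → trans (rearrange ⟦ F A ⟧ ((n ∸ ∣ A ∣) !) (∣ A ∣ !))
               (sym (cong₂ _*_ (𝟙-yes (A ⊆? ⊤) ⊆⊤) (cong ((n ∸ ∣ A ∣) ! *_) (chainSum-const (∣ A ∣) A ⟦ F A ⟧ refl))))) ⟩
        q * ∑ (subsets n) (λ A → 𝟙 (A ⊆? ⊤) * ((n ∸ ∣ A ∣) ! * chainSum (∣ A ∣) A (const ⟦ F A ⟧)))
          ≡⟨ cong (q *_) (chainSum-tot n ⊤ _ (∣⊤∣≡n n)) ⟨
        q * chainSum n ⊤ hits
          ≤⟨ *-monoʳ-≤ q (chainSum-mono n ⊤ (∣⊤∣≡n n) (hits≤pairs n)) ⟩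
        q * chainSum n ⊤ (λ c → suc τ + pairs c)
          ≡⟨ cong (q *_) (chainSum-+ n ⊤ (const (suc τ)) pairs) ⟩
        q * (chainSum n ⊤ (const (suc τ)) + chainSum n ⊤ pairs)
          ≡⟨ *-distribˡ-+ q _ _ ⟩
        q * chainSum n ⊤ (const (suc τ)) + q * chainSum n ⊤ pairs
          ≤⟨ +-mono-≤ (≤-reflexive (cong (q *_) (trans (chainSum-const n ⊤ (suc τ) (∣⊤∣≡n n)) (*-comm (n !) (suc τ))))) pairs≤ ⟩
        q * (suc τ * n !) + ∑ (subsets n) (λ A → ⟦ F A ⟧ * ((n ∸ ∣ A ∣) ! * ∣ A ∣ !)) ∎
        where
        open ≤-Reasoning
        rearrange : ∀ a b c → a * (b * c) ≡ 1 * (b * (c * a))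
        rearrange = solve-∀
        Q : Subset n → ℕ
        Q B = chainSum (∣ B ∣) B (λ c → ⟦ F B ⟧ * tot (λ A _ → distant B A) (List.drop 1 c))
        drop≤ : ∀ g (c : List (Subset n)) → tot g (List.drop 1 c) ≤ tot g c
        drop≤ g []      = z≤n
        drop≤ g (B ∷ c) = m≤n+m _ _
        P : Subset n → ℕ
        P B = ∑ (subsets n) λ A → 𝟙 (A ⊆? B) * ((∣ B ∣ ∸ ∣ A ∣) ! * chainSum (∣ A ∣) A (const (distant B A)))
        Q≤ : ∀ B → Q B ≤ ⟦ F B ⟧ * P B
        Q≤ B = begin
          Q B
            ≤⟨ chainSum-mono (∣ B ∣) B refl (λ c _ → *-monoʳ-≤ ⟦ F B ⟧ (drop≤ _ c)) ⟩
          chainSum (∣ B ∣) B (λ c → ⟦ F B ⟧ * tot (λ A _ → distant B A) c)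
            ≡⟨ chainSum-*ˡ (∣ B ∣) B ⟦ F B ⟧ _ ⟩
          ⟦ F B ⟧ * chainSum (∣ B ∣) B (tot (λ A _ → distant B A))
            ≡⟨ cong (⟦ F B ⟧ *_) (chainSum-tot (∣ B ∣) B _ refl) ⟩
          ⟦ F B ⟧ * P B ∎
        term : ∀ B → F B ≡ true → ∀ A → κ * (𝟙 (A ⊆? B) * ((∣ B ∣ ∸ ∣ A ∣) ! * chainSum (∣ A ∣) A (const (distant B A)))) ≤
                     ⟦ F A ⟧ * 𝟙 (A ⊆? B) * ∣ B ∣ !
        term B B∈F A = ≤-trans
          (≤-reflexive (cong (λ x → κ * (𝟙 (A ⊆? B) * ((∣ B ∣ ∸ ∣ A ∣) ! * x))) (chainSum-const (∣ A ∣) A (distant B A) refl)))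
          (cases (F A) refl (A ⊆? B) (∣ A ∣ + suc τ ≤? ∣ B ∣))
          where
          vanish₁ : ∀ a b c d → a * (b * (c * (d * 0))) ≡ 0
          vanish₁ = solve-∀
          vanish₂ : ∀ a c d → a * (1 * (c * (d * 0))) ≡ 0
          vanish₂ = solve-∀
          tidy : ∀ a c d → a * (1 * (c * (d * 1))) ≡ a * (c * d)
          tidy = solve-∀
          cases : ∀ x → F A ≡ x → (d : Dec (A ⊆ B)) (d′ : Dec (∣ A ∣ + suc τ ≤ ∣ B ∣)) →
            κ * (𝟙 d * ((∣ B ∣ ∸ ∣ A ∣) ! * (∣ A ∣ ! * (⟦ x ⟧ * 𝟙 d′)))) ≤ ⟦ x ⟧ * 𝟙 d * ∣ B ∣ !
          cases false _   d d′ = ≤-reflexive (vanish₁ κ (𝟙 d) ((∣ B ∣ ∸ ∣ A ∣) !) (∣ A ∣ !))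
          cases true  A∈F (no _) d′ = ≤-reflexive (*-zeroʳ κ)
          cases true  A∈F (yes A⊆B) (no _) = ≤-trans (≤-reflexive (vanish₂ κ ((∣ B ∣ ∸ ∣ A ∣) !) (∣ A ∣ !))) z≤n
          cases true  A∈F (yes A⊆B) (yes a+t≤b) = ≤-trans (≤-reflexive (tidy κ ((∣ B ∣ ∸ ∣ A ∣) !) (∣ A ∣ !)))
            (≤-trans (sparse A B A∈F B∈F A⊆B a+t≤b) (≤-reflexive (sym (+-identityʳ (∣ B ∣ !)))))
        -- After multiplication by κ each of the at most D sets A contributes at most ∣B∣!, and q D
        -- ≤ κ absorbs their number.
        P≤ : ∀ B → F B ≡ true → q * P B ≤ ∣ B ∣ !
        P≤ B B∈F = *-cancelˡ-≤ κ {{ℕ.>-nonZero 0<C}} (begin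
          κ * (q * P B)
            ≡⟨ swap κ q (P B) ⟩
          q * (κ * P B)
            ≡⟨ cong (q *_) (∑-*ˡ (subsets n) κ _) ⟨
          q * ∑ (subsets n) (λ A → κ * (𝟙 (A ⊆? B) * ((∣ B ∣ ∸ ∣ A ∣) ! * chainSum (∣ A ∣) A (const (distant B A)))))
            ≤⟨ *-monoʳ-≤ q (∑-mono (subsets n) (term B B∈F)) ⟩
          q * ∑ (subsets n) (λ A → ⟦ F A ⟧ * 𝟙 (A ⊆? B) * ∣ B ∣ !)
            ≡⟨ cong (q *_) (∑-*ʳ (subsets n) (∣ B ∣ !) _) ⟩
          q * (∑ (subsets n) (λ A → ⟦ F A ⟧ * 𝟙 (A ⊆? B)) * ∣ B ∣ !)
            ≤⟨ *-monoʳ-≤ q (*-monoˡ-≤ (∣ B ∣ !) (deg≤D B B∈F)) ⟩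
          q * (D * ∣ B ∣ !)
            ≡⟨ *-assoc q D _ ⟨
          q * D * ∣ B ∣ !
            ≤⟨ *-monoˡ-≤ (∣ B ∣ !) qD≤C ⟩
          κ * ∣ B ∣ ! ∎)
          where
          swap : ∀ a b c → a * (b * c) ≡ b * (a * c)
          swap = solve-∀
        pairs≤ : q * chainSum n ⊤ pairs ≤ ∑ (subsets n) (λ A → ⟦ F A ⟧ * ((n ∸ ∣ A ∣) ! * ∣ A ∣ !))
        pairs≤ = begin
          q * chainSum n ⊤ pairs
            ≡⟨ cong (q *_) (chainSum-tot n ⊤ _ (∣⊤∣≡n n)) ⟩
          q * ∑ (subsets n) (λ B → 𝟙 (B ⊆? ⊤) * ((n ∸ ∣ B ∣) ! * Q B))
            ≡⟨ ∑-*ˡ (subsets n) q _ ⟨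
          ∑ (subsets n) (λ B → q * (𝟙 (B ⊆? ⊤) * ((n ∸ ∣ B ∣) ! * Q B)))
            ≤⟨ ∑-mono (subsets n) pointwise ⟩
          ∑ (subsets n) (λ A → ⟦ F A ⟧ * ((n ∸ ∣ A ∣) ! * ∣ A ∣ !)) ∎
          where
          rearrange₂ : ∀ q a f p → q * (a * (f * p)) ≡ f * (a * (q * p))
          rearrange₂ = solve-∀
          pointwise : ∀ B → q * (𝟙 (B ⊆? ⊤) * ((n ∸ ∣ B ∣) ! * Q B)) ≤ ⟦ F B ⟧ * ((n ∸ ∣ B ∣) ! * ∣ B ∣ !)
          pointwise B = begin
            q * (𝟙 (B ⊆? ⊤) * ((n ∸ ∣ B ∣) ! * Q B))
              ≤⟨ *-monoʳ-≤ q (≤-trans (*-monoˡ-≤ _ (⟦⟧≤1 (does (B ⊆? ⊤)))) (≤-reflexive (*-identityˡ _))) ⟩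
            q * ((n ∸ ∣ B ∣) ! * Q B)
              ≤⟨ *-monoʳ-≤ q (*-monoʳ-≤ ((n ∸ ∣ B ∣) !) (Q≤ B)) ⟩
            q * ((n ∸ ∣ B ∣) ! * (⟦ F B ⟧ * P B))
              ≡⟨ rearrange₂ q ((n ∸ ∣ B ∣) !) ⟦ F B ⟧ (P B) ⟩
            ⟦ F B ⟧ * ((n ∸ ∣ B ∣) ! * (q * P B))
              ≤⟨ ⟦⟧*-mono (F B) (λ B∈F → *-monoʳ-≤ ((n ∸ ∣ B ∣) !) (P≤ B B∈F)) ⟩
            ⟦ F B ⟧ * ((n ∸ ∣ B ∣) ! * ∣ B ∣ !) ∎

  -- Binomial coefficients

  C-! : ∀ {n k} → k ≤ n → (n C k) * (k ! * (n ∸ k) !) ≡ n !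
  C-! {n} {k} k≤n = trans (cong (_* (k ! * (n ∸ k) !)) (nCk≡n!/k![n-k]! k≤n))
    (m/n*n≡m {{k !* (n ∸ k) !≢0}} (k![n∸k]!∣n! k≤n))

  C-0 : ∀ n → n C 0 ≡ 1
  C-0 n = trans (nCk≡nC[n∸k] {0} {n} z≤n) (nCn≡1 n)

  C-step : ∀ {n k} → k < n → suc k * (n C suc k) ≡ (n ∸ k) * (n C k)
  C-step {n} {k} k<n = *-cancelʳ-≡ _ _ (k ! * (n ∸ suc k) !) {{k !* (n ∸ suc k) !≢0}} (begin
    suc k * (n C suc k) * (k ! * (n ∸ suc k) !)
      ≡⟨ rearrange (suc k) (n C suc k) (k !) ((n ∸ suc k) !) ⟩
    (n C suc k) * (suc k ! * (n ∸ suc k) !)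
      ≡⟨ trans (C-! k<n) (sym (C-! (<⇒≤ k<n))) ⟩
    (n C k) * (k ! * (n ∸ k) !)
      ≡⟨ cong (λ x → (n C k) * (k ! * x)) ([n-k]*[n-k-1]!≡[n-k]! k<n) ⟨
    (n C k) * (k ! * ((n ∸ k) * (n ∸ suc k) !))
      ≡⟨ rearrange₂ (n C k) (k !) (n ∸ k) ((n ∸ suc k) !) ⟩
    (n ∸ k) * (n C k) * (k ! * (n ∸ suc k) !) ∎)
    where
    open ≡-Reasoning
    rearrange : ∀ a c f g → a * c * (f * g) ≡ c * (a * f * g)
    rearrange = solve-∀
    rearrange₂ : ∀ c f a g → c * (f * (a * g)) ≡ a * c * (f * g)
    rearrange₂ = solve-∀

  C-grow : ∀ {n k} c → suc k * c ≤ n ∸ k → k < n → c * (n C k) ≤ n C suc k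
  C-grow {n} {k} c h k<n = *-cancelˡ-≤ (suc k) (≤-trans (≤-reflexive (sym (*-assoc (suc k) c (n C k))))
    (≤-trans (*-monoˡ-≤ (n C k) h) (≤-reflexive (sym (C-step k<n)))))

  C-mono-half : ∀ {n j} k → j ≤ k → k + k ≤ n → n C j ≤ n C k
  C-mono-half {n} {zero} zero j≤k _ = ≤-refl
  C-mono-half {n} {j} (suc k) j≤k k≤n with j ℕ.≟ suc k
  ... | yes refl = ≤-refl
  ... | no j≢k = ≤-trans (C-mono-half k (ℕ.s≤s⁻¹ (≤∧≢⇒< j≤k j≢k)) (≤-trans (+-mono-≤ (n≤1+n k) (n≤1+n k)) k≤n))
    (≤-trans (≤-reflexive (sym (*-identityˡ _))) (C-grow 1 (≤-trans (≤-reflexive (*-identityʳ (suc k)))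
      (m+n≤o⇒m≤o∸n (suc k) (≤-trans (+-monoʳ-≤ (suc k) (n≤1+n k)) k≤n))) (≤-trans (m≤m+n (suc k) (suc k)) k≤n)))

  -- If k lies past the middle, its mirror image n - k is still at least j and lies in the
  -- increasing half.
  C-mono : ∀ {n j} k → j ≤ k → j + k ≤ n → n C j ≤ n C k
  C-mono {n} {j} k j≤k j+k≤n with k + k ≤? n
  ... | yes 2k≤n = C-mono-half k j≤k 2k≤n
  ... | no  2k≰n = ≤-trans
    (C-mono-half (n ∸ k) (m+n≤o⇒m≤o∸n j j+k≤n)
      (≤-trans (+-monoʳ-≤ (n ∸ k) (m≤n+o⇒m∸n≤o n k (<⇒≤ (≰⇒> 2k≰n)))) (≤-reflexive (m∸n+n≡m k≤n))))
    (≤-reflexive (sym (nCk≡nC[n∸k] k≤n)))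
    where
    k≤n : k ≤ n
    k≤n = ≤-trans (m≤n+m k j) j+k≤n

  ⌊n/2⌋+⌊n/2⌋≤n : ∀ n → ⌊ n /2⌋ + ⌊ n /2⌋ ≤ n
  ⌊n/2⌋+⌊n/2⌋≤n n = ≤-trans (+-monoʳ-≤ ⌊ n /2⌋ (⌊n/2⌋≤⌈n/2⌉ n)) (≤-reflexive (⌊n/2⌋+⌈n/2⌉≡n n))

  C≤m : ∀ {n k} → k ≤ n → n C k ≤ m n
  C≤m {n} {k} k≤n with k ≤? ⌊ n /2⌋
  ... | yes k≤h = C-mono ⌊ n /2⌋ k≤h (≤-trans (+-monoˡ-≤ ⌊ n /2⌋ k≤h) (⌊n/2⌋+⌊n/2⌋≤n n))
  ... | no  k≰h = ≤-trans (≤-reflexive (nCk≡nC[n∸k] k≤n))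
    (C-mono ⌊ n /2⌋ n∸k≤h (≤-trans (+-monoˡ-≤ ⌊ n /2⌋ n∸k≤h) (⌊n/2⌋+⌊n/2⌋≤n n)))
    where
    n≤1+2h : n ≤ suc ⌊ n /2⌋ + ⌊ n /2⌋
    n≤1+2h = ≤-trans (≤-reflexive (sym (⌊n/2⌋+⌈n/2⌉≡n n)))
      (≤-trans (+-monoʳ-≤ ⌊ n /2⌋ (⌈n/2⌉≤1+⌊n/2⌋ n)) (≤-reflexive (+-comm ⌊ n /2⌋ (suc ⌊ n /2⌋))))
      where
      ⌈n/2⌉≤1+⌊n/2⌋ : ∀ n → ℕ.⌈ n /2⌉ ≤ suc ⌊ n /2⌋
      ⌈n/2⌉≤1+⌊n/2⌋ zero          = z≤n
      ⌈n/2⌉≤1+⌊n/2⌋ (suc zero)    = s≤s z≤n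
      ⌈n/2⌉≤1+⌊n/2⌋ (suc (suc n)) = s≤s (⌈n/2⌉≤1+⌊n/2⌋ n)
    n∸k≤h : n ∸ k ≤ ⌊ n /2⌋
    n∸k≤h = m≤n+o⇒m∸n≤o n k (≤-trans n≤1+2h (+-monoˡ-≤ ⌊ n /2⌋ (≰⇒> k≰h)))

  C-monoˡ : ∀ {a b} k → a ≤ b → a C k ≤ b C k
  C-monoˡ {a} {b} k a≤b with m≤n⇒∃[o]m+o≡n a≤b
  ... | d , refl = climb d
    where
    step : ∀ n k → n C k ≤ suc n C k
    step n zero    = ≤-reflexive (trans (C-0 n) (sym (C-0 (suc n))))
    step n (suc k) = ≤-trans (m≤n+m _ (n C k)) (≤-reflexive (nCk+nC[k+1]≡[n+1]C[k+1] n k))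
    climb : ∀ d → a C k ≤ (a + d) C k
    climb zero    = ≤-reflexive (cong (_C k) (sym (+-identityʳ a)))
    climb (suc d) = ≤-trans (climb d) (≤-trans (step (a + d) k) (≤-reflexive (cong (_C k) (sym (+-suc a d)))))

  -- The right side is a falling product of u factors, none of them below b - u.
  C-lower : ∀ b u → u ≤ b → (b ∸ u) ^ u ≤ u ! * (b C u)
  C-lower b zero    _   = ≤-reflexive (sym (trans (*-identityˡ _) (C-0 b)))
  C-lower b (suc u) u<b = begin
    (b ∸ suc u) * (b ∸ suc u) ^ u   ≤⟨ *-mono-≤ b∸≤ (^-monoˡ-≤ u b∸≤) ⟩
    (b ∸ u) * (b ∸ u) ^ u           ≤⟨ *-monoʳ-≤ (b ∸ u) (C-lower b u (<⇒≤ u<b)) ⟩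
    (b ∸ u) * (u ! * (b C u))       ≡⟨ swap (b ∸ u) (u !) (b C u) ⟩
    u ! * ((b ∸ u) * (b C u))       ≡⟨ cong (u ! *_) (C-step u<b) ⟨
    u ! * (suc u * (b C suc u))     ≡⟨ swap₂ (u !) (suc u) (b C suc u) ⟩
    suc u ! * (b C suc u) ∎
    where
    open ≤-Reasoning
    b∸≤ : b ∸ suc u ≤ b ∸ u
    b∸≤ = ∸-monoʳ-≤ b (n≤1+n u)
    swap : ∀ a b c → a * (b * c) ≡ b * (a * c)
    swap = solve-∀
    swap₂ : ∀ a b c → a * (b * c) ≡ b * a * c
    swap₂ = solve-∀

  -- Sizes of layers and of the part of the cube below a layer

  ∑-layer : ∀ n k → ∑ (subsets n) (λ A → 𝟙 (∣ A ∣ ℕ.≟ k)) ≡ n C k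
  ∑-layer zero    zero    = refl
  ∑-layer zero    (suc k) = refl
  ∑-layer (suc n) zero    = trans (∑-∣∣-0 (suc n)) (sym (C-0 (suc n)))
  ∑-layer (suc n) (suc k) = trans (∑-subsets-suc n _) (trans (cong₂ _+_ (∑-layer n (suc k))
    (trans (∑-cong (subsets n) λ A → 𝟙-cong (suc ∣ A ∣ ℕ.≟ suc k) (∣ A ∣ ℕ.≟ k) suc-injective (cong suc)) (∑-layer n k)))
    (trans (+-comm (n C suc k) (n C k)) (nCk+nC[k+1]≡[n+1]C[k+1] n k)))

  below : ℕ → ℕ → ℕ
  below n b = ∑ (subsets n) (λ A → 𝟙 (∣ A ∣ <? b))

  below-suc : ∀ n b → below n (suc b) ≡ below n b + n C b
  below-suc n b = trans (∑-cong (subsets n) λ A → split A (∣ A ∣ <? b) (∣ A ∣ ℕ.≟ b))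
    (trans (∑-+ (subsets n) _ _) (cong (below n b +_) (∑-layer n b)))
    where
    split : ∀ A (d : Dec (∣ A ∣ < b)) (d′ : Dec (∣ A ∣ ≡ b)) → 𝟙 (∣ A ∣ <? suc b) ≡ 𝟙 d + 𝟙 d′
    split A (yes a<b) (yes a≡b) = ⊥-elim (<-irrefl a≡b a<b)
    split A (yes a<b) (no _)    = 𝟙-yes (∣ A ∣ <? suc b) (≤-trans a<b (n≤1+n b))
    split A (no _)    (yes a≡b) = 𝟙-yes (∣ A ∣ <? suc b) (s≤s (≤-reflexive a≡b))
    split A (no a≮b)  (no a≢b)  = 𝟙-no (∣ A ∣ <? suc b) λ a<1+b → a≮b (≤∧≢⇒< (ℕ.s≤s⁻¹ a<1+b) a≢b)

  below-0 : ∀ n → below n 0 ≡ 0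
  below-0 n = ∑-zero (subsets n) λ A → 𝟙-no (∣ A ∣ <? 0) λ ()

  2^n≤[1+n]m : ∀ n → 2 ^ n ≤ suc n * m n
  2^n≤[1+n]m n = ≤-trans (≤-reflexive (sym (trans (sym (∑-members n (const 1))) (∑-Fin-1 (2 ^ n)))))
    (≤-trans (∑-mono (subsets n) λ A → ≤-reflexive (sym (𝟙-yes (∣ A ∣ <? suc n) (s≤s (∣p∣≤n A)))))
      (layers (suc n) ≤-refl))
    where
    layers : ∀ b → b ≤ suc n → below n b ≤ b * m n
    layers zero    _   = ≤-reflexive (below-0 n)
    layers (suc b) b<n = ≤-trans (≤-reflexive (trans (below-suc n b) (+-comm (below n b) _)))
      (+-mono-≤ (C≤m (ℕ.s≤s⁻¹ b<n)) (layers b (<⇒≤ b<n)))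

  C-triple : ∀ {n b} → 4 * suc b ≤ n → 3 * (n C b) ≤ n C suc b
  C-triple {n} {b} h = C-grow 3
    (m+n≤o⇒m≤o∸n (suc b * 3) (≤-trans (m≤m+n _ 1) (≤-trans (≤-reflexive (arith b)) h)))
    (≤-trans (m≤m+n (suc b) _) h)
    where
    arith : ∀ b → (1 + b) * 3 + b + 1 ≡ 4 * (1 + b)
    arith = solve-∀

  -- Up to n/4 the layers at least triple, so those below b are dominated by the geometric series
  -- 1/3 + 1/9 + ... = 1/2.
  below≤C : ∀ n b → 4 * b ≤ n → 2 * below n b ≤ n C b
  below≤C n zero    _ = ≤-trans (≤-reflexive (cong (2 *_) (below-0 n))) z≤n
  below≤C n (suc b) h = begin
    2 * below n (suc b)             ≡⟨ cong (2 *_) (below-suc n b) ⟩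
    2 * (below n b + n C b)         ≡⟨ *-distribˡ-+ 2 (below n b) (n C b) ⟩
    2 * below n b + 2 * (n C b)     ≤⟨ +-monoˡ-≤ _ (below≤C n b (≤-trans (*-monoʳ-≤ 4 (n≤1+n b)) h)) ⟩
    3 * (n C b)                     ≤⟨ C-triple h ⟩
    n C suc b ∎
    where open ≤-Reasoning

  -- From n/8 up to n/4 every layer is at least three times the previous one.
  below-small : ∀ n b → 8 * b ≤ n → b * below n b ≤ m n
  below-small n b h = begin
    -- The b steps from layer b to layer 2b gain 3^b, of which only a factor b is needed.
    b * below n b            ≤⟨ *-mono-≤ (b≤3^b b) (≤-trans (m≤m+n (below n b) _) (below≤C n b (≤-trans (*-monoˡ-≤ b (m≤m+n 4 4)) h))) ⟩
    3 ^ b * (n C b)          ≤⟨ climb b (≤-trans (≤-reflexive (double b)) h) ⟩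
    n C (b + b)              ≤⟨ C≤m (≤-trans (m≤m+n (b + b) _) (≤-trans (≤-reflexive (double₂ b)) h)) ⟩
    m n ∎
    where
    open ≤-Reasoning
    double : ∀ b → 4 * (b + b) ≡ 8 * b
    double = solve-∀
    double₂ : ∀ b → b + b + (6 * b) ≡ 8 * b
    double₂ = solve-∀
    b≤3^b : ∀ b → b ≤ 3 ^ b
    b≤3^b zero    = z≤n
    b≤3^b (suc b) = ≤-trans (+-mono-≤ (m^n>0 3 b) (b≤3^b b)) (+-monoʳ-≤ (3 ^ b) (m≤m+n (3 ^ b) _))
    climb : ∀ j → 4 * (b + j) ≤ n → 3 ^ j * (n C b) ≤ n C (b + j)
    climb zero    _ = ≤-reflexive (trans (*-identityˡ _) (cong (n C_) (sym (+-identityʳ b))))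
    climb (suc j) h = ≤-trans (≤-reflexive (*-assoc 3 (3 ^ j) (n C b)))
      (≤-trans (*-monoʳ-≤ 3 (climb j (≤-trans (*-monoʳ-≤ 4 (+-monoʳ-≤ b (n≤1+n j))) h)))
        (≤-trans (C-triple (≤-trans (*-monoʳ-≤ 4 (≤-reflexive (sym (+-suc b j)))) h)) (≤-reflexive (cong (n C_) (sym (+-suc b j))))))

  -- The comparability graph of the subsets of [n]

  Comparable : ∀ n → Fin (2 ^ n) → Fin (2 ^ n) → Set
  Comparable n i j = members n i ⊆ members n j ⊎ members n j ⊆ members n i

  comparable? : ∀ n i j → Dec (Comparable n i j)
  comparable? n i j = (members n i ⊆? members n j) ⊎-dec (members n j ⊆? members n i)

  module Cube (n : ℕ) = Graph {2 ^ n} (Comparable n) (comparable? n) (λ _ → inj₁ ⊆-refl) Sum.swap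

  #antichains≡ : ∀ n s → #antichains n s ≡ Cube.#independent n (const true) s
  #antichains≡ n s = trans (count-∑ᵛ _ (powerset (2 ^ n))) (trans (∑ᵛ-powerset (2 ^ n) _)
    (∑-cong (subsets (2 ^ n)) λ 𝒜 → 𝟙-cong (antichain? {n} 𝒜 ×-dec (∣ 𝒜 ∣ ℕ.≟ s))
      (Cube.isIndependent? n (const true) s 𝒜) (to 𝒜) (from 𝒜)))
    where
    to : ∀ 𝒜 → Antichain {n} 𝒜 × ∣ 𝒜 ∣ ≡ s → Cube.IsIndependent n (const true) s 𝒜
    to 𝒜 (anti , card) = (λ _ _ → refl) , indep , card
      where
      member : ∀ i → lookup 𝒜 i ≡ true → members n i ∈ᶠ 𝒜
      member i i∈𝒜 = i , lookup⇒[]= i 𝒜 i∈𝒜 , refl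
      indep : ∀ i j → lookup 𝒜 i ≡ true → lookup 𝒜 j ≡ true → Comparable n i j → i ≡ j
      indep i j i∈ j∈ (inj₁ i⊆j) = members-injective n (anti (member i i∈) (member j j∈) i⊆j)
      indep i j i∈ j∈ (inj₂ j⊆i) = sym (members-injective n (anti (member j j∈) (member i i∈) j⊆i))
    from : ∀ 𝒜 → Cube.IsIndependent n (const true) s 𝒜 → Antichain {n} 𝒜 × ∣ 𝒜 ∣ ≡ s
    from 𝒜 (_ , indep , card) = (λ { (i , i∈ , refl) (j , j∈ , refl) i⊆j →
      cong (members n) (indep i j ([]=⇒lookup i∈) ([]=⇒lookup j∈) (inj₁ i⊆j)) }) , card

  ∑-index : ∀ n (f : Fin (2 ^ n) → ℕ) → ∑ (allFin (2 ^ n)) f ≡ ∑ (subsets n) (f ∘ index)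
  ∑-index n f = trans (∑-cong (allFin (2 ^ n)) λ i → cong f (sym (index-members n i))) (∑-members n (f ∘ index))

  -- The contrapositive of `lym`, applied to the members of F of size at least b.
  supersaturated : ∀ n τ p b → suc τ ≤ b → (F : Fin (2 ^ n) → Bool) →
    suc p * (suc τ * m n) + p * below n b < p * size F →
    ∃[ v ] (F v ≡ true × (b C suc τ) / suc p < Cube.degree n F v)
  supersaturated n τ p b τ<b F large with any? (λ v → (F v ≟ᵇ true) ×-dec ((b C suc τ) / suc p <? Cube.degree n F v))
  ... | yes found = found
  ... | no none = ⊥-elim (<-irrefl refl (<-≤-trans large (begin
    p * size F
      ≤⟨ *-monoʳ-≤ p size≤G+below ⟩
    p * (∑G + below n b)
      ≡⟨ *-distribˡ-+ p ∑G (below n b) ⟩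
    p * ∑G + p * below n b
      ≤⟨ +-monoˡ-≤ (p * below n b) (*-cancelˡ-≤ (n !) {{n !≢0}} G-small) ⟩
    suc p * (suc τ * m n) + p * below n b ∎)))
    where
    open ≤-Reasoning
    D : ℕ
    D = (b C suc τ) / suc p
    -- Among very small sets a distant pair may have a small coefficient ∣B∣ choose ∣A∣. Keeping
    -- only sizes at least b makes it at least `b C suc τ`, at the price of the term `below n b`.
    G : Subset n → Bool
    G A = F (index A) ∧ does (b ≤? ∣ A ∣)
    ∑G W : ℕ
    ∑G = ∑ (subsets n) (λ A → ⟦ G A ⟧)
    W  = ∑ (subsets n) (λ A → ⟦ G A ⟧ * ((n ∸ ∣ A ∣) ! * ∣ A ∣ !))
    G⇒large : ∀ A → G A ≡ true → b ≤ ∣ A ∣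
    G⇒large A = cases (F (index A)) (b ≤? ∣ A ∣)
      where
      cases : ∀ x (d : Dec (b ≤ ∣ A ∣)) → x ∧ does d ≡ true → b ≤ ∣ A ∣
      cases true (yes b≤A) _ = b≤A
    degree≤D : ∀ v → F v ≡ true → Cube.degree n F v ≤ D
    degree≤D v v∈F = ≮⇒≥ λ D<deg → none (v , v∈F , D<deg)
    size≤G+below : size F ≤ ∑G + below n b
    size≤G+below = ≤-trans (≤-reflexive (∑-index n (λ i → ⟦ F i ⟧)))
      (≤-trans (∑-mono (subsets n) (λ A → split A (F (index A)) (b ≤? ∣ A ∣))) (≤-reflexive (∑-+ (subsets n) _ _)))
      where
      split : ∀ A x (d : Dec (b ≤ ∣ A ∣)) → ⟦ x ⟧ ≤ ⟦ x ∧ does d ⟧ + 𝟙 (∣ A ∣ <? b)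
      split A false d       = z≤n
      split A true  (yes _) = m≤m+n 1 _
      split A true  (no b≰) = ≤-reflexive (sym (𝟙-yes (∣ A ∣ <? b) (≰⇒> b≰)))
    sparse : ∀ A B → G A ≡ true → G B ≡ true → A ⊆ B → ∣ A ∣ + suc τ ≤ ∣ B ∣ →
      (b C suc τ) * ((∣ B ∣ ∸ ∣ A ∣) ! * ∣ A ∣ !) ≤ ∣ B ∣ !
    sparse A B A∈G B∈G A⊆B a+t≤b = begin
      (b C suc τ) * ((∣ B ∣ ∸ ∣ A ∣) ! * ∣ A ∣ !)
        -- Both ∣A∣ and ∣B∣ - ∣A∣ are at least `suc τ`, so by unimodality the coefficient at ∣A∣ is
        -- at least the one at `suc τ`.
        ≤⟨ *-monoˡ-≤ _ (≤-trans (C-monoˡ (suc τ) (G⇒large B B∈G))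
             (C-mono ∣ A ∣ (≤-trans τ<b (G⇒large A A∈G)) (≤-trans (≤-reflexive (+-comm (suc τ) ∣ A ∣)) a+t≤b))) ⟩
      (∣ B ∣ C ∣ A ∣) * ((∣ B ∣ ∸ ∣ A ∣) ! * ∣ A ∣ !)
        ≡⟨ cong ((∣ B ∣ C ∣ A ∣) *_) (*-comm ((∣ B ∣ ∸ ∣ A ∣) !) (∣ A ∣ !)) ⟩
      (∣ B ∣ C ∣ A ∣) * (∣ A ∣ ! * (∣ B ∣ ∸ ∣ A ∣) !)
        ≡⟨ C-! (p⊆q⇒∣p∣≤∣q∣ A⊆B) ⟩
      ∣ B ∣ ! ∎
    few-below : ∀ B → G B ≡ true → ∑ (subsets n) (λ A → ⟦ G A ⟧ * 𝟙 (A ⊆? B)) ≤ D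
    few-below B B∈G = begin
      ∑ (subsets n) (λ A → ⟦ G A ⟧ * 𝟙 (A ⊆? B))
        ≤⟨ ∑-mono (subsets n) (λ A → pointwise A (F (index A)) (b ≤? ∣ A ∣) (A ⊆? B)) ⟩
      ∑ (subsets n) (λ A → ⟦ F (index A) ∧ does (comparable? n (index B) (index A)) ⟧)
        ≡⟨ ∑-index n _ ⟨
      Cube.degree n F (index B)
        ≤⟨ degree≤D (index B) (∧-trueˡ (F (index B)) B∈G) ⟩
      D ∎
      where
      pointwise : ∀ A x (d : Dec (b ≤ ∣ A ∣)) (d′ : Dec (A ⊆ B)) →
        ⟦ x ∧ does d ⟧ * 𝟙 d′ ≤ ⟦ x ∧ does (comparable? n (index B) (index A)) ⟧
      pointwise A false d       d′        = z≤n
      pointwise A true  (no _)  d′        = z≤n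
      pointwise A true  (yes _) (no _)    = z≤n
      pointwise A true  (yes _) (yes A⊆B) = ≤-reflexive (sym (𝟙-yes (comparable? n (index B) (index A))
        (inj₂ (subst₂ _⊆_ (sym (members-index A)) (sym (members-index B)) A⊆B))))
    -- Here q = `suc p`; cancelling the W on the right side of `lym` leaves the factor p.
    pW≤ : p * W ≤ suc p * (suc τ * n !)
    pW≤ = +-cancelˡ-≤ W _ _ (≤-trans (lym G τ (suc p) (b C suc τ) D
      (≤-trans (≤-reflexive (*-comm (suc p) D)) (m/n*n≤m (b C suc τ) (suc p)))
      (ℕ.>-nonZero⁻¹ (b C suc τ) {{nCk≢0 τ<b}}) sparse few-below) (≤-reflexive (+-comm _ W)))
    -- Each weight in W is n! / (n choose ∣A∣), hence at least n! / m.
    n!∑G≤ : n ! * ∑G ≤ m n * W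
    n!∑G≤ = ≤-trans (≤-reflexive (sym (∑-*ˡ (subsets n) (n !) _)))
      (≤-trans (∑-mono (subsets n) pointwise) (≤-reflexive (∑-*ˡ (subsets n) (m n) _)))
      where
      pointwise : ∀ A → n ! * ⟦ G A ⟧ ≤ m n * (⟦ G A ⟧ * ((n ∸ ∣ A ∣) ! * ∣ A ∣ !))
      pointwise A = begin
        n ! * ⟦ G A ⟧
          ≡⟨ cong (_* ⟦ G A ⟧) (C-! (∣p∣≤n A)) ⟨
        (n C ∣ A ∣) * (∣ A ∣ ! * (n ∸ ∣ A ∣) !) * ⟦ G A ⟧
          ≤⟨ *-monoˡ-≤ ⟦ G A ⟧ (*-monoˡ-≤ _ (C≤m (∣p∣≤n A))) ⟩
        m n * (∣ A ∣ ! * (n ∸ ∣ A ∣) !) * ⟦ G A ⟧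
          ≡⟨ rearrange (m n) (∣ A ∣ !) ((n ∸ ∣ A ∣) !) ⟦ G A ⟧ ⟩
        m n * (⟦ G A ⟧ * ((n ∸ ∣ A ∣) ! * ∣ A ∣ !)) ∎
        where
        rearrange : ∀ m a b g → m * (a * b) * g ≡ m * (g * (b * a))
        rearrange = solve-∀
    G-small : n ! * (p * ∑G) ≤ n ! * (suc p * (suc τ * m n))
    G-small = begin
      n ! * (p * ∑G)                       ≡⟨ rearrange (n !) p ∑G ⟩
      p * (n ! * ∑G)                       ≤⟨ *-monoʳ-≤ p n!∑G≤ ⟩
      p * (m n * W)                        ≡⟨ rearrange p (m n) W ⟩
      m n * (p * W)                        ≤⟨ *-monoʳ-≤ (m n) pW≤ ⟩
      m n * (suc p * (suc τ * n !))        ≡⟨ rearrange₂ (m n) (suc p) (suc τ) (n !) ⟩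
      n ! * (suc p * (suc τ * m n)) ∎
      where
      rearrange : ∀ a b c → a * (b * c) ≡ b * (a * c)
      rearrange = solve-∀
      rearrange₂ : ∀ m p t f → m * (p * (t * f)) ≡ f * (p * (t * m))
      rearrange₂ = solve-∀

  -- The upper bound

  ^-distribʳ-* : ∀ s a b → (a * b) ^ s ≡ a ^ s * b ^ s
  ^-distribʳ-* zero    a b = refl
  ^-distribʳ-* (suc s) a b = trans (cong (a * b *_) (^-distribʳ-* s a b)) (interchange a b (a ^ s) (b ^ s))
    where
    interchange : ∀ a b c d → a * b * (c * d) ≡ a * c * (b * d)
    interchange = solve-∀

  ^-mono-* : ∀ s {a b c d} → a * b ≤ c * d → a ^ s * b ^ s ≤ c ^ s * d ^ s
  ^-mono-* s {a} {b} {c} {d} h =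
    subst₂ _≤_ (^-distribʳ-* s a b) (^-distribʳ-* s c d) (^-monoˡ-≤ s h)

  -- Bernoulli's inequality (1 - x)^w ≥ 1 - w x at x = 1/(r + 1), with k for r + 1 - w so that no
  -- subtraction occurs.
  bernoulli-upper : ∀ r w k → w + k ≡ suc r → suc r ^ w * k ≤ suc r * r ^ w
  bernoulli-upper r zero    k refl = ≤-reflexive (trans (*-identityˡ k) (sym (*-identityʳ k)))
  bernoulli-upper r (suc w) k e = begin
    suc r * suc r ^ w * k              ≡⟨ rearrange (suc r) (suc r ^ w) k ⟩
    suc r ^ w * (suc r * k)            ≤⟨ *-monoʳ-≤ (suc r ^ w) key ⟩
    suc r ^ w * (suc k * r)            ≡⟨ *-assoc (suc r ^ w) (suc k) r ⟨
    suc r ^ w * suc k * r              ≤⟨ *-monoˡ-≤ r (bernoulli-upper r w (suc k) (trans (+-suc w k) e)) ⟩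
    suc r * r ^ w * r                  ≡⟨ rearrange₂ (suc r) (r ^ w) r ⟩
    suc r * r ^ suc w ∎
    where
    open ≤-Reasoning
    rearrange : ∀ a b c → a * b * c ≡ b * (a * c)
    rearrange = solve-∀
    rearrange₂ : ∀ a b c → a * b * c ≡ a * (c * b)
    rearrange₂ = solve-∀
    key : suc r * k ≤ suc k * r
    key = ≤-trans (+-monoˡ-≤ (r * k) (≤-trans (m≤n+m k w) (≤-reflexive (suc-injective e))))
      (≤-reflexive (cong (r +_) (*-comm r k)))

  -- Bernoulli's inequality (1 + x)^w ≥ 1 + w x at x = 1/r.
  bernoulli-lower : ∀ r w → (r + w) * r ^ w ≤ r * suc r ^ w
  bernoulli-lower r zero    = ≤-reflexive (cong (_* 1) (+-identityʳ r))
  bernoulli-lower r (suc w) = begin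
    (r + suc w) * (r * r ^ w)          ≡⟨ *-assoc (r + suc w) r (r ^ w) ⟨
    (r + suc w) * r * r ^ w            ≤⟨ *-monoˡ-≤ (r ^ w) (≤-trans (m≤m+n _ w) (≤-reflexive (key r w))) ⟩
    suc r * (r + w) * r ^ w            ≡⟨ *-assoc (suc r) (r + w) (r ^ w) ⟩
    suc r * ((r + w) * r ^ w)          ≤⟨ *-monoʳ-≤ (suc r) (bernoulli-lower r w) ⟩
    suc r * (r * suc r ^ w)            ≡⟨ swap (suc r) r (suc r ^ w) ⟩
    r * suc r ^ suc w ∎
    where
    open ≤-Reasoning
    swap : ∀ a b c → a * (b * c) ≡ b * (a * c)
    swap = solve-∀
    key : ∀ r w → (r + (1 + w)) * r + w ≡ (1 + r) * (r + w)
    key = solve-∀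

  -- (1 + 1/r)^w ≤ 1 + 1/h
  root-bound : ∀ r w h → w * suc h ≤ r → h * suc r ^ w ≤ suc h * r ^ w
  root-bound r w h wh≤r = *-cancelˡ-≤ (suc r) (begin
    suc r * (h * suc r ^ w)           ≡⟨ rearrange (suc r) h (suc r ^ w) ⟩
    suc r ^ w * (h * suc r)           ≤⟨ *-monoʳ-≤ (suc r ^ w) h[r+1]≤ ⟩
    suc r ^ w * (suc h * k)           ≡⟨ rearrange₂ (suc r ^ w) (suc h) k ⟩
    suc h * (suc r ^ w * k)           ≤⟨ *-monoʳ-≤ (suc h) (bernoulli-upper r w k w+k≡) ⟩
    suc h * (suc r * r ^ w)           ≡⟨ rearrange₂ (suc h) (suc r) (r ^ w) ⟩
    suc r * (suc h * r ^ w) ∎)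
    where
    open ≤-Reasoning
    rearrange : ∀ a b c → a * (b * c) ≡ c * (b * a)
    rearrange = solve-∀
    rearrange₂ : ∀ a b c → a * (b * c) ≡ b * (a * c)
    rearrange₂ = solve-∀
    w≤r : w ≤ r
    w≤r = ≤-trans (m≤m*n w (suc h)) wh≤r
    k : ℕ
    k = suc r ∸ w
    w+k≡ : w + k ≡ suc r
    w+k≡ = m+[n∸m]≡n (≤-trans w≤r (n≤1+n r))
    h[r+1]≤ : h * suc r ≤ suc h * k
    h[r+1]≤ = +-cancelˡ-≤ (w * suc h) _ _ (begin
      w * suc h + h * suc r     ≤⟨ +-monoˡ-≤ (h * suc r) (≤-trans wh≤r (n≤1+n r)) ⟩
      suc h * suc r             ≡⟨ cong (suc h *_) w+k≡ ⟨
      suc h * (w + k)           ≡⟨ trans (*-distribˡ-+ (suc h) w k) (cong (_+ suc h * k) (*-comm (suc h) w)) ⟩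
      w * suc h + suc h * k ∎)

  -- The s-th power of `root-bound`, after padding the exponent X to exactly w s.
  power-bound : ∀ r w h s X → 0 < r → w * suc h ≤ r → X ≤ w * s →
                h ^ s * suc r ^ X ≤ suc h ^ s * r ^ X
  power-bound r w h s X 0<r wh≤r X≤ws with m≤n⇒∃[o]m+o≡n X≤ws
  ... | o , X+o≡ws = *-cancelʳ-≤ _ _ (r ^ o) {{m^n≢0 r o {{ℕ.>-nonZero 0<r}}}} (begin
    h ^ s * suc r ^ X * r ^ o          ≤⟨ *-monoʳ-≤ (h ^ s * suc r ^ X) (^-monoˡ-≤ o (n≤1+n r)) ⟩
    h ^ s * suc r ^ X * suc r ^ o      ≡⟨ collect (h ^ s) (suc r) ⟩
    h ^ s * (suc r ^ w) ^ s            ≤⟨ ^-mono-* s {h} (root-bound r w h wh≤r) ⟩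
    suc h ^ s * (r ^ w) ^ s            ≡⟨ collect (suc h ^ s) r ⟨
    suc h ^ s * r ^ X * r ^ o ∎)
    where
    open ≤-Reasoning
    collect : ∀ a b → a * b ^ X * b ^ o ≡ a * (b ^ w) ^ s
    collect a b = trans (*-assoc a (b ^ X) (b ^ o)) (cong (a *_)
      (trans (sym (^-distribˡ-+-* b X o)) (trans (cong (b ^_) X+o≡ws) (sym (^-*-assoc b w s)))))

  -- At w = r, `bernoulli-lower` gives (1 + 1/r)^r ≥ 2.
  doubling : ∀ r j → 0 < r → 2 ^ j * r ^ (r * j) ≤ suc r ^ (r * j)
  doubling r j 0<r = subst₂ _≤_ (cong (2 ^ j *_) (^-*-assoc r r j)) (trans (*-identityˡ _) (^-*-assoc (suc r) r j))
    (subst (2 ^ j * (r ^ r) ^ j ≤_) (cong (_* (suc r ^ r) ^ j) (^-zeroˡ j))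
      (^-mono-* j {2} {r ^ r} {1} {suc r ^ r} (≤-trans twice (≤-reflexive (sym (*-identityˡ _))))))
    where
    twice : 2 * r ^ r ≤ suc r ^ r
    twice = *-cancelˡ-≤ r {{ℕ.>-nonZero 0<r}} (≤-trans (≤-reflexive (rearrange r (r ^ r))) (bernoulli-lower r r))
      where
      rearrange : ∀ r x → r * (2 * x) ≡ (r + r) * x
      rearrange = solve-∀

  n≤2^n : ∀ n → n ≤ 2 ^ n
  n≤2^n zero    = z≤n
  n≤2^n (suc n) = ≤-trans (+-mono-≤ (m^n>0 2 n) (n≤2^n n)) (+-monoʳ-≤ (2 ^ n) (m≤m+n (2 ^ n) 0))

  -- Two demands on r that pull in opposite directions: the hypothesis of `branching` wants r small
  -- compared with D, while a total charge of at most (1 + 1/h)^s wants r large compared with B μ /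
  -- s.
  BranchingRate : (B h μ s D M : ℕ) → Set
  BranchingRate B h μ s D M =
    ∃[ r ] (0 < r × s * r * r ^ D ≤ suc r ^ D * M ×
      (∀ X → X ≤ B * μ → h ^ s * suc r ^ X ≤ suc h ^ s * r ^ X))

  -- The choice r ≈ B (h + 1) μ / s, for which X ≤ B μ vertices cost at most (1 + 1/h)^s.
  branching-rate : ∀ B h μ s D M → 0 < s → s ≤ μ → μ ≤ M →
    suc h * suc B * (suc h * suc B) * μ ≤ D * s →
    BranchingRate B h μ s D M
  branching-rate B h μ s D M 0<s s≤μ μ≤M degree-large =
    r , 0<r , cost , λ X X≤ → power-bound r w h s X 0<r ≤-refl (≤-trans X≤ Bμ≤ws)
    where
    open ≤-Reasoning
    instance
      s≢0 : ℕ.NonZero s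
      s≢0 = ℕ.>-nonZero 0<s
    w r j : ℕ
    w = suc ((B * μ) / s)
    r = w * suc h
    -- As w s ≤ (B + 1) μ, the product s r is at most j μ, hence at most 2^j M. By `doubling`, (1 +
    -- 1/r)^D reaches 2^j as soon as D ≥ r j, and r j is at most j² μ / s.
    j = suc h * suc B
    0<r : 0 < r
    0<r = s≤s z≤n
    Bμ≤ws : B * μ ≤ w * s
    Bμ≤ws = <⇒≤ (m<[1+n/o]*o (B * μ) s)
      where
      m<[1+n/o]*o : ∀ x s .{{_ : ℕ.NonZero s}} → x < suc (x / s) * s
      m<[1+n/o]*o x s = ≤-trans (s≤s (≤-reflexive (m≡m%n+[m/n]*n x s))) (+-monoˡ-≤ ((x / s) * s) (m%n<n x s))
    ws≤ : w * s ≤ suc B * μ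
    ws≤ = +-mono-≤ s≤μ (m/n*n≤m (B * μ) s)
    rj≤D : r * j ≤ D
    rj≤D = *-cancelʳ-≤ _ _ s (begin
      w * suc h * j * s        ≡⟨ rearrange w (suc h) j s ⟩
      j * suc h * (w * s)      ≤⟨ *-monoʳ-≤ (j * suc h) ws≤ ⟩
      j * suc h * (suc B * μ)  ≡⟨ rearrange₂ (suc h) (suc B) μ ⟩
      j * j * μ                ≤⟨ degree-large ⟩
      D * s ∎)
      where
      rearrange : ∀ w h j s → w * h * j * s ≡ j * h * (w * s)
      rearrange = solve-∀
      rearrange₂ : ∀ h b m → h * b * h * (b * m) ≡ h * b * (h * b) * m
      rearrange₂ = solve-∀
    sr≤ : s * r ≤ 2 ^ j * M
    sr≤ = begin
      s * (w * suc h)       ≡⟨ rearrange s w (suc h) ⟩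
      suc h * (w * s)       ≤⟨ *-monoʳ-≤ (suc h) ws≤ ⟩
      suc h * (suc B * μ)   ≡⟨ *-assoc (suc h) (suc B) μ ⟨
      j * μ                 ≤⟨ *-mono-≤ (n≤2^n j) μ≤M ⟩
      2 ^ j * M ∎
      where
      rearrange : ∀ s w h → s * (w * h) ≡ h * (w * s)
      rearrange = solve-∀
    cost : s * r * r ^ D ≤ suc r ^ D * M
    cost with m≤n⇒∃[o]m+o≡n rj≤D
    ... | o , rj+o≡D = begin
      s * r * r ^ D                                 ≤⟨ *-monoˡ-≤ (r ^ D) sr≤ ⟩
      2 ^ j * M * r ^ D                             ≡⟨ cong (λ x → 2 ^ j * M * r ^ x) rj+o≡D ⟨
      2 ^ j * M * r ^ (r * j + o)                   ≡⟨ cong (2 ^ j * M *_) (^-distribˡ-+-* r (r * j) o) ⟩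
      2 ^ j * M * (r ^ (r * j) * r ^ o)             ≡⟨ rearrange (2 ^ j) M (r ^ (r * j)) (r ^ o) ⟩
      2 ^ j * r ^ (r * j) * r ^ o * M               ≤⟨ *-monoˡ-≤ M (*-mono-≤ (doubling r j 0<r) (^-monoˡ-≤ o (n≤1+n r))) ⟩
      suc r ^ (r * j) * suc r ^ o * M               ≡⟨ cong (_* M) (^-distribˡ-+-* (suc r) (r * j) o) ⟨
      suc r ^ (r * j + o) * M                       ≡⟨ cong (λ x → suc r ^ x * M) rj+o≡D ⟩
      suc r ^ D * M ∎
      where
      rearrange : ∀ a b c d → a * b * (c * d) ≡ a * c * d * b
      rearrange = solve-∀

  -- The two branching phases and their constants

  module _ (τ e′ : ℕ) where

    private
      t e g h u p₁ p₂ c₁ c₂ K₁ K₂ : ℕ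
      t = suc τ
      e = suc e′
      -- In units of m/(2e), the target size `M` is g up to rounding and the final bound (t + 1/e) m
      -- is g + 1. Each phase loses a factor 1 + 1/h per chosen set, and h = 2 g + 1 gives (1 +
      -- 1/h)² g ≤ g + 1.
      g = 2 * (t * e) + 1
      h = 2 * g + 1
      u = suc (suc t)
      -- Supersaturation starts at (1 + 1/p₁) u m plus the small sets. With p₁ = u this is (u + 1) m
      -- plus at most m, which is the threshold (t + 4) m.
      p₁ = u
      -- Here (1 + 1/p₂) t m = t m + m/(4e), and the small sets take another m/(4e), which together
      -- give t m + m/(2e).
      p₂ = 4 * e * t
      c₁ = 16 ^ u * (u ! * suc p₁)
      c₂ = 16 ^ t * (t ! * suc p₂)
      -- The 9 comes from n + 2 ≤ 3 n, squared. The `+ 1` here and in K₂ pays for the rounding down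
      -- in D₁ and D₂, which costs s ≤ m.
      K₁ = c₁ * (9 * (suc h * suc h) + 1)
      K₂ = c₂ * (suc h * suc (t + 4) * (suc h * suc (t + 4)) + 1)

    -- The part 14 + 16 u ensures n ≤ 16 (b - u) in spite of the rounding in b = n / 8; the part 32
    -- e ensures 4 e ≤ b, so that sets smaller than b number at most m/(4e).
    module Upper (n s : ℕ) (n-large : 14 + 16 * u + 32 * e ≤ n) (0<s : 0 < s) (s≤m : s ≤ m n)
                 (s-large : (K₁ + K₂) * m n ≤ s * n ^ t) where

      open ≤-Reasoning

      b M M₁ D₁ D₂ : ℕ
      b  = n / 8
      M  = t * m n + m n / (2 * e)
      M₁ = (t + 4) * m n
      D₁ = (b C u) / suc p₁
      D₂ = (b C t) / suc p₂

      8b≤n : 8 * b ≤ n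
      8b≤n = ≤-trans (≤-reflexive (*-comm 8 b)) (m/n*n≤m n 8)

      n≤8b+7 : n ≤ 7 + b * 8
      n≤8b+7 = ≤-trans (≤-reflexive (m≡m%n+[m/n]*n n 8)) (+-monoˡ-≤ (b * 8) (ℕ.s≤s⁻¹ (m%n<n n 8)))

      n+16u≤16b : n + 16 * u ≤ 16 * b
      n+16u≤16b = +-cancelʳ-≤ n _ _ (begin
        n + 16 * u + n             ≤⟨ +-mono-≤ (+-monoˡ-≤ (16 * u) n≤8b+7) n≤8b+7 ⟩
        7 + b * 8 + 16 * u + (7 + b * 8) ≡⟨ rearrange b u ⟩
        16 * b + (14 + 16 * u)     ≤⟨ +-monoʳ-≤ (16 * b) (≤-trans (m≤m+n _ (32 * e)) n-large) ⟩
        16 * b + n ∎)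
        where
        rearrange : ∀ b u → 7 + b * 8 + 16 * u + (7 + b * 8) ≡ 16 * b + (14 + 16 * u)
        rearrange = solve-∀

      u≤b : u ≤ b
      u≤b = *-cancelˡ-≤ 16 (≤-trans (m≤n+m (16 * u) n) n+16u≤16b)

      t≤b : t ≤ b
      t≤b = ≤-trans (≤-trans (n≤1+n t) (n≤1+n (suc t))) u≤b

      4e≤b : 4 * e ≤ b
      4e≤b = ℕ.s≤s⁻¹ (*-cancelʳ-< 8 (4 * e) (suc b) (begin-strict
        4 * e * 8              ≡⟨ rearrange e ⟩
        32 * e                 <⟨ m<n+m (32 * e) {14 + 16 * u} (s≤s z≤n) ⟩
        14 + 16 * u + 32 * e   ≤⟨ n-large ⟩
        n                      ≤⟨ ≤-trans n≤8b+7 (n≤1+n _) ⟩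
        suc b * 8 ∎))
        where
        rearrange : ∀ e → 4 * e * 8 ≡ 32 * e
        rearrange = solve-∀

      below≤ : 4 * e * below n b ≤ m n
      below≤ = ≤-trans (*-monoˡ-≤ (below n b) 4e≤b) (below-small n b 8b≤n)

      -- Translates the degree threshold into a power of n, through n ≤ 16 (b - v) and `C-lower`;
      -- the `suc` undoes the rounding of the quotient.
      n^≤ : ∀ v p → v ≤ u → v ≤ b → n ^ v ≤ 16 ^ v * (v ! * suc p) * suc ((b C v) / suc p)
      n^≤ v p v≤u v≤b = begin
        n ^ v                                  ≤⟨ ^-monoˡ-≤ v n≤ ⟩
        (16 * (b ∸ v)) ^ v                     ≡⟨ ^-distribʳ-* v 16 (b ∸ v) ⟩
        16 ^ v * (b ∸ v) ^ v                   ≤⟨ *-monoʳ-≤ (16 ^ v) (C-lower b v v≤b) ⟩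
        16 ^ v * (v ! * (b C v))               ≤⟨ *-monoʳ-≤ (16 ^ v) (*-monoʳ-≤ (v !) C≤) ⟩
        16 ^ v * (v ! * (suc ((b C v) / suc p) * suc p)) ≡⟨ rearrange (16 ^ v) (v !) (suc ((b C v) / suc p)) (suc p) ⟩
        16 ^ v * (v ! * suc p) * suc ((b C v) / suc p) ∎
        where
        rearrange : ∀ a b c d → a * (b * (c * d)) ≡ a * (b * d) * c
        rearrange = solve-∀
        C≤ : b C v ≤ suc ((b C v) / suc p) * suc p
        C≤ = ≤-trans (≤-reflexive (m≡m%n+[m/n]*n (b C v) (suc p))) (+-monoˡ-≤ _ (<⇒≤ (m%n<n (b C v) (suc p))))
        n≤ : n ≤ 16 * (b ∸ v)
        n≤ = +-cancelʳ-≤ (16 * v) _ _ (≤-trans (+-monoʳ-≤ n (*-monoʳ-≤ 16 v≤u)) (≤-trans n+16u≤16b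
          (≤-reflexive (trans (cong (16 *_) (sym (m∸n+n≡m v≤b))) (*-distribˡ-+ 16 (b ∸ v) v)))))

      D₂-large : suc h * suc (t + 4) * (suc h * suc (t + 4)) * m n ≤ D₂ * s
      D₂-large = +-cancelˡ-≤ (m n) _ _ (*-cancelˡ-≤ c₂ {{c₂≢0}} (begin
        c₂ * (m n + Y * m n)          ≡⟨ rearrange c₂ Y (m n) ⟩
        K₂ * m n                      ≤⟨ *-monoˡ-≤ (m n) (m≤n+m K₂ K₁) ⟩
        (K₁ + K₂) * m n               ≤⟨ s-large ⟩
        s * n ^ t                     ≤⟨ *-monoʳ-≤ s (n^≤ t p₂ (≤-trans (n≤1+n t) (n≤1+n (suc t))) t≤b) ⟩
        s * (c₂ * suc D₂)             ≡⟨ rearrange₂ s c₂ D₂ ⟩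
        c₂ * (s + D₂ * s)             ≤⟨ *-monoʳ-≤ c₂ (+-monoˡ-≤ (D₂ * s) s≤m) ⟩
        c₂ * (m n + D₂ * s) ∎))
        where
        Y : ℕ
        Y = suc h * suc (t + 4) * (suc h * suc (t + 4))
        c₂≢0 : ℕ.NonZero c₂
        c₂≢0 = m*n≢0 (16 ^ t) (t ! * suc p₂) {{m^n≢0 16 t}} {{m*n≢0 (t !) (suc p₂) {{t !≢0}}}}
        rearrange : ∀ c y m → c * (m + y * m) ≡ c * (y + 1) * m
        rearrange = solve-∀
        rearrange₂ : ∀ s c d → s * (c * (1 + d)) ≡ c * (s + d * s)
        rearrange₂ = solve-∀

      0<n : 0 < n
      0<n = ≤-trans (s≤s z≤n) n-large

      D₁-large : suc h * suc (suc n) * (suc h * suc (suc n)) * m n ≤ D₁ * s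
      D₁-large = +-cancelˡ-≤ (m n) _ _ (*-cancelˡ-≤ c₁ {{c₁≢0}} (begin
        c₁ * (m n + suc h * suc (suc n) * (suc h * suc (suc n)) * m n)
          ≤⟨ *-monoʳ-≤ c₁ (+-mono-≤ m≤ (*-monoˡ-≤ (m n) (*-mono-≤ (*-monoʳ-≤ (suc h) n+2≤) (*-monoʳ-≤ (suc h) n+2≤)))) ⟩
        c₁ * (n * n * m n + suc h * (3 * n) * (suc h * (3 * n)) * m n)
          ≡⟨ rearrange c₁ (suc h) n (m n) ⟩
        K₁ * m n * (n * n)            ≤⟨ *-monoˡ-≤ (n * n) (*-monoˡ-≤ (m n) (m≤m+n K₁ K₂)) ⟩
        (K₁ + K₂) * m n * (n * n)     ≤⟨ *-monoˡ-≤ (n * n) s-large ⟩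
        s * n ^ t * (n * n)           ≡⟨ rearrange₃ s (n ^ t) n ⟩
        s * n ^ u                     ≤⟨ *-monoʳ-≤ s (n^≤ u p₁ ≤-refl u≤b) ⟩
        s * (c₁ * suc D₁)             ≡⟨ rearrange₂ s c₁ D₁ ⟩
        c₁ * (s + D₁ * s)             ≤⟨ *-monoʳ-≤ c₁ (+-monoˡ-≤ (D₁ * s) s≤m) ⟩
        c₁ * (m n + D₁ * s) ∎))
        where
        c₁≢0 : ℕ.NonZero c₁
        c₁≢0 = m*n≢0 (16 ^ u) (u ! * suc p₁) {{m^n≢0 16 u}} {{m*n≢0 (u !) (suc p₁) {{u !≢0}}}}
        n+2≤ : suc (suc n) ≤ 3 * n
        n+2≤ = ≤-trans (+-mono-≤ 0<n (+-mono-≤ 0<n (≤-refl {n}))) (≤-reflexive (three n))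
          where
          three : ∀ n → n + (n + n) ≡ 3 * n
          three = solve-∀
        m≤ : m n ≤ n * n * m n
        m≤ = ≤-trans (≤-reflexive (sym (*-identityˡ (m n)))) (*-monoˡ-≤ (m n) (*-mono-≤ 0<n 0<n))
        rearrange : ∀ c h n m → c * (n * n * m + h * (3 * n) * (h * (3 * n)) * m) ≡ c * (9 * (h * h) + 1) * m * (n * n)
        rearrange = solve-∀
        rearrange₂ : ∀ s c d → s * (c * (1 + d)) ≡ c * (s + d * s)
        rearrange₂ = solve-∀
        rearrange₃ : ∀ s x n → s * x * (n * n) ≡ s * (n * (n * x))
        rearrange₃ = solve-∀

      dense₁ : ∀ F → M₁ < size F → ∃[ v ] (F v ≡ true × D₁ < Cube.degree n F v)
      dense₁ F M₁<F = supersaturated n (suc t) p₁ b u≤b F (begin-strict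
        suc p₁ * (u * m n) + p₁ * below n b     ≤⟨ +-monoʳ-≤ (suc p₁ * (u * m n)) (*-monoʳ-≤ p₁ (≤-trans (m≤n*m (below n b) (4 * e)) below≤)) ⟩
        suc p₁ * (u * m n) + p₁ * m n           ≡⟨ rearrange t (m n) ⟩
        p₁ * M₁                                 <⟨ *-monoʳ-< p₁ M₁<F ⟩
        p₁ * size F ∎)
        where
        rearrange : ∀ t m → (3 + t) * ((2 + t) * m) + (2 + t) * m ≡ (2 + t) * ((t + 4) * m)
        rearrange = solve-∀

      2eM≤ : 2 * e * M ≤ g * m n
      2eM≤ = begin
        2 * e * (t * m n + m n / (2 * e))           ≡⟨ rearrange e t (m n) (m n / (2 * e)) ⟩
        2 * (t * e) * m n + m n / (2 * e) * (2 * e) ≤⟨ +-monoʳ-≤ (2 * (t * e) * m n) (m/n*n≤m (m n) (2 * e)) ⟩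
        2 * (t * e) * m n + m n                       ≡⟨ rearrange₂ (2 * (t * e)) (m n) ⟩
        g * m n ∎
        where
        rearrange : ∀ e t m d → 2 * e * (t * m + d) ≡ 2 * (t * e) * m + d * (2 * e)
        rearrange = solve-∀
        rearrange₂ : ∀ a m → a * m + m ≡ (a + 1) * m
        rearrange₂ = solve-∀

      -- Rounding may leave 2 e M below g m; in `dense₂` the strict inequality `M < size F` supplies
      -- the missing unit.
      g*m<2e[1+M] : g * m n < 2 * e * suc M
      g*m<2e[1+M] = begin-strict
        g * m n                                              ≡⟨ rearrange₂ (2 * (t * e)) (m n) ⟩
        2 * (t * e) * m n + m n                              ≡⟨ cong (2 * (t * e) * m n +_) (m≡m%n+[m/n]*n (m n) (2 * e)) ⟩
        2 * (t * e) * m n + (m n % (2 * e) + m n / (2 * e) * (2 * e))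
          <⟨ +-monoʳ-< (2 * (t * e) * m n) (+-monoˡ-< _ (m%n<n (m n) (2 * e))) ⟩
        2 * (t * e) * m n + (2 * e + m n / (2 * e) * (2 * e)) ≡⟨ rearrange e t (m n) (m n / (2 * e)) ⟩
        2 * e * suc M ∎
        where
        rearrange : ∀ e t m d → 2 * (t * e) * m + (2 * e + d * (2 * e)) ≡ 2 * e * (1 + (t * m + d))
        rearrange = solve-∀
        rearrange₂ : ∀ a m → (a + 1) * m ≡ a * m + m
        rearrange₂ = solve-∀

      dense₂ : ∀ F → M < size F → ∃[ v ] (F v ≡ true × D₂ < Cube.degree n F v)
      dense₂ F M<F = supersaturated n τ p₂ b t≤b F (begin-strict
        suc p₂ * (t * m n) + p₂ * below n b                   ≡⟨ rearrange e t (m n) (below n b) ⟩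
        p₂ * (t * m n) + t * m n + t * (4 * e * below n b)    ≤⟨ +-monoʳ-≤ (p₂ * (t * m n) + t * m n) (*-monoʳ-≤ t below≤) ⟩
        p₂ * (t * m n) + t * m n + t * m n                    ≡⟨ rearrange₂ e t (m n) ⟩
        2 * t * (g * m n)                                     <⟨ *-monoʳ-< (2 * t) g*m<2e[1+M] ⟩
        2 * t * (2 * e * suc M)                               ≡⟨ rearrange₃ t e (suc M) ⟩
        p₂ * suc M                                            ≤⟨ *-monoʳ-≤ p₂ M<F ⟩
        p₂ * size F ∎)
        where
        rearrange : ∀ e t m x → (1 + 4 * e * t) * (t * m) + 4 * e * t * x ≡ 4 * e * t * (t * m) + t * m + t * (4 * e * x)
        rearrange = solve-∀
        rearrange₂ : ∀ e t m → 4 * e * t * (t * m) + t * m + t * m ≡ 2 * t * ((2 * (t * e) + 1) * m)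
        rearrange₂ = solve-∀
        rearrange₃ : ∀ t e x → 2 * t * (2 * e * x) ≡ 4 * e * t * x
        rearrange₃ = solve-∀

      m≤M : m n ≤ M
      m≤M = ≤-trans (m≤m+n (m n) (τ * m n)) (m≤m+n (t * m n) _)

      J : ℕ
      J = Cube.#orderedIndependent n (const true) s

      h²ˢJ≤ : (h * h) ^ s * J ≤ (suc h * suc h) ^ s * M ^ s
      h²ˢJ≤ = combine-phases (branching-rate (t + 4) h (m n) s D₂ M 0<s s≤m m≤M D₂-large)
                             (branching-rate (suc n) h (m n) s D₁ M 0<s s≤m m≤M D₁-large)
        where
        rearrange : ∀ h j a b → h * h * j * (a * b) ≡ h * h * (a * b * j)
        rearrange = solve-∀
        rearrange₂ : ∀ h a b c → h * h * (a * b * c) ≡ h * a * (h * b) * c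
        rearrange₂ = solve-∀
        rearrange₃ : ∀ h a b c → h * a * (h * b) * c ≡ h * h * c * (a * b)
        rearrange₃ = solve-∀
        phase₂ : ∀ r₂ → s * r₂ * r₂ ^ D₂ ≤ suc r₂ ^ D₂ * M → ∀ F → size F ≤ M₁ → ∀ s′ → s′ ≤ s →
          r₂ ^ M₁ * Cube.#orderedIndependent n F s′ ≤ suc r₂ ^ M₁ * M ^ s′
        phase₂ r₂ cost₂ F F≤M₁ s′ s′≤s = subst₂ (λ x y → x * Cube.#orderedIndependent n F s′ ≤ y * M ^ s′) (*-identityˡ (r₂ ^ M₁)) (*-identityˡ (suc r₂ ^ M₁))
          (Cube.branching n M D₂ M r₂ s 1 1 ≤-refl cost₂ dense₂
            (λ F F≤M s _ → *-monoʳ-≤ 1 (≤-trans (Cube.#orderedIndependent≤ n F s) (^-monoˡ-≤ s F≤M)))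
            M₁ M₁ ≤-refl F F≤M₁ s′ s′≤s)
        combine-phases : BranchingRate (t + 4) h (m n) s D₂ M → BranchingRate (suc n) h (m n) s D₁ M →
          (h * h) ^ s * J ≤ (suc h * suc h) ^ s * M ^ s
        combine-phases (r₂ , 0<r₂ , cost₂ , rate₂) (r₁ , 0<r₁ , cost₁ , rate₁) =
          *-cancelʳ-≤ _ _ (r₂ ^ M₁ * r₁ ^ 2 ^ n) {{m*n≢0 (r₂ ^ M₁) (r₁ ^ 2 ^ n) {{m^n≢0 r₂ M₁ {{ℕ.>-nonZero 0<r₂}}}} {{m^n≢0 r₁ (2 ^ n) {{ℕ.>-nonZero 0<r₁}}}}}} (begin
          (h * h) ^ s * J * (r₂ ^ M₁ * r₁ ^ 2 ^ n)
            ≡⟨ cong (λ x → x * J * (r₂ ^ M₁ * r₁ ^ 2 ^ n)) (^-distribʳ-* s h h) ⟩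
          h ^ s * h ^ s * J * (r₂ ^ M₁ * r₁ ^ 2 ^ n)
            ≡⟨ rearrange (h ^ s) J (r₂ ^ M₁) (r₁ ^ 2 ^ n) ⟩
          h ^ s * h ^ s * (r₂ ^ M₁ * r₁ ^ 2 ^ n * J)
            ≤⟨ *-monoʳ-≤ (h ^ s * h ^ s) phases ⟩
          h ^ s * h ^ s * (suc r₂ ^ M₁ * suc r₁ ^ 2 ^ n * M ^ s)
            ≡⟨ rearrange₂ (h ^ s) (suc r₂ ^ M₁) (suc r₁ ^ 2 ^ n) (M ^ s) ⟩
          h ^ s * suc r₂ ^ M₁ * (h ^ s * suc r₁ ^ 2 ^ n) * M ^ s
            ≤⟨ *-monoˡ-≤ (M ^ s) (*-mono-≤ (rate₂ M₁ ≤-refl) (rate₁ (2 ^ n) (2^n≤[1+n]m n))) ⟩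
          suc h ^ s * r₂ ^ M₁ * (suc h ^ s * r₁ ^ 2 ^ n) * M ^ s
            ≡⟨ rearrange₃ (suc h ^ s) (r₂ ^ M₁) (r₁ ^ 2 ^ n) (M ^ s) ⟩
          suc h ^ s * suc h ^ s * M ^ s * (r₂ ^ M₁ * r₁ ^ 2 ^ n)
            ≡⟨ cong (λ x → x * M ^ s * (r₂ ^ M₁ * r₁ ^ 2 ^ n)) (^-distribʳ-* s (suc h) (suc h)) ⟨
          (suc h * suc h) ^ s * M ^ s * (r₂ ^ M₁ * r₁ ^ 2 ^ n) ∎)
          where
          phases : r₂ ^ M₁ * r₁ ^ 2 ^ n * J ≤ suc r₂ ^ M₁ * suc r₁ ^ 2 ^ n * M ^ s
          -- The base case of the phase starting at 2^n is the whole phase starting at M₁, whose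
          -- charge enters through the constants `r₂ ^ M₁` and `suc r₂ ^ M₁`.
          phases = Cube.branching n M₁ D₁ M r₁ s (r₂ ^ M₁) (suc r₂ ^ M₁) (^-monoˡ-≤ M₁ (n≤1+n r₂)) cost₁ dense₁ (phase₂ r₂ cost₂)
            (2 ^ n) (2 ^ n) ≤-refl (const true) (size≤ {2 ^ n} (const true)) s ≤-refl

      eˢJ≤ : e ^ s * J ≤ ((t * e + 1) * m n) ^ s
      eˢJ≤ = *-cancelˡ-≤ ((2 * (h * h)) ^ s) {{m^n≢0 (2 * (h * h)) s {{2hh≢0}}}} (begin
        (2 * (h * h)) ^ s * (e ^ s * J)             ≡⟨ cong (_* (e ^ s * J)) (^-distribʳ-* s 2 (h * h)) ⟩
        2 ^ s * (h * h) ^ s * (e ^ s * J)           ≡⟨ rearrange (2 ^ s) ((h * h) ^ s) (e ^ s) J ⟩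
        2 ^ s * e ^ s * ((h * h) ^ s * J)           ≤⟨ *-monoʳ-≤ (2 ^ s * e ^ s) h²ˢJ≤ ⟩
        2 ^ s * e ^ s * ((suc h * suc h) ^ s * M ^ s)
          ≡⟨ cong₂ _*_ (^-distribʳ-* s 2 e) (^-distribʳ-* s (suc h * suc h) M) ⟨
        (2 * e) ^ s * (suc h * suc h * M) ^ s       ≤⟨ ^-mono-* s {2 * e} {suc h * suc h * M} {2 * (h * h)} {(t * e + 1) * m n} key ⟩
        (2 * (h * h)) ^ s * ((t * e + 1) * m n) ^ s ∎)
        where
        rearrange : ∀ a b c d → a * b * (c * d) ≡ a * c * (b * d)
        rearrange = solve-∀
        2hh≢0 : ℕ.NonZero (2 * (h * h))
        2hh≢0 = m*n≢0 2 (h * h) {{_}} {{m*n≢0 h h {{h≢0}} {{h≢0}}}}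
          where
          h≢0 : ℕ.NonZero h
          h≢0 = ℕ.>-nonZero (m≤n+m 1 (2 * g))
        rearrange₂ : ∀ e h m → 2 * e * (h * h * m) ≡ h * h * (2 * e * m)
        rearrange₂ = solve-∀
        expand : ∀ g m → (1 + (2 * g + 1)) * (1 + (2 * g + 1)) * (g * m) + (g + 1) * m ≡
                         (2 * g + 1) * (2 * g + 1) * ((g + 1) * m)
        expand = solve-∀
        regroup : ∀ x t e m → x * ((2 * (t * e) + 1 + 1) * m) ≡ 2 * x * ((t * e + 1) * m)
        regroup = solve-∀
        key : 2 * e * (suc h * suc h * M) ≤ 2 * (h * h) * ((t * e + 1) * m n)
        key = begin
          2 * e * (suc h * suc h * M)      ≡⟨ rearrange₂ e (suc h) M ⟩
          suc h * suc h * (2 * e * M)      ≤⟨ *-monoʳ-≤ (suc h * suc h) 2eM≤ ⟩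
          suc h * suc h * (g * m n)        ≤⟨ m≤m+n _ ((g + 1) * m n) ⟩
          suc h * suc h * (g * m n) + (g + 1) * m n ≡⟨ expand g (m n) ⟩
          h * h * ((g + 1) * m n)          ≡⟨ regroup (h * h) t e (m n) ⟩
          2 * (h * h) * ((t * e + 1) * m n) ∎

    #antichains-upper : ∃[ K ] ∃[ N ] ∀ n s → N ≤ n → 0 < s → s ≤ m n → K * m n ≤ s * n ^ suc τ →
      suc e′ ^ s * (s ! * #antichains n s) ≤ ((suc τ * suc e′ + 1) * m n) ^ s
    #antichains-upper = K₁ + K₂ , 14 + 16 * u + 32 * e , λ n s n-large 0<s s≤m s-large →
      subst (λ x → e ^ s * (s ! * x) ≤ ((t * e + 1) * m n) ^ s) (sym (#antichains≡ n s))
        (Upper.eˢJ≤ n s n-large 0<s s≤m s-large)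

  -- The lower bound

  dist : ∀ {n} → Subset n → Subset n → ℕ
  dist []          []          = 0
  dist (true  ∷ A) (true  ∷ B) = dist A B
  dist (true  ∷ A) (false ∷ B) = suc (dist A B)
  dist (false ∷ A) (true  ∷ B) = suc (dist A B)
  dist (false ∷ A) (false ∷ B) = dist A B

  dist-sym : ∀ {n} (A B : Subset n) → dist A B ≡ dist B A
  dist-sym []          []          = refl
  dist-sym (true  ∷ A) (true  ∷ B) = dist-sym A B
  dist-sym (true  ∷ A) (false ∷ B) = cong suc (dist-sym A B)
  dist-sym (false ∷ A) (true  ∷ B) = cong suc (dist-sym A B)
  dist-sym (false ∷ A) (false ∷ B) = dist-sym A B

  dist-⊆ : ∀ {n} (A B : Subset n) → A ⊆ B → ∣ A ∣ + dist A B ≡ ∣ B ∣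
  dist-⊆ []          []          _   = refl
  dist-⊆ (true  ∷ A) (true  ∷ B) A⊆B = cong suc (dist-⊆ A B (drop-∷-⊆ A⊆B))
  dist-⊆ (true  ∷ A) (false ∷ B) A⊆B with () ← []=⇒lookup (A⊆B here)
  dist-⊆ (false ∷ A) (true  ∷ B) A⊆B = trans (+-suc ∣ A ∣ _) (cong suc (dist-⊆ A B (drop-∷-⊆ A⊆B)))
  dist-⊆ (false ∷ A) (false ∷ B) A⊆B = dist-⊆ A B (drop-∷-⊆ A⊆B)

  ball : ∀ {n} → Subset n → ℕ → ℕ
  ball {n} B d = ∑ (subsets n) (λ A → 𝟙 (dist B A ≤? d))

  sphere-shift : ∀ {n} (B : Subset n) d → ∑ (subsets n) (λ A → 𝟙 (suc (dist B A) ≤? suc d)) ≡ ball B d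
  sphere-shift {n} B d = ∑-cong (subsets n) λ A → 𝟙-cong (suc (dist B A) ≤? suc d) (dist B A ≤? d) ℕ.s≤s⁻¹ s≤s

  -- A set within distance d is reached in d moves, each of which flips one of the n coordinates or
  -- does nothing. The induction splits on whether the first coordinates agree.
  ball≤ : ∀ {n} (B : Subset n) d → ball B d ≤ suc n ^ d
  ball≤ []                  d       = ≤-reflexive (sym (^-zeroˡ d))
  ball≤ {suc n} (true ∷ B)  zero    = ≤-trans (≤-reflexive (∑-subsets-suc n _))
    (+-mono-≤ (≤-reflexive (∑-zero (subsets n) λ _ → refl)) (ball≤ B 0))
  ball≤ {suc n} (false ∷ B) zero    = ≤-trans (≤-reflexive (trans (∑-subsets-suc n _)
    (trans (cong (ball B 0 +_) (∑-zero (subsets n) λ _ → refl)) (+-identityʳ _)))) (ball≤ B 0)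
  ball≤ {suc n} (b ∷ B)     (suc d) = begin
    ball (b ∷ B) (suc d)              ≤⟨ ≤-reflexive (split b) ⟩
    ball B d + ball B (suc d)         ≤⟨ +-mono-≤ (ball≤ B d) (ball≤ B (suc d)) ⟩
    suc n ^ d + suc n * suc n ^ d     ≤⟨ *-monoʳ-≤ (suc (suc n)) (^-monoˡ-≤ d (n≤1+n (suc n))) ⟩
    suc (suc n) ^ suc d ∎
    where
    open ≤-Reasoning
    split : ∀ b → ball (b ∷ B) (suc d) ≡ ball B d + ball B (suc d)
    split true  = trans (∑-subsets-suc n _) (cong (_+ ball B (suc d)) (sphere-shift B d))
    split false = trans (∑-subsets-suc n _) (trans (cong (ball B (suc d) +_) (sphere-shift B d)) (+-comm _ (ball B d)))

  inBand : ℕ → ℕ → ℕ → Bool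
  inBand h j a = does (h ≤? a) ∧ does (a <? h + j)

  inBand⁻ : ∀ h j a → inBand h j a ≡ true → h ≤ a × a < h + j
  inBand⁻ h j a = cases (h ≤? a) (a <? h + j)
    where
    cases : (d : Dec (h ≤ a)) (d′ : Dec (a < h + j)) → does d ∧ does d′ ≡ true → h ≤ a × a < h + j
    cases (yes p) (yes q) _ = p , q

  band : ℕ → ℕ → ℕ → ℕ
  band n h j = ∑ (subsets n) (λ A → ⟦ inBand h j ∣ A ∣ ⟧)

  band-suc : ∀ n h j → band n h j + n C (h + j) ≤ band n h (suc j)
  band-suc n h j = ≤-trans (≤-reflexive (trans (cong (band n h j +_) (sym (∑-layer n (h + j)))) (sym (∑-+ (subsets n) _ _))))
    (∑-mono (subsets n) λ A → cases ∣ A ∣ (h ≤? ∣ A ∣) (∣ A ∣ <? h + j) (∣ A ∣ ℕ.≟ h + j))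
    where
    a<h+1+j : ∀ {a} → a ≤ h + j → a < h + suc j
    a<h+1+j a≤ = ≤-trans (s≤s a≤) (≤-reflexive (sym (+-suc h j)))
    cases : ∀ a (d : Dec (h ≤ a)) (d′ : Dec (a < h + j)) (d″ : Dec (a ≡ h + j)) →
      ⟦ does d ∧ does d′ ⟧ + 𝟙 d″ ≤ ⟦ inBand h (suc j) a ⟧
    cases a (yes h≤a) (yes a<) (yes a≡) = ⊥-elim (<-irrefl a≡ a<)
    cases a (yes h≤a) (yes a<) (no _)   = ≤-reflexive (sym (cong ⟦_⟧ (∧-true (does-yes (h ≤? a) h≤a) (does-yes (a <? h + suc j) (a<h+1+j (<⇒≤ a<))))))
    cases a d         (no _)   (yes a≡) = ≤-trans (≤-reflexive (cong (_+ 1) (∧-false (does d))))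
      (≤-reflexive (sym (cong ⟦_⟧ (∧-true (does-yes (h ≤? a) (≤-trans (m≤m+n h j) (≤-reflexive (sym a≡)))) (does-yes (a <? h + suc j) (a<h+1+j (≤-reflexive a≡)))))))
      where
      ∧-false : ∀ b → ⟦ b ∧ false ⟧ ≡ 0
      ∧-false true  = refl
      ∧-false false = refl
    cases a (no h≰a)  (yes a<) (yes a≡) = ⊥-elim (<-irrefl a≡ a<)
    cases a (no _)    (yes _)  (no _)   = z≤n
    cases a (yes _)   (no _)   (no _)   = z≤n
    cases a (no _)    (no _)   (no _)   = z≤n

  module Middle (n t E : ℕ) (0<E : 0 < E) (E-small : E * (2 * t) ≤ ⌊ n /2⌋) where

    private
      h : ℕ
      h = ⌊ n /2⌋

    -- The ratio of consecutive layers is (n - k)/(k + 1) at k = h + i. The denominator exceeds the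
    -- numerator by at most 2 i + 1 < 2 t, a fraction of at most 1/E of k + 1 because 2 t E ≤ h.
    next-layer : ∀ i → i < t → E * (n C (h + i)) ≤ E * (n C suc (h + i)) + n C (h + i)
    next-layer i i<t = *-cancelˡ-≤ (suc k) (begin
      suc k * (E * (n C k))                         ≡⟨ rearrange (suc k) E (n C k) ⟩
      E * suc k * (n C k)                           ≤⟨ *-monoˡ-≤ (n C k) ratio ⟩
      (E * (n ∸ k) + suc k) * (n C k)               ≡⟨ rearrange₂ E (n ∸ k) (suc k) (n C k) ⟩
      E * ((n ∸ k) * (n C k)) + suc k * (n C k)     ≡⟨ cong (λ x → E * x + suc k * (n C k)) (C-step k<n) ⟨
      E * (suc k * (n C suc k)) + suc k * (n C k)   ≡⟨ rearrange₃ E (suc k) (n C suc k) (n C k) ⟩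
      suc k * (E * (n C suc k) + n C k) ∎)
      where
      open ≤-Reasoning
      k : ℕ
      k = h + i
      rearrange : ∀ a b c → a * (b * c) ≡ b * a * c
      rearrange = solve-∀
      rearrange₂ : ∀ e x k c → (e * x + k) * c ≡ e * (x * c) + k * c
      rearrange₂ = solve-∀
      rearrange₃ : ∀ e k c d → e * (k * c) + k * d ≡ k * (e * c + d)
      rearrange₃ = solve-∀
      2i+1≤2t : suc (2 * i) ≤ 2 * t
      2i+1≤2t = ≤-trans (n≤1+n _) (≤-trans (≤-reflexive (double i)) (*-monoʳ-≤ 2 i<t))
        where
        double : ∀ i → 2 + 2 * i ≡ 2 * (1 + i)
        double = solve-∀
      E[2i+1]≤h : E * suc (2 * i) ≤ h
      E[2i+1]≤h = ≤-trans (*-monoʳ-≤ E 2i+1≤2t) E-small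
      i<h : i < h
      i<h = ≤-trans (s≤s (m≤m+n i _)) (≤-trans (m≤n*m (suc (2 * i)) E {{ℕ.>-nonZero 0<E}}) E[2i+1]≤h)
      k<n : k < n
      k<n = ≤-trans (+-monoʳ-< h i<h) (⌊n/2⌋+⌊n/2⌋≤n n)
      h≤i+x : h ≤ i + (n ∸ k)
      h≤i+x = +-cancelˡ-≤ h _ _ (≤-trans (⌊n/2⌋+⌊n/2⌋≤n n)
        (≤-reflexive (trans (sym (m+[n∸m]≡n (<⇒≤ k<n))) (+-assoc h i _))))
      ratio : E * suc k ≤ E * (n ∸ k) + suc k
      ratio = begin
        E * suc (h + i)                       ≤⟨ *-monoʳ-≤ E (s≤s (+-monoˡ-≤ i h≤i+x)) ⟩
        E * suc (i + (n ∸ k) + i)             ≡⟨ rearrange₄ E i (n ∸ k) ⟩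
        E * (n ∸ k) + E * suc (2 * i)         ≤⟨ +-monoʳ-≤ (E * (n ∸ k)) (≤-trans E[2i+1]≤h (≤-trans (m≤m+n h i) (n≤1+n k))) ⟩
        E * (n ∸ k) + suc k ∎
        where
        rearrange₄ : ∀ e i x → e * (1 + (i + x + i)) ≡ e * x + e * (1 + 2 * i)
        rearrange₄ = solve-∀

    -- Each of the i steps up from the middle loses at most m/E.
    layer-lower : ∀ i → i ≤ t → E * m n ≤ E * (n C (h + i)) + i * m n
    layer-lower zero    _   = ≤-reflexive (sym (trans (+-identityʳ _) (cong (λ x → E * (n C x)) (+-identityʳ h))))
    layer-lower (suc i) i<t = begin
      E * m n                                             ≤⟨ layer-lower i (<⇒≤ i<t) ⟩
      E * (n C (h + i)) + i * m n                         ≤⟨ +-monoˡ-≤ (i * m n) (next-layer i i<t) ⟩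
      E * (n C suc (h + i)) + n C (h + i) + i * m n       ≤⟨ +-monoˡ-≤ (i * m n) (+-monoʳ-≤ (E * (n C suc (h + i))) layer≤m) ⟩
      E * (n C suc (h + i)) + m n + i * m n               ≡⟨ +-assoc (E * (n C suc (h + i))) (m n) (i * m n) ⟩
      E * (n C suc (h + i)) + suc i * m n                 ≡⟨ cong (λ x → E * (n C x) + suc i * m n) (+-suc h i) ⟨
      E * (n C (h + suc i)) + suc i * m n ∎
      where
      open ≤-Reasoning
      i≤h : i ≤ h
      i≤h = ≤-trans (<⇒≤ i<t) (≤-trans (m≤m+n t _) (≤-trans (m≤n*m (2 * t) E {{ℕ.>-nonZero 0<E}}) E-small))
      layer≤m : n C (h + i) ≤ m n
      layer≤m = C≤m (≤-trans (+-monoʳ-≤ h i≤h) (⌊n/2⌋+⌊n/2⌋≤n n))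

    -- The losses of the j layers add up to 0 + 1 + ... + (j - 1) times m/E, which is at most j²
    -- m/E.
    band-lower : ∀ j → j ≤ t → E * (j * m n) ≤ E * band n h j + j * j * m n
    band-lower zero    _   = ≤-trans (≤-reflexive (*-zeroʳ E)) z≤n
    band-lower (suc j) j<t = begin
      E * (suc j * m n)                                             ≡⟨ *-distribˡ-+ E (m n) (j * m n) ⟩
      E * m n + E * (j * m n)                                       ≤⟨ +-mono-≤ (layer-lower j (<⇒≤ j<t)) (band-lower j (<⇒≤ j<t)) ⟩
      E * (n C (h + j)) + j * m n + (E * band n h j + j * j * m n)  ≡⟨ rearrange E (n C (h + j)) (band n h j) j (m n) ⟩
      E * (band n h j + n C (h + j)) + (j * j + j) * m n            ≤⟨ +-mono-≤ (*-monoʳ-≤ E (band-suc n h j)) (*-monoˡ-≤ (m n) (≤-trans (m≤m+n (j * j + j) (suc j)) (≤-reflexive (square j)))) ⟩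
      E * band n h (suc j) + suc j * suc j * m n ∎
      where
      open ≤-Reasoning
      rearrange : ∀ e c b j m → e * c + j * m + (e * b + j * j * m) ≡ e * (b + c) + (j * j + j) * m
      rearrange = solve-∀
      square : ∀ j → j * j + j + (1 + j) ≡ (1 + j) * (1 + j)
      square = solve-∀

  module Lower (n τ e s : ℕ) (0<n : 0 < n) (0<e : 0 < e)
               (n-large : 2 * e * (suc τ * suc τ) * (2 * suc τ) ≤ ⌊ n /2⌋)
               (s-small : 2 * e * 2 ^ τ * s * n ^ τ ≤ m n) where

    open ≤-Reasoning

    t h d a : ℕ
    t = suc τ
    h = ⌊ n /2⌋
    d = suc n ^ τ
    -- That is, a / e = (t - 1/e) m. Half of the missing m/e covers the deficit of the band against
    -- t m, the other half the neighbourhoods of the chosen sets.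
    a = (t * e ∸ 1) * m n

    L : Fin (2 ^ n) → Bool
    L i = inBand h t ∣ members n i ∣

    size-L : size L ≡ band n h t
    size-L = ∑-members n (λ A → ⟦ inBand h t ∣ A ∣ ⟧)

    close : ∀ (A B : Subset n) → inBand h t ∣ A ∣ ≡ true → inBand h t ∣ B ∣ ≡ true → A ⊆ B → dist A B ≤ τ
    close A B A∈L B∈L A⊆B = +-cancelˡ-≤ h _ _ (begin
      h + dist A B        ≤⟨ +-monoˡ-≤ (dist A B) (proj₁ (inBand⁻ h t ∣ A ∣ A∈L)) ⟩
      ∣ A ∣ + dist A B    ≡⟨ dist-⊆ A B A⊆B ⟩
      ∣ B ∣               ≤⟨ ℕ.s≤s⁻¹ (≤-trans (proj₂ (inBand⁻ h t ∣ B ∣ B∈L)) (≤-reflexive (+-suc h τ))) ⟩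
      h + τ ∎)

    -- Comparable members of the band differ in as many elements as their sizes do, at most τ, so a
    -- closed neighbourhood lies in a Hamming ball of radius τ.
    degree-L : ∀ u → L u ≡ true → Cube.degree n L u ≤ d
    degree-L u u∈L = begin
      Cube.degree n L u                                                       ≤⟨ ∑-mono (allFin (2 ^ n)) (λ i → near i (L i) refl (comparable? n u i)) ⟩
      ∑ (allFin (2 ^ n)) (λ i → 𝟙 (dist (members n u) (members n i) ≤? τ))  ≡⟨ ∑-members n (λ A → 𝟙 (dist (members n u) A ≤? τ)) ⟩
      ball (members n u) τ                                                    ≤⟨ ball≤ (members n u) τ ⟩
      d ∎
      where
      near : ∀ i x → L i ≡ x → (c : Dec (Comparable n u i)) → ⟦ x ∧ does c ⟧ ≤ 𝟙 (dist (members n u) (members n i) ≤? τ)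
      near i false _   _               = z≤n
      near i true  _   (no _)          = z≤n
      near i true  i∈L (yes (inj₁ u⊆i)) = ≤-reflexive (sym (𝟙-yes (dist (members n u) (members n i) ≤? τ)
        (close (members n u) (members n i) u∈L i∈L u⊆i)))
      near i true  i∈L (yes (inj₂ i⊆u)) = ≤-reflexive (sym (𝟙-yes (dist (members n u) (members n i) ≤? τ)
        (subst (_≤ τ) (dist-sym (members n i) (members n u)) (close (members n i) (members n u) i∈L u∈L i⊆u))))

    -- The deficit in `band-lower` is t² m/E, and E = 2 e t² makes it m/(2e).
    2etm≤ : 2 * e * (t * m n) ≤ 2 * e * size L + m n
    2etm≤ = *-cancelʳ-≤ _ _ (t * t) (begin
      2 * e * (t * m n) * (t * t)                    ≡⟨ rearrange (2 * e) t (m n) ⟩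
      2 * e * (t * t) * (t * m n)                    ≤⟨ Middle.band-lower n t (2 * e * (t * t)) 0<E n-large t ≤-refl ⟩
      2 * e * (t * t) * band n h t + t * t * m n     ≡⟨ cong (λ x → 2 * e * (t * t) * x + t * t * m n) size-L ⟨
      2 * e * (t * t) * size L + t * t * m n         ≡⟨ rearrange₂ (2 * e) t (size L) (m n) ⟩
      (2 * e * size L + m n) * (t * t) ∎)
      where
      rearrange : ∀ e t m → e * (t * m) * (t * t) ≡ e * (t * t) * (t * m)
      rearrange = solve-∀
      rearrange₂ : ∀ e t l m → e * (t * t) * l + t * t * m ≡ (e * l + m) * (t * t)
      rearrange₂ = solve-∀
      0<E : 0 < 2 * e * (t * t)
      0<E = *-mono-≤ (*-mono-≤ (s≤s (z≤n {1})) 0<e) (s≤s (z≤n {τ + τ * t}))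

    2esd≤m : 2 * (e * (s * d)) ≤ m n
    2esd≤m = begin
      2 * (e * (s * suc n ^ τ))            ≤⟨ *-monoʳ-≤ 2 (*-monoʳ-≤ e (*-monoʳ-≤ s (^-monoˡ-≤ τ n+1≤2n))) ⟩
      2 * (e * (s * (2 * n) ^ τ))          ≡⟨ cong (λ x → 2 * (e * (s * x))) (^-distribʳ-* τ 2 n) ⟩
      2 * (e * (s * (2 ^ τ * n ^ τ)))      ≡⟨ rearrange e s (2 ^ τ) (n ^ τ) ⟩
      2 * e * 2 ^ τ * s * n ^ τ            ≤⟨ s-small ⟩
      m n ∎
      where
      rearrange : ∀ e s x y → 2 * (e * (s * (x * y))) ≡ 2 * e * x * s * y
      rearrange = solve-∀
      n+1≤2n : suc n ≤ 2 * n
      n+1≤2n = ≤-trans (+-monoˡ-≤ n 0<n) (+-monoʳ-≤ n (m≤m+n n 0))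

    a+m≡ : a + m n ≡ e * (t * m n)
    a+m≡ = begin-equality
      (t * e ∸ 1) * m n + m n           ≡⟨ +-comm _ (m n) ⟩
      suc (t * e ∸ 1) * m n             ≡⟨ cong (_* m n) (m+[n∸m]≡n {1} {t * e} (≤-trans 0<e (m≤m+n e (τ * e)))) ⟩
      t * e * m n                       ≡⟨ rearrange t e (m n) ⟩
      e * (t * m n) ∎
      where
      rearrange : ∀ t e m → t * e * m ≡ e * (t * m)
      rearrange = solve-∀

    room : a + e * (s * d) ≤ e * size L
    room = *-cancelˡ-≤ 2 (+-cancelʳ-≤ (m n) _ _ (begin
      2 * (a + e * (s * d)) + m n           ≡⟨ rearrange a (e * (s * d)) (m n) ⟩
      2 * a + 2 * (e * (s * d)) + m n       ≤⟨ +-monoˡ-≤ (m n) (+-monoʳ-≤ (2 * a) 2esd≤m) ⟩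
      2 * a + m n + m n                     ≡⟨ rearrange₂ a (m n) ⟩
      2 * (a + m n)                         ≡⟨ cong (2 *_) a+m≡ ⟩
      2 * (e * (t * m n))                   ≡⟨ *-assoc 2 e (t * m n) ⟨
      2 * e * (t * m n)                     ≤⟨ 2etm≤ ⟩
      2 * e * size L + m n                  ≡⟨ cong (_+ m n) (*-assoc 2 e (size L)) ⟩
      2 * (e * size L) + m n ∎))
      where
      rearrange : ∀ a b m → 2 * (a + b) + m ≡ 2 * a + 2 * b + m
      rearrange = solve-∀
      rearrange₂ : ∀ a m → 2 * a + m + m ≡ 2 * (a + m)
      rearrange₂ = solve-∀

    aˢ≤ : a ^ s ≤ e ^ s * Cube.#orderedIndependent n (const true) s
    aˢ≤ = ≤-trans (Cube.greedy n L a e d s degree-L room s ≤-refl)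
      (*-monoʳ-≤ (e ^ s) (*-monoʳ-≤ (s !) (Cube.#independent-mono n s λ _ _ → refl)))

  #antichains-lower : ∀ τ e → 0 < e → ∃[ K ] ∃[ N ] ∀ n s → 0 < n → N ≤ n → K * s * n ^ τ ≤ m n →
    ((suc τ * e ∸ 1) * m n) ^ s ≤ e ^ s * (s ! * #antichains n s)
  #antichains-lower τ e 0<e = 2 * e * 2 ^ τ , 2 * E , λ n s 0<n N≤n s-small →
    subst (λ x → ((suc τ * e ∸ 1) * m n) ^ s ≤ e ^ s * (s ! * x)) (sym (#antichains≡ n s))
      (Lower.aˢ≤ n τ e s 0<n 0<e (≤-trans (≤-reflexive (half-double E)) (⌊n/2⌋-mono N≤n)) s-small)
    where
    E : ℕ
    E = 2 * e * (suc τ * suc τ) * (2 * suc τ)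
    half-double : ∀ x → x ≡ ⌊ 2 * x /2⌋
    half-double x = trans (n≡⌊n+n/2⌋ x) (cong (λ y → ⌊ x + y /2⌋) (sym (+-identityʳ x)))

open Counting using (#antichains-upper; #antichains-lower)
open import Data.Rational as ℚ
  using (ℚ; 0ℚ; 1ℚ; mkℚ; _+_; _-_; _*_; -_; ∣_∣; 1/_; _/_; _÷_; _≤_; _<_; fromℚᵘ; NonNegative; Positive)
open import Data.Rational.Properties
open import Data.Rational.Solver using (module +-*-Solver)
open import Data.Rational.Unnormalised as ℚᵘ using (mkℚᵘ; *≡*)
import Data.Rational.Unnormalised.Properties as ℚᵘ

-- The embedding of ℕ into ℚ

fromℚᵘ-+ : ∀ p q → fromℚᵘ p + fromℚᵘ q ≡ fromℚᵘ (p ℚᵘ.+ q)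
fromℚᵘ-+ p q = toℚᵘ-injective (ℚᵘ.≃-trans (toℚᵘ-homo-+ (fromℚᵘ p) (fromℚᵘ q))
  (ℚᵘ.≃-trans (ℚᵘ.+-cong (toℚᵘ-fromℚᵘ p) (toℚᵘ-fromℚᵘ q)) (ℚᵘ.≃-sym (toℚᵘ-fromℚᵘ (p ℚᵘ.+ q)))))

fromℚᵘ-* : ∀ p q → fromℚᵘ p * fromℚᵘ q ≡ fromℚᵘ (p ℚᵘ.* q)
fromℚᵘ-* p q = toℚᵘ-injective (ℚᵘ.≃-trans (toℚᵘ-homo-* (fromℚᵘ p) (fromℚᵘ q))
  (ℚᵘ.≃-trans (ℚᵘ.*-cong (toℚᵘ-fromℚᵘ p) (toℚᵘ-fromℚᵘ q)) (ℚᵘ.≃-sym (toℚᵘ-fromℚᵘ (p ℚᵘ.* q)))))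

fromℕ-+ : ∀ a b → fromℕ (a ℕ.+ b) ≡ fromℕ a + fromℕ b
fromℕ-+ a b = sym (trans (fromℚᵘ-+ (mkℚᵘ (ℤ.+ a) 0) (mkℚᵘ (ℤ.+ b) 0)) (fromℚᵘ-cong {mkℚᵘ (ℤ.+ a) 0 ℚᵘ.+ mkℚᵘ (ℤ.+ b) 0} {mkℚᵘ (ℤ.+ (a ℕ.+ b)) 0}
  (*≡* (cong (ℤ._* ℤ.+ 1) (cong₂ ℤ._+_ (ℤ.*-identityʳ (ℤ.+ a)) (ℤ.*-identityʳ (ℤ.+ b)))))))

fromℕ-* : ∀ a b → fromℕ (a ℕ.* b) ≡ fromℕ a * fromℕ b
fromℕ-* a b = sym (trans (fromℚᵘ-* (mkℚᵘ (ℤ.+ a) 0) (mkℚᵘ (ℤ.+ b) 0)) (fromℚᵘ-cong {mkℚᵘ (ℤ.+ a) 0 ℚᵘ.* mkℚᵘ (ℤ.+ b) 0} {mkℚᵘ (ℤ.+ (a ℕ.* b)) 0}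
  (*≡* (cong (ℤ._* ℤ.+ 1) (sym (ℤ.pos-* a b))))))

/-*-cancel : ∀ a d .{{_ : ℕ.NonZero d}} → (ℤ.+ a / d) * fromℕ d ≡ fromℕ a
/-*-cancel a (suc d) = trans (fromℚᵘ-* (mkℚᵘ (ℤ.+ a) d) (mkℚᵘ (ℤ.+ suc d) 0))
  (fromℚᵘ-cong {mkℚᵘ (ℤ.+ a) d ℚᵘ.* mkℚᵘ (ℤ.+ suc d) 0} {mkℚᵘ (ℤ.+ a) 0}
    (*≡* (trans (ℤ.*-assoc (ℤ.+ a) (ℤ.+ suc d) (ℤ.+ 1)) (cong (ℤ.+ a ℤ.*_) (sym (ℤ.pos-* (suc d) 1))))))

fromℕ-nonNeg : ∀ k → NonNegative (fromℕ k)
fromℕ-nonNeg k = normalize-nonNeg k 1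

0≤fromℕ : ∀ k → 0ℚ ≤ fromℕ k
0≤fromℕ k = nonNegative⁻¹ (fromℕ k) {{fromℕ-nonNeg k}}

*-monoˡ-fromℕ : ∀ k {p q} → p ≤ q → fromℕ k * p ≤ fromℕ k * q
*-monoˡ-fromℕ k = *-monoˡ-≤-nonNeg (fromℕ k) {{fromℕ-nonNeg k}}

*-monoʳ-fromℕ : ∀ k {p q} → p ≤ q → p * fromℕ k ≤ q * fromℕ k
*-monoʳ-fromℕ k = *-monoʳ-≤-nonNeg (fromℕ k) {{fromℕ-nonNeg k}}

fromℕ-pos : ∀ k .{{_ : ℕ.NonZero k}} → Positive (fromℕ k)
fromℕ-pos k = normalize-pos k 1

fromℕ-mono : ∀ a b → a ℕ.≤ b → fromℕ a ≤ fromℕ b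
fromℕ-mono a b a≤b with ℕₚ.m≤n⇒∃[o]m+o≡n a≤b
... | o , refl = ≤-trans (≤-reflexive (sym (+-identityʳ (fromℕ a))))
  (≤-trans (+-monoʳ-≤ (fromℕ a) (0≤fromℕ o)) (≤-reflexive (sym (fromℕ-+ a o))))

fromℕ-cancel-< : ∀ a b → fromℕ a < fromℕ b → a ℕ.< b
fromℕ-cancel-< a b a<b with b ℕ.≤? a
... | yes b≤a = ⊥-elim (<-irrefl refl (<-≤-trans a<b (fromℕ-mono b a b≤a)))
... | no  b≰a = ℕₚ.≰⇒> b≰a

÷<⇒<* : ∀ p q r .{{_ : Positive q}} → (p ÷ q) {{pos⇒nonZero q}} < r → p < r * q
÷<⇒<* p q r p÷q<r = subst (_< r * q) eq (*-monoˡ-<-pos q p÷q<r)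
  where
  instance
    q≢0 : ℚ.NonZero q
    q≢0 = pos⇒nonZero q
  eq : p * 1/ q * q ≡ p
  eq = trans (*-assoc p (1/ q) q) (trans (cong (p *_) (*-inverseˡ q)) (*-identityʳ p))

1/suc-pos : ∀ k → 0ℚ < ℤ.+ 1 / suc k
1/suc-pos k = positive⁻¹ (ℤ.+ 1 / suc k) {{normalize-pos 1 (suc k)}}

open +-*-Solver using (solve; _:=_; _:+_; _:*_; _:-_; :-_)

-- Clears all denominators from an instance of `≪` at ε = 1/(k + 1), where c is a rational that D
-- turns into a natural number.
≪⇒*< : ∀ k a b D c → fromℕ a < (ℤ.+ 1 / suc k) * c → c * fromℕ D ≡ fromℕ b → .{{_ : ℕ.NonZero D}} →
       suc k ℕ.* (a ℕ.* D) ℕ.< b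
≪⇒*< k a b D c a< cD≡b = fromℕ-cancel-< (suc k ℕ.* (a ℕ.* D)) b (subst₂ _<_
  (trans (cong (fromℕ (suc k) *_) (sym (fromℕ-* a D))) (sym (fromℕ-* (suc k) (a ℕ.* D))))
  (trans (rearrange (fromℕ (suc k)) (ℤ.+ 1 / suc k) c (fromℕ D))
    (trans (cong₂ _*_ (/-*-cancel 1 (suc k)) cD≡b) (*-identityˡ (fromℕ b))))
  (*-monoʳ-<-pos (fromℕ (suc k)) {{fromℕ-pos (suc k)}} (*-monoˡ-<-pos (fromℕ D) {{fromℕ-pos D}} a<)))
  where
  rearrange : ∀ k e c d → k * (e * c * d) ≡ e * k * (c * d)
  rearrange = solve 4 (λ k e c d → k :* (e :* c :* d) := e :* k :* (c :* d)) refl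

-- Falling factorials

interchange : ∀ a b c d → a * b * (c * d) ≡ a * c * (b * d)
interchange = solve 4 (λ a b c d → a :* b :* (c :* d) := a :* c :* (b :* d)) refl

-- The bound by a natural number makes every factor nonnegative, so the inequalities can be
-- multiplied.
fallingFactorial-lower : ∀ x a e k → (∀ i → i ℕ.< k → fromℕ a ≤ fromℕ e * (x - fromℕ i)) →
  fromℕ (a ^ k) ≤ fromℕ (e ^ k) * fallingFactorial x k
fallingFactorial-lower x a e zero    h = ≤-refl
fallingFactorial-lower x a e (suc k) h = begin
  fromℕ (a ℕ.* a ^ k)
    ≡⟨ fromℕ-* a (a ^ k) ⟩
  fromℕ a * fromℕ (a ^ k)
    ≤⟨ *-monoˡ-fromℕ a ih ⟩
  fromℕ a * (fromℕ (e ^ k) * fallingFactorial x k)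
    ≤⟨ *-monoʳ-≤-nonNeg (fromℕ (e ^ k) * fallingFactorial x k)
         {{ℚ.nonNegative (≤-trans (0≤fromℕ (a ^ k)) ih)}} (h k ℕₚ.≤-refl) ⟩
  fromℕ e * (x - fromℕ k) * (fromℕ (e ^ k) * fallingFactorial x k)
    ≡⟨ trans (interchange (fromℕ e) _ (fromℕ (e ^ k)) _) (cong₂ _*_ (sym (fromℕ-* e (e ^ k))) (*-comm (x - fromℕ k) _)) ⟩
  fromℕ (e ℕ.* e ^ k) * (fallingFactorial x k * (x - fromℕ k)) ∎
  where
  open ≤-Reasoning
  ih : fromℕ (a ^ k) ≤ fromℕ (e ^ k) * fallingFactorial x k
  ih = fallingFactorial-lower x a e k λ i i<k → h i (ℕₚ.≤-trans i<k (ℕₚ.n≤1+n k))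

-- Absolute values appear because x may be smaller than i: for δ close to t the number (t - δ) m
-- drops below s and the factors change sign.
fallingFactorial-upper : ∀ x a e k → (∀ i → i ℕ.< k → fromℕ e * ∣ x - fromℕ i ∣ ≤ fromℕ a) →
  fromℕ (e ^ k) * ∣ fallingFactorial x k ∣ ≤ fromℕ (a ^ k)
fallingFactorial-upper x a e zero    h = ≤-refl
fallingFactorial-upper x a e (suc k) h = begin
  fromℕ (e ℕ.* e ^ k) * ∣ fallingFactorial x k * (x - fromℕ k) ∣
    ≡⟨ cong₂ _*_ (fromℕ-* e (e ^ k)) (trans (∣p*q∣≡∣p∣*∣q∣ (fallingFactorial x k) (x - fromℕ k)) (*-comm (∣ fallingFactorial x k ∣) (∣ x - fromℕ k ∣))) ⟩
  fromℕ e * fromℕ (e ^ k) * (∣ x - fromℕ k ∣ * ∣ fallingFactorial x k ∣)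
    ≡⟨ interchange (fromℕ e) (fromℕ (e ^ k)) _ _ ⟩
  fromℕ e * ∣ x - fromℕ k ∣ * (fromℕ (e ^ k) * ∣ fallingFactorial x k ∣)
    ≤⟨ *-monoˡ-≤-nonNeg (fromℕ e * ∣ x - fromℕ k ∣)
         {{nonNeg*nonNeg⇒nonNeg (fromℕ e) {{fromℕ-nonNeg e}} ∣ x - fromℕ k ∣ {{∣-∣-nonNeg (x - fromℕ k)}}}}
         (fallingFactorial-upper x a e k λ i i<k → h i (ℕₚ.≤-trans i<k (ℕₚ.n≤1+n k))) ⟩
  fromℕ e * ∣ x - fromℕ k ∣ * fromℕ (a ^ k)
    ≤⟨ *-monoʳ-fromℕ (a ^ k) (h k ℕₚ.≤-refl) ⟩
  fromℕ a * fromℕ (a ^ k)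
    ≡⟨ fromℕ-* a (a ^ k) ⟨
  fromℕ (a ℕ.* a ^ k) ∎
  where open ≤-Reasoning

p≤∣p∣ : ∀ p → p ≤ ∣ p ∣
p≤∣p∣ p with ≤-total 0ℚ p
... | inj₁ 0≤p = ≤-reflexive (sym (0≤p⇒∣p∣≡p 0≤p))
... | inj₂ p≤0 = ≤-trans p≤0 (0≤∣p∣ p)

binom-≤ : ∀ x e .{{_ : ℕ.NonZero e}} s k → fromℕ (e ^ s) * fallingFactorial x s ≤ fromℕ (e ^ s ℕ.* (s ! ℕ.* k)) → binom x s ≤ fromℕ k
binom-≤ x e s k h = *-cancelʳ-≤-pos (fromℕ (s !)) {{fromℕ-pos (s !) {{s !≢0}}}} (begin
  fallingFactorial x s * r * fromℕ (s !)   ≡⟨ cancel ⟩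
  fallingFactorial x s                     ≤⟨ *-cancelˡ-≤-pos (fromℕ (e ^ s)) {{fromℕ-pos (e ^ s) {{m^n≢0 e s}}}} (≤-trans h (≤-reflexive (fromℕ-* (e ^ s) (s ! ℕ.* k)))) ⟩
  fromℕ (s ! ℕ.* k)                        ≡⟨ trans (cong fromℕ (ℕₚ.*-comm (s !) k)) (fromℕ-* k (s !)) ⟩
  fromℕ k * fromℕ (s !) ∎)
  where
  open ≤-Reasoning
  r : ℚ
  r = (ℤ.+ 1 / s !) {{s !≢0}}
  cancel : fallingFactorial x s * r * fromℕ (s !) ≡ fallingFactorial x s
  cancel = trans (*-assoc (fallingFactorial x s) r (fromℕ (s !)))
    (trans (cong (fallingFactorial x s *_) (/-*-cancel 1 (s !) {{s !≢0}})) (*-identityʳ (fallingFactorial x s)))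

≤-binom : ∀ x e .{{_ : ℕ.NonZero e}} s k → fromℕ (e ^ s ℕ.* (s ! ℕ.* k)) ≤ fromℕ (e ^ s) * fallingFactorial x s → fromℕ k ≤ binom x s
≤-binom x e s k h = *-cancelʳ-≤-pos (fromℕ (s !)) {{fromℕ-pos (s !) {{s !≢0}}}} (begin
  fromℕ k * fromℕ (s !)                    ≡⟨ trans (cong fromℕ (ℕₚ.*-comm (s !) k)) (fromℕ-* k (s !)) ⟨
  fromℕ (s ! ℕ.* k)                        ≤⟨ *-cancelˡ-≤-pos (fromℕ (e ^ s)) {{fromℕ-pos (e ^ s) {{m^n≢0 e s}}}} (≤-trans (≤-reflexive (sym (fromℕ-* (e ^ s) (s ! ℕ.* k)))) h) ⟩
  fallingFactorial x s                     ≡⟨ cancel ⟨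
  fallingFactorial x s * r * fromℕ (s !) ∎)
  where
  open ≤-Reasoning
  r : ℚ
  r = (ℤ.+ 1 / s !) {{s !≢0}}
  cancel : fallingFactorial x s * r * fromℕ (s !) ≡ fallingFactorial x s
  cancel = trans (*-assoc (fallingFactorial x s) r (fromℕ (s !)))
    (trans (cong (fallingFactorial x s *_) (/-*-cancel 1 (s !) {{s !≢0}})) (*-identityʳ (fallingFactorial x s)))

-- A positive rational is at least 1 over its denominator.
denominator-bound : ∀ δ → 0ℚ < δ → fromℕ 2 ≤ fromℕ (2 ℕ.* ℚ.↧ₙ δ) * δ
denominator-bound δ 0<δ = bound δ (ℚ.positive 0<δ)
  where
  open ≤-Reasoning
  bound : ∀ δ → Positive δ → fromℕ 2 ≤ fromℕ (2 ℕ.* ℚ.↧ₙ δ) * δ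
  bound δ@(mkℚ (ℤ.+ suc k) d c) _ = begin
    fromℕ 2                                     ≤⟨ fromℕ-mono 2 (2 ℕ.* suc k) (ℕₚ.*-monoʳ-≤ 2 (s≤s (z≤n {k}))) ⟩
    fromℕ (2 ℕ.* suc k)                         ≡⟨ fromℕ-* 2 (suc k) ⟩
    fromℕ 2 * fromℕ (suc k)                     ≡⟨ cong (fromℕ 2 *_) (/-*-cancel (suc k) (suc d)) ⟨
    fromℕ 2 * ((ℤ.+ suc k / suc d) * fromℕ (suc d))
      ≡⟨ cong (λ p → fromℕ 2 * (p * fromℕ (suc d))) (↥p/↧p≡p δ) ⟩
    fromℕ 2 * (δ * fromℕ (suc d))               ≡⟨ trans (cong (fromℕ 2 *_) (*-comm δ (fromℕ (suc d)))) (sym (*-assoc (fromℕ 2) (fromℕ (suc d)) δ)) ⟩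
    fromℕ 2 * fromℕ (suc d) * δ                 ≡⟨ cong (_* δ) (fromℕ-* 2 (suc d)) ⟨
    fromℕ (2 ℕ.* suc d) * δ ∎

-- From s-th powers to falling factorials, one factor at a time

module Rounding (t e s μ : ℕ) (δ : ℚ) (0<t : 0 ℕ.< t) (2≤e : 2 ℕ.≤ e) (2≤eδ : fromℕ 2 ≤ fromℕ e * δ) (es≤μ : e ℕ.* s ℕ.≤ μ) where

  open ≤-Reasoning

  -- Of e δ ≥ 2, one unit produces the `+ 1` in the natural number bound and the other absorbs e i ≤
  -- e s ≤ μ.
  upper-factor : ∀ i → i ℕ.< s →
    fromℕ ((t ℕ.* e ℕ.+ 1) ℕ.* μ) ≤ fromℕ e * ((fromℕ t + δ) * fromℕ μ - fromℕ i)
  upper-factor i i<s = +-cancel (fromℕ (e ℕ.* i)) (begin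
    fromℕ ((t ℕ.* e ℕ.+ 1) ℕ.* μ) + fromℕ (e ℕ.* i)
      ≡⟨ fromℕ-+ ((t ℕ.* e ℕ.+ 1) ℕ.* μ) (e ℕ.* i) ⟨
    fromℕ ((t ℕ.* e ℕ.+ 1) ℕ.* μ ℕ.+ e ℕ.* i)
      ≤⟨ fromℕ-mono ((t ℕ.* e ℕ.+ 1) ℕ.* μ ℕ.+ e ℕ.* i) ((t ℕ.* e ℕ.+ 1) ℕ.* μ ℕ.+ μ) (ℕₚ.+-monoʳ-≤ ((t ℕ.* e ℕ.+ 1) ℕ.* μ) (ℕₚ.≤-trans (ℕₚ.*-monoʳ-≤ e (ℕₚ.<⇒≤ i<s)) es≤μ)) ⟩
    fromℕ ((t ℕ.* e ℕ.+ 1) ℕ.* μ ℕ.+ μ)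
      ≡⟨ cong fromℕ (regroup t e μ) ⟩
    fromℕ ((e ℕ.* t ℕ.+ 2) ℕ.* μ)
      ≡⟨ trans (fromℕ-* (e ℕ.* t ℕ.+ 2) μ) (cong (_* fromℕ μ) (trans (fromℕ-+ (e ℕ.* t) 2) (cong (_+ fromℕ 2) (fromℕ-* e t)))) ⟩
    (fromℕ e * fromℕ t + fromℕ 2) * fromℕ μ
      ≤⟨ *-monoʳ-fromℕ μ (+-monoʳ-≤ (fromℕ e * fromℕ t) 2≤eδ) ⟩
    (fromℕ e * fromℕ t + fromℕ e * δ) * fromℕ μ
      ≡⟨ expand (fromℕ e) (fromℕ t) δ (fromℕ μ) (fromℕ i) ⟩
    fromℕ e * ((fromℕ t + δ) * fromℕ μ - fromℕ i) + fromℕ e * fromℕ i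
      ≡⟨ cong (fromℕ e * ((fromℕ t + δ) * fromℕ μ - fromℕ i) +_) (fromℕ-* e i) ⟨
    fromℕ e * ((fromℕ t + δ) * fromℕ μ - fromℕ i) + fromℕ (e ℕ.* i) ∎)
    where
    regroup : ∀ t e m → (t ℕ.* e ℕ.+ 1) ℕ.* m ℕ.+ m ≡ (e ℕ.* t ℕ.+ 2) ℕ.* m
    regroup = solve-∀
    expand : ∀ e t d m i → (e * t + e * d) * m ≡ e * ((t + d) * m - i) + e * i
    expand = solve 5 (λ e t d m i → (e :* t :+ e :* d) :* m := e :* ((t :+ d) :* m :- i) :+ e :* i) refl
    +-cancel : ∀ {p q} r → p + r ≤ q + r → p ≤ q
    +-cancel {p} {q} r h = subst₂ _≤_ (undo p r) (undo q r) (+-monoˡ-≤ (- r) h)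
      where
      undo : ∀ p r → p + r + - r ≡ p
      undo = solve 2 (λ p r → p :+ r :+ :- r := p) refl

  -- Since δ ≤ t, the number x = (t - δ) μ is nonnegative and ∣x - i∣ is at most x or at most i. The
  -- first case uses e δ ≥ 1; the second uses e i ≤ μ together with t e ≥ 2.
  lower-factor : δ ≤ fromℕ t → ∀ i → i ℕ.< s →
    fromℕ e * ∣ (fromℕ t - δ) * fromℕ μ - fromℕ i ∣ ≤ fromℕ ((t ℕ.* e ∸ 1) ℕ.* μ)
  lower-factor δ≤t i i<s = abs (∣p∣≡p∨∣p∣≡-p (x - fromℕ i))
    where
    a : ℕ
    a = (t ℕ.* e ∸ 1) ℕ.* μ
    x : ℚ
    x = (fromℕ t - δ) * fromℕ μ
    0≤t-δ : 0ℚ ≤ fromℕ t - δ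
    0≤t-δ = ≤-trans (≤-reflexive (sym (+-inverseʳ δ))) (+-monoˡ-≤ (- δ) δ≤t)
    2≤te : 2 ℕ.≤ t ℕ.* e
    2≤te = ℕₚ.≤-trans 2≤e (ℕₚ.m≤n*m e t {{ℕ.>-nonZero 0<t}})
    a+μ≡ : a ℕ.+ μ ≡ e ℕ.* t ℕ.* μ
    a+μ≡ = trans (ℕₚ.+-comm a μ) (cong (ℕ._* μ) (trans (ℕₚ.m+[n∸m]≡n (ℕₚ.≤-trans (ℕₚ.n≤1+n 1) 2≤te)) (ℕₚ.*-comm t e)))
    0≤x : 0ℚ ≤ x
    0≤x = ≤-trans (≤-reflexive (sym (*-zeroˡ (fromℕ μ)))) (*-monoʳ-fromℕ μ 0≤t-δ)
    ex≤a : fromℕ e * x ≤ fromℕ a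
    ex≤a = begin
      fromℕ e * x
        ≡⟨ expand (fromℕ e) (fromℕ t) δ (fromℕ μ) ⟩
      fromℕ e * fromℕ t * fromℕ μ + - (fromℕ e * δ) * fromℕ μ
        ≤⟨ +-monoʳ-≤ (fromℕ e * fromℕ t * fromℕ μ) (*-monoʳ-fromℕ μ (neg-antimono-≤ (≤-trans (fromℕ-mono 1 2 (ℕₚ.n≤1+n 1)) 2≤eδ))) ⟩
      fromℕ e * fromℕ t * fromℕ μ + - 1ℚ * fromℕ μ
        ≡⟨ cong₂ _+_ (trans (cong (_* fromℕ μ) (sym (fromℕ-* e t))) (sym (fromℕ-* (e ℕ.* t) μ))) (neg-one (fromℕ μ)) ⟩
      fromℕ (e ℕ.* t ℕ.* μ) + - fromℕ μ
        ≡⟨ cong (λ y → fromℕ y + - fromℕ μ) a+μ≡ ⟨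
      fromℕ (a ℕ.+ μ) + - fromℕ μ
        ≡⟨ cong (_+ - fromℕ μ) (fromℕ-+ a μ) ⟩
      fromℕ a + fromℕ μ + - fromℕ μ
        ≡⟨ trans (+-assoc (fromℕ a) _ _) (trans (cong (fromℕ a +_) (+-inverseʳ (fromℕ μ))) (+-identityʳ (fromℕ a))) ⟩
      fromℕ a ∎
      where
      expand : ∀ e t d m → e * ((t - d) * m) ≡ e * t * m + - (e * d) * m
      expand = solve 4 (λ e t d m → e :* ((t :- d) :* m) := e :* t :* m :+ :- (e :* d) :* m) refl
      neg-one : ∀ p → - 1ℚ * p ≡ - p
      neg-one p = trans (sym (neg-distribˡ-* 1ℚ p)) (cong -_ (*-identityˡ p))
    ei≤a : fromℕ e * fromℕ i ≤ fromℕ a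
    ei≤a = ≤-trans (≤-reflexive (sym (fromℕ-* e i))) (fromℕ-mono (e ℕ.* i) a (ℕₚ.≤-trans (ℕₚ.*-monoʳ-≤ e (ℕₚ.<⇒≤ i<s))
      (ℕₚ.≤-trans es≤μ (ℕₚ.m≤n*m μ (t ℕ.* e ∸ 1) {{ℕ.>-nonZero (ℕₚ.m<n⇒0<n∸m 2≤te)}}))))
    abs : ∣ x - fromℕ i ∣ ≡ x - fromℕ i ⊎ ∣ x - fromℕ i ∣ ≡ - (x - fromℕ i) → fromℕ e * ∣ x - fromℕ i ∣ ≤ fromℕ a
    abs (inj₁ eq) = begin
      fromℕ e * ∣ x - fromℕ i ∣   ≡⟨ cong (fromℕ e *_) eq ⟩
      fromℕ e * (x - fromℕ i)     ≤⟨ *-monoˡ-fromℕ e (≤-trans (+-monoʳ-≤ x (neg-antimono-≤ (0≤fromℕ i))) (≤-reflexive (+-identityʳ x))) ⟩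
      fromℕ e * x                 ≤⟨ ex≤a ⟩
      fromℕ a ∎
    abs (inj₂ eq) = begin
      fromℕ e * ∣ x - fromℕ i ∣   ≡⟨ cong (fromℕ e *_) (trans eq (flip x (fromℕ i))) ⟩
      fromℕ e * (- x + fromℕ i)   ≤⟨ *-monoˡ-fromℕ e (≤-trans (+-monoˡ-≤ (fromℕ i) (neg-antimono-≤ 0≤x)) (≤-reflexive (+-identityˡ (fromℕ i)))) ⟩
      fromℕ e * fromℕ i           ≤⟨ ei≤a ⟩
      fromℕ a ∎
      where
      flip : ∀ x i → - (x - i) ≡ - x + i
      flip = solve 2 (λ x i → :- (x :- i) := :- x :+ i) refl

-- The growth hypotheses as inequalities between natural numbers

module _ (s : (n : ℕ) .{{_ : ℕ.NonZero n}} → ℕ) (s≢0 : (n : ℕ) .{{_ : ℕ.NonZero n}} → ℕ.NonZero (s n))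
         (n : ℕ) .{{_ : ℕ.NonZero n}} (t K : ℕ) where

  private
    instance
      nᵗ≢0 : ℕ.NonZero (n ^ t)
      nᵗ≢0 = m^n≢0 n t
    ε : ℚ
    ε = ℤ.+ 1 / suc K

  s-large : (at (m/n^ t) n ÷ fromℕ (s n)) {{pos⇒nonZero (fromℕ (s n)) {{pos (natSeq s s≢0) n}}}} < ε →
            K ℕ.* m n ℕ.≤ s n ℕ.* n ^ t
  s-large small = ℕₚ.≤-trans (ℕₚ.*-monoˡ-≤ (m n) (ℕₚ.n≤1+n K)) (ℕₚ.≤-trans
    (ℕₚ.*-monoʳ-≤ (suc K) (ℕₚ.≤-reflexive (sym (ℕₚ.*-identityʳ (m n)))))
    (ℕₚ.<⇒≤ (≪⇒*< K (m n) (s n ℕ.* n ^ t) 1 (fromℕ (s n) * fromℕ (n ^ t))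
      (subst₂ _<_ (/-*-cancel (m n) (n ^ t)) (*-assoc ε (fromℕ (s n)) (fromℕ (n ^ t)))
        (*-monoˡ-<-pos (fromℕ (n ^ t)) {{fromℕ-pos (n ^ t)}}
          (÷<⇒<* (at (m/n^ t) n) (fromℕ (s n)) ε {{pos (natSeq s s≢0) n}} small)))
      (trans (*-identityʳ (fromℕ (s n) * fromℕ (n ^ t))) (sym (fromℕ-* (s n) (n ^ t)))))))

  s-small : (fromℕ (s n) ÷ at (m/n^ t) n) {{pos⇒nonZero (at (m/n^ t) n) {{pos (m/n^ t) n}}}} < ε →
            K ℕ.* (s n ℕ.* n ^ t) ℕ.≤ m n
  s-small small = ℕₚ.≤-trans (ℕₚ.*-monoˡ-≤ (s n ℕ.* n ^ t) (ℕₚ.n≤1+n K)) (ℕₚ.<⇒≤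
    (≪⇒*< K (s n) (m n) (n ^ t) (at (m/n^ t) n)
      (÷<⇒<* (fromℕ (s n)) (at (m/n^ t) n) ε {{pos (m/n^ t) n}} small) (/-*-cancel (m n) (n ^ t))))

-- The constant `K + e` serves two purposes: K is what the lower bound asks for, and e yields e s ≤
-- m, which the passage to falling factorials needs and which contains s ≤ m.
#antichains-bounds : ∀ τ n s δ K (let e = 2 ℕ.* ℚ.↧ₙ δ) → 0 ℕ.< n → 0ℚ < δ →
  (K ℕ.+ e) ℕ.* (s ℕ.* n ^ τ) ℕ.≤ m n →
  (s ℕ.≤ m n → e ^ s ℕ.* (s ! ℕ.* #antichains n s) ℕ.≤ ((suc τ ℕ.* e ℕ.+ 1) ℕ.* m n) ^ s) →
  (K ℕ.* s ℕ.* n ^ τ ℕ.≤ m n → ((suc τ ℕ.* e ∸ 1) ℕ.* m n) ^ s ℕ.≤ e ^ s ℕ.* (s ! ℕ.* #antichains n s)) →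
  (δ ≤ fromℕ (suc τ) → binom ((fromℕ (suc τ) - δ) * fromℕ (m n)) s ≤ fromℕ (#antichains n s)) ×
  fromℕ (#antichains n s) ≤ binom ((fromℕ (suc τ) + δ) * fromℕ (m n)) s
#antichains-bounds τ n s δ K 0<n 0<δ small upper lower =
  (λ δ≤t → binom-≤ x e s k (begin
    fromℕ (e ^ s) * fallingFactorial x s        ≤⟨ *-monoˡ-fromℕ (e ^ s) (p≤∣p∣ (fallingFactorial x s)) ⟩
    fromℕ (e ^ s) * ∣ fallingFactorial x s ∣    ≤⟨ fallingFactorial-upper x a e s (Factors.lower-factor δ≤t) ⟩
    fromℕ (a ^ s)                               ≤⟨ fromℕ-mono (a ^ s) _ (lower (ℕₚ.≤-trans (ℕₚ.≤-reflexive (ℕₚ.*-assoc K s (n ^ τ))) (ℕₚ.≤-trans (ℕₚ.*-monoˡ-≤ (s ℕ.* n ^ τ) (ℕₚ.m≤m+n K e)) small))) ⟩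
    fromℕ (e ^ s ℕ.* (s ! ℕ.* k)) ∎)) ,
  ≤-binom y e s k (begin
    fromℕ (e ^ s ℕ.* (s ! ℕ.* k))               ≤⟨ fromℕ-mono (e ^ s ℕ.* (s ! ℕ.* k)) (b ^ s) (upper s≤m) ⟩
    fromℕ (b ^ s)                               ≤⟨ fallingFactorial-lower y b e s Factors.upper-factor ⟩
    fromℕ (e ^ s) * fallingFactorial y s ∎)
  where
  open ≤-Reasoning
  e k a b : ℕ
  e = 2 ℕ.* ℚ.↧ₙ δ
  k = #antichains n s
  a = (suc τ ℕ.* e ∸ 1) ℕ.* m n
  b = (suc τ ℕ.* e ℕ.+ 1) ℕ.* m n
  x y : ℚ
  x = (fromℕ (suc τ) - δ) * fromℕ (m n)
  y = (fromℕ (suc τ) + δ) * fromℕ (m n)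
  es≤m : e ℕ.* s ℕ.≤ m n
  es≤m = ℕₚ.≤-trans (ℕₚ.*-mono-≤ (ℕₚ.m≤n+m e K) (ℕₚ.m≤m*n s (n ^ τ) {{m^n≢0 n τ {{ℕ.>-nonZero 0<n}}}})) small
  s≤m : s ℕ.≤ m n
  s≤m = ℕₚ.≤-trans (ℕₚ.m≤n*m s e) es≤m
  module Factors = Rounding (suc τ) e s (m n) δ (s≤s z≤n) (ℕₚ.m≤m*n 2 (ℚ.↧ₙ δ)) (denominator-bound δ 0<δ) es≤m

proposition3 : (t : ℕ) .{{_ : ℕ.NonZero t}}
    (s : (n : ℕ) .{{_ : ℕ.NonZero n}} → ℕ)
    (s≢0 : (n : ℕ) .{{_ : ℕ.NonZero n}} → ℕ.NonZero (s n)) →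
    m/n^ t ≪ natSeq s s≢0 →
    natSeq s s≢0 ≪ m/n^ (t ∸ 1) →
    (δ : ℚ) → 0ℚ < δ →
    ∃[ N ] ∀ (n : ℕ) .{{_ : ℕ.NonZero n}} → N ℕ.≤ n →
    (δ ≤ fromℕ t → binom ((fromℕ t - δ) * fromℕ (m n)) (s n) ≤ fromℕ (#antichains n (s n))) ×
    fromℕ (#antichains n (s n)) ≤ binom ((fromℕ t + δ) * fromℕ (m n)) (s n)
proposition3 zero    s s≢0 m/nᵗ≪s s≪m/nᵗ⁻¹ δ 0<δ = ⊥-elim (ℕ.≢-nonZero⁻¹ 0 refl)
proposition3 (suc τ) s s≢0 m/nᵗ≪s s≪m/nᵗ⁻¹ δ 0<δ =
  let e = 2 ℕ.* ℚ.↧ₙ δ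
      Kᵘ , Nᵘ , upper = #antichains-upper τ (ℕ.pred e)
      Kˡ , Nˡ , lower = #antichains-lower τ e (s≤s z≤n)
      N₁ , large = m/nᵗ≪s (ℤ.+ 1 / suc Kᵘ) (1/suc-pos Kᵘ)
      N₂ , small = s≪m/nᵗ⁻¹ (ℤ.+ 1 / suc (Kˡ ℕ.+ e)) (1/suc-pos (Kˡ ℕ.+ e))
  in Nᵘ ℕ.+ Nˡ ℕ.+ (N₁ ℕ.+ N₂) , λ n N≤n →
     let 0<n = ℕ.>-nonZero⁻¹ n
         Nᵘˡ≤n = ℕₚ.m+n≤o⇒m≤o (Nᵘ ℕ.+ Nˡ) N≤n
         N₁₂≤n = ℕₚ.m+n≤o⇒n≤o (Nᵘ ℕ.+ Nˡ) N≤n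
     in #antichains-bounds τ n (s n) δ Kˡ 0<n 0<δ
          (s-small s s≢0 n τ (Kˡ ℕ.+ e) (small n (ℕₚ.m+n≤o⇒n≤o N₁ N₁₂≤n)))
          (λ s≤m → upper n (s n) (ℕₚ.m+n≤o⇒m≤o Nᵘ Nᵘˡ≤n) (ℕ.>-nonZero⁻¹ (s n) {{s≢0 n}}) s≤m
            (s-large s s≢0 n (suc τ) Kᵘ (large n (ℕₚ.m+n≤o⇒m≤o N₁ N₁₂≤n))))
          (lower n (s n) 0<n (ℕₚ.m+n≤o⇒n≤o Nᵘ Nᵘˡ≤n))
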